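{- Let $A^{\{1,3\}}_{132}(z)=\sum_{n\ge0}a_n z^n$, where $a_n$ is the number of permutations $\pi\in\mathfrak{S}_n$ that avoid $132$ and all of whose cycles have length $1$ or $3$ (with $a_0=1$). Let $c(x)=\frac{1-\sqrt{1-4x}}{2x}$ be the generating function of the Catalan numbers, let \[m(t,x)=\dfrac{2}{1-2tx+x+\sqrt{1-2x-3x^2}},\] and let $F(t,x)=1+xt\,m(t,x)$. Then \[ A^{\{1,3\}}_{132}(z)=\frac{1}{1-z}\,F\!\left(\frac{2}{1-z},\,c(z^3)-1\right), \] and equivalently \[ A^{\{1,3\}}_{132}(z)=\dfrac{c(z^3)}{\sqrt{c(z^3)\,(4-3c(z^3))}-z\,c(z^3)}. \]
   Context: $\mathfrak{S}_n$ is the symmetric group on $[n]$, with permutations written in one-line notation $\pi_1\cdots\pi_n$. A permutation contains a pattern $\sigma$ if some subsequence of its one-line notation is in the same relative order as $\sigma$; otherwise it avoids $\sigma$. The function $m(t,x)$ is the bivariate generating function $\sum_{k,j}M_{k,j}x^kt^j$ where $M_{k,j}$ is the number of Motzkin paths of length $k$ with exactly $j$ flat steps at height zero. -}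

module Defs where

open import Algebra.Bundles.Raw using (RawRing)
open import Algebra.Definitions using (LeftInvertible)
import Algebra.Definitions.RawSemiring as RawSemiringOps
open import Data.Fin.Base as Fin using (Fin; toℕ; punchIn; finToFun; funToFin)
open import Data.Fin.Patterns using (0F; 1F; 2F)
open import Data.Fin.Permutation as Perm
  using (Permutation′; _⟨$⟩ʳ_; transpose; insert; remove; insert-remove; insert-punchIn)
open import Data.Fin.Properties as Finₚ
  using (all?; any?; finToFun-funToFin; punchIn-injective)
import Data.Integer.Base as ℤ
open import Data.List.Base
  using (List; []; _∷_; map; length; filter; allFin; cartesianProductWith)
open import Data.List.Membership.Propositional.Properties using (∈-allFin)
import Data.List.Membership.Setoid as Membership
open import Data.List.Membership.Setoid.Properties using (∈-cartesianProductWith⁺; ∈-resp-≈)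
import Data.List.Relation.Unary.All as All
import Data.List.Relation.Unary.AllPairs as AllPairs
open import Data.List.Relation.Unary.Any as Any using (Any; here)
import Data.List.Relation.Unary.Unique.Setoid as Unique
open import Data.List.Relation.Unary.Unique.Propositional.Properties using (allFin⁺)
open import Data.List.Relation.Unary.Unique.Setoid.Properties using (cartesianProductWith⁺)
open import Data.Nat.Base as ℕ using (ℕ; zero; suc; _∸_)
import Data.Nat.Properties as ℕₚ
open import Data.Product.Base using (∃; _×_; _,_)
open import Data.Rational.Base as ℚ using (ℚ; 0ℚ; 1ℚ; ½)
import Data.Rational.Properties as ℚₚ
open import Function.Bundles using (_⇔_; mk⇔; module Equivalence)
import Function.Endo.Propositional as Endo
open import Level using (0ℓ)
open import Relation.Binary.Bundles using (Setoid)
open import Relation.Binary.PropositionalEquality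
  using (_≡_; _≢_; refl; sym; trans; cong; subst; subst₂; setoid)
open import Relation.Nullary using (¬_; Dec)
open import Relation.Nullary.Decidable using (map′; ¬?; _×-dec_; _→-dec_)

------------------------------------------------------------------------
-- Permutations: patterns and cycles

-- f picks out the positions of a subsequence of the one-line notation of π
-- that is in the same relative order as σ.
IsOccurrence : ∀ {k n} → Permutation′ k → Permutation′ n → (Fin k → Fin n) → Set
IsOccurrence σ π f =
    (∀ a b → a Fin.< b → f a Fin.< f b)
  × (∀ a b → (σ ⟨$⟩ʳ a Fin.< σ ⟨$⟩ʳ b) ⇔ (π ⟨$⟩ʳ f a Fin.< π ⟨$⟩ʳ f b))

Contains : ∀ {k n} → Permutation′ k → Permutation′ n → Set
Contains σ π = ∃ λ f → IsOccurrence σ π f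

Avoids : ∀ {k n} → Permutation′ k → Permutation′ n → Set
Avoids σ π = ¬ Contains σ π

-- Positions and values are numbered from 0.
pattern132 : Permutation′ 3
pattern132 = transpose 1F 2F

IsCycleLength : ∀ {n} → Permutation′ n → Fin n → ℕ → Set
IsCycleLength {n} π i ℓ =
    0 ℕ.< ℓ
  × (π^ ℓ) i ≡ i
  × (∀ {m} → m ℕ.< ℓ → 0 ℕ.< m → (π^ m) i ≢ i)
  where
  π^ : ℕ → Fin n → Fin n
  π^ m = Endo._^_ (Fin n) (π ⟨$⟩ʳ_) m

CycleLengthsIn : ∀ {n} → List ℕ → Permutation′ n → Set
CycleLengthsIn S π = ∀ i → Any (IsCycleLength π i) S

isOccurrence? : ∀ {k n} (σ : Permutation′ k) (π : Permutation′ n) f →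
                Dec (IsOccurrence σ π f)
isOccurrence? σ π f =
  (all? λ a → all? λ b → (a Finₚ.<? b) →-dec (f a Finₚ.<? f b))
  ×-dec
  (all? λ a → all? λ b →
    let s = (σ ⟨$⟩ʳ a) Finₚ.<? (σ ⟨$⟩ʳ b)
        p = (π ⟨$⟩ʳ f a) Finₚ.<? (π ⟨$⟩ʳ f b)
    in map′ (λ (to , from) → mk⇔ to from)
            (λ e → Equivalence.to e , Equivalence.from e)
            ((s →-dec p) ×-dec (p →-dec s)))

avoids? : ∀ {k n} (σ : Permutation′ k) (π : Permutation′ n) → Dec (Avoids σ π)
avoids? {k} {n} σ π = ¬? (map′ (λ (c , o) → finToFun c , o) encode
                               (any? λ c → isOccurrence? σ π (finToFun c)))
  where
  encode : Contains σ π → ∃ λ (c : Fin (n ℕ.^ k)) → IsOccurrence σ π (finToFun c)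
  encode (f , inc , ord) = funToFin f , inc′ , ord′
    where
    eq : ∀ a → f a ≡ finToFun (funToFin f) a
    eq a = sym (finToFun-funToFin f a)

    inc′ : ∀ a b → a Fin.< b → finToFun (funToFin f) a Fin.< finToFun (funToFin f) b
    inc′ a b a<b = subst₂ Fin._<_ (eq a) (eq b) (inc a b a<b)

    ord′ : ∀ a b → (σ ⟨$⟩ʳ a Fin.< σ ⟨$⟩ʳ b)
                 ⇔ (π ⟨$⟩ʳ finToFun (funToFin f) a Fin.< π ⟨$⟩ʳ finToFun (funToFin f) b)
    ord′ a b = subst₂ (λ u v → (σ ⟨$⟩ʳ a Fin.< σ ⟨$⟩ʳ b) ⇔ (π ⟨$⟩ʳ u Fin.< π ⟨$⟩ʳ v))
                      (eq a) (eq b) (ord a b)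

isCycleLength? : ∀ {n} (π : Permutation′ n) i ℓ → Dec (IsCycleLength π i ℓ)
isCycleLength? {n} π i ℓ =
  (0 ℕₚ.<? ℓ)
  ×-dec (_ Finₚ.≟ i)
  ×-dec ℕₚ.allUpTo? (λ m → (0 ℕₚ.<? m) →-dec ¬? (_ Finₚ.≟ i)) ℓ

cycleLengthsIn? : ∀ {n} S (π : Permutation′ n) → Dec (CycleLengthsIn S π)
cycleLengthsIn? S π = all? λ i → Any.any? (isCycleLength? π i) S

-- The elements of 𝔖ₙ, each exactly once up to pointwise equality
-- (∈-permutations and permutations-unique below): a permutation of suc n is
-- determined by the image j of 0 and by what remains when 0 and j are deleted.
permutations : ∀ n → List (Permutation′ n)
permutations zero    = Perm.id ∷ []
permutations (suc n) = cartesianProductWith (insert 0F) (allFin (suc n)) (permutations n)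

permutationSetoid : ℕ → Setoid 0ℓ 0ℓ
permutationSetoid n = record
  { Carrier       = Permutation′ n
  ; _≈_           = Perm._≈_
  ; isEquivalence = record
    { refl  = λ i → refl
    ; sym   = λ p i → sym (p i)
    ; trans = λ p q i → trans (p i) (q i)
    }
  }

private
  insert-cong : ∀ {n} {j k : Fin (suc n)} {π ρ : Permutation′ n} →
                j ≡ k → π Perm.≈ ρ → insert 0F j π Perm.≈ insert 0F k ρ
  insert-cong         refl π≈ρ 0F          = refl
  insert-cong {j = j} refl π≈ρ (Fin.suc i) = cong (punchIn j) (π≈ρ i)

  insert-injective : ∀ {n} {j k : Fin (suc n)} {π ρ : Permutation′ n} →
                     insert 0F j π Perm.≈ insert 0F k ρ → j ≡ k × π Perm.≈ ρ
  insert-injective {j = j} {π = π} {ρ} e with e 0F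
  ... | refl = refl , λ i → punchIn-injective j _ _
    (trans (sym (insert-punchIn 0F j π i)) (trans (e (Fin.suc i)) (insert-punchIn 0F j ρ i)))

∈-permutations : ∀ {n} (π : Permutation′ n) →
                 Membership._∈_ (permutationSetoid n) π (permutations n)
∈-permutations {zero}  π = here λ ()
∈-permutations {suc n} π =
  ∈-resp-≈ (permutationSetoid (suc n))
    {x = insert 0F (π ⟨$⟩ʳ 0F) (remove 0F π)} {y = π} (insert-remove 0F π)
    (∈-cartesianProductWith⁺ (setoid _) (permutationSetoid n) (permutationSetoid (suc n))
      (λ {_} {_} {π} {ρ} → insert-cong {π = π} {ρ})
      (∈-allFin (π ⟨$⟩ʳ 0F)) (∈-permutations (remove 0F π)))

permutations-unique : ∀ n → Unique.Unique (permutationSetoid n) (permutations n)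
permutations-unique zero    = All.[] AllPairs.∷ AllPairs.[]
permutations-unique (suc n) =
  cartesianProductWith⁺ (setoid _) (permutationSetoid n) (permutationSetoid (suc n))
    (insert 0F) (λ {_} {_} {π} {ρ} → insert-injective {π = π} {ρ})
    (allFin⁺ (suc n)) (permutations-unique n)

numberAvoiding : ∀ {k} → Permutation′ k → List ℕ → ℕ → ℕ
numberAvoiding σ S n =
  length (filter (λ π → avoids? σ π ×-dec cycleLengthsIn? S π) (permutations n))

------------------------------------------------------------------------
-- Formal power series

module RingNotation {c ℓ} (R : RawRing c ℓ) where
  open RawRing R public
  open RawSemiringOps rawSemiring public using (_^_; sum)

  infixl 6 _-_
  _-_ : Carrier → Carrier → Carrier
  a - b = a + - b

  infix 9 #_
  #_ : ℕ → Carrier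
  # n = RawSemiringOps._×_ rawSemiring n 1#

-- R⟦x⟧, a series being the function from exponents to coefficients.
module PowerSeries {c ℓ} (R : RawRing c ℓ) where
  private module R = RingNotation R

  Series : Set c
  Series = ℕ → R.Carrier

  infixr 5 _⊲_
  -- a ⊲ f is a + x f.
  _⊲_ : R.Carrier → Series → Series
  (a ⊲ f) zero    = a
  (a ⊲ f) (suc n) = f n

  tail : Series → Series
  tail f n = f (suc n)

  const : R.Carrier → Series
  const a = a ⊲ λ _ → R.0#

  x : Series
  x = R.0# ⊲ const R.1#

  seriesRing : RawRing c ℓ
  seriesRing = record
    { Carrier = Series
    ; _≈_     = λ f g → ∀ n → f n R.≈ g n
    ; _+_     = λ f g n → f n R.+ g n
    ; _*_     = λ f g n → R.sum {suc n} λ i → f (toℕ i) R.* g (n ∸ toℕ i)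
    ; -_      = λ f n → R.- f n
    ; 0#      = const R.0#
    ; 1#      = const R.1#
    }

  open RingNotation seriesRing hiding (Carrier; sum; _^_; #_)

  -- If the coefficients of Φ f up to xⁿ depend only on those of f below xⁿ,
  -- then Φ has a unique fixed point and it agrees with Φⁿ⁺¹(0) up to xⁿ.
  fixpoint : (Series → Series) → Series
  fixpoint Φ n = Endo._^_ Series Φ (suc n) 0# n

  -- f / g, where g = g₀ + x g′ and u g₀ = 1: the inverse h of g is the solution
  -- of h = u (1 - x g′ h).
  divide : (f g : Series) → LeftInvertible R._≈_ R.1# R._*_ (g 0) → Series
  divide f g (u , _) = f * fixpoint λ h → const u * (1# - (R.0# ⊲ tail g * h))

------------------------------------------------------------------------
-- ℚ⟦z⟧; the indeterminate is called x or z as convenient.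

open PowerSeries ℚ.+-*-rawRing public
  using (Series; _⊲_; tail; const; fixpoint; divide; seriesRing)
  renaming (x to z)

open RingNotation seriesRing public
  using (_≈_; _+_; _*_; -_; _-_; _^_; #_; 1#)

infixl 7 _/_
_/_ : (f g : Series) → .{{ℚ.NonZero (g 0)}} → Series
f / g = divide f g ((ℚ.1/ g 0) , ℚₚ.*-inverseˡ (g 0))

-- The square root with constant term 1: for f = 1 + x f′ it is 1 + x r, where
-- r = (f′ - x r²) / 2.
√ : (f : Series) → f 0 ≡ 1ℚ → Series
√ f _ = 1ℚ ⊲ fixpoint λ r → const ½ * (tail f - (0ℚ ⊲ r * r))

-- For a homomorphism φ from the coefficients of f to ℚ⟦z⟧ this is ∑ φ(fₖ) Xᵏ.
-- As X has no constant term, Xᵏ does not contribute to zⁿ for k > n.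
substitute : ∀ {a} {A : Set a} → (A → Series) → (ℕ → A) →
             (X : Series) → X 0 ≡ 0ℚ → Series
substitute φ f X _ n = RingNotation.sum ℚ.+-*-rawRing {suc n} λ k →
  (φ (f (toℕ k)) * X ^ toℕ k) n

compose : Series → (X : Series) → X 0 ≡ 0ℚ → Series
compose = substitute const

-- c(x) = (1 - √(1 - 4x)) / 2x. The numerator has no constant term, so dividing
-- it by x is taking its tail.
c : Series
c = const ½ * tail (1# - √ (1# - # 4 * z) refl)

------------------------------------------------------------------------
-- ℚ[t]⟦x⟧. Coefficients in ℚ[t], rather than ℚ⟦t⟧, allow substituting for t a
-- series with nonzero constant term.

-- a₀ ∷ a₁ ∷ ⋯ is a₀ + a₁ t + ⋯; trailing zeros are allowed.
Polynomial : Set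
Polynomial = List ℚ

coefficient : Polynomial → ℕ → ℚ
coefficient []      j       = 0ℚ
coefficient (a ∷ p) zero    = a
coefficient (a ∷ p) (suc j) = coefficient p j

addᴾ : Polynomial → Polynomial → Polynomial
addᴾ []      q       = q
addᴾ (a ∷ p) []      = a ∷ p
addᴾ (a ∷ p) (b ∷ q) = a ℚ.+ b ∷ addᴾ p q

mulᴾ : Polynomial → Polynomial → Polynomial
mulᴾ []      q = []
mulᴾ (a ∷ p) q = addᴾ (map (a ℚ.*_) q) (0ℚ ∷ mulᴾ p q)

polynomialRing : RawRing 0ℓ 0ℓ
polynomialRing = record
  { Carrier = Polynomial
  ; _≈_     = λ p q → ∀ j → coefficient p j ≡ coefficient q j
  ; _+_     = addᴾ
  ; _*_     = mulᴾ
  ; -_      = map λ a → ℚ.- a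
  ; 0#      = []
  ; 1#      = 1ℚ ∷ []
  }

evaluate : Series → Polynomial → Series
evaluate T []      = # 0
evaluate T (a ∷ p) = const a + T * evaluate T p

module Bivariate where
  private
    module P = PowerSeries polynomialRing
    module B = RingNotation P.seriesRing

  BivariateSeries : Set
  BivariateSeries = P.Series

  t x : BivariateSeries
  t = P.const (0ℚ ∷ 1ℚ ∷ [])
  x = P.x

  fromUnivariate : Series → BivariateSeries
  fromUnivariate f k = f k ∷ []

  denominator : BivariateSeries
  denominator =
    B.# 1 B.- B.# 2 B.* t B.* x B.+ x
    B.+ fromUnivariate (√ (# 1 - # 2 * z - # 3 * z ^ 2) refl)

  -- 2 / (1 - 2tx + x + √(1 - 2x - 3x²)), whose denominator has constant term 2.
  m : BivariateSeries
  m = P.divide (B.# 2) denominator (½ ∷ [] , λ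
    { 0             → refl
    ; 1             → refl
    ; (suc (suc j)) → refl
    })

  F : BivariateSeries
  F = B.# 1 B.+ x B.* t B.* m

  infix 10 _⟨_,_⟩[_]
  -- f ⟨ T , X ⟩[ p ] is f(T, X).
  _⟨_,_⟩[_] : BivariateSeries → (T X : Series) → X 0 ≡ 0ℚ → Series
  f ⟨ T , X ⟩[ p ] = substitute (evaluate T) f X p

open Bivariate public using (BivariateSeries; m; F; _⟨_,_⟩[_])

A132 : List ℕ → Series
A132 S n = ℤ.+ numberAvoiding pattern132 S n ℚ./ 1

c[z³] : Series
c[z³] = compose c (z ^ 3) refl

-- Let m be the side of the largest empty square in the lower left corner of the
-- diagram of π. If π avoids 132, its points above and to the right of this square
-- increase; if moreover π³ = 1, the positions outside the square are of three
-- kinds: images a of the first m positions, preimages b of these, and fixed points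
-- g, where π maps the i-th a to the i-th b and at each g as many a as b have
-- occurred. The remaining datum is the 132-avoiding permutation β taking the i-th
-- b to its image. The condition on π as a whole is that the i-th and (i+1)-st a (or
-- b) may be separated only where β is cut into skew components. So π amounts to a
-- sequence of skew-indecomposable 132-avoiding permutations, counted by w = y c(y)
-- with y = z³, and a walk with as many up as down steps and level steps at height
-- 0, one up and one down step for each component. Splitting off the first step gives
-- A = 1 + z A + 2 w D A with D = c(w), whence A (√(1 - 4w) - z) = 1; and
-- c² (1 - 4w) = c (4 - 3c) for c = c(y).
module Submission where

-- The walk counts components, whereas the word of π consists of single positions: one step expands
-- to a block of equal letters. The two readings collide at the fixed points, which the walk allows
-- where equally many components of both copies of β remain, and π where equally many positions
-- remain. They agree because the two unread parts are suffixes of one sequence of components, along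
-- which both numbers decrease strictly.
--
-- The factor D is not obtained by cutting a word at its first return. Let E_h count the walks at
-- height h. The first step gives E_(h+1) = E_h + w E_(h+2), a system that runs upwards without end;
-- since w has no constant term it determines every E_h from E_0, and D^h E_0 is a solution by D = 1
-- + w D².
--
-- Both closed forms are then algebra over ℚ⟦z⟧, and no Motzkin path is drawn. With X = C - 1 the
-- radicand 1 - 2X - 3X² of m becomes C (4 - 3C), so the root in m and the root in the second form
-- are the same series; every identification of roots rests on the constant term 1.

-- Ring solver with integer coefficients for an arbitrary commutative ring

module IntegerSolver where

  open import Algebra.Bundles using (CommutativeRing)
  open import Algebra.Bundles.Raw using (RawRing)
  open import Level using (0ℓ)

  module RingSolver {c ℓ} (R : CommutativeRing c ℓ) where
    open import Algebra.Solver.Ring.AlmostCommutativeRing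
      using (AlmostCommutativeRing; fromCommutativeRing; _-Raw-AlmostCommutative⟶_)
    open import Data.Maybe.Base using (Maybe; just; nothing)
    open import Data.Nat.Base as ℕ using (ℕ; suc)
    import Data.Nat.Properties as ℕₚ
    open import Data.Product.Base using (_×_; _,_)
    open import Relation.Binary.PropositionalEquality.Core using (_≡_)
    open import Relation.Nullary.Decidable.Core using (yes; no)
    open CommutativeRing R
    open import Algebra.Definitions.RawMonoid +-rawMonoid using () renaming (_×_ to _·_)
    open import Algebra.Properties.AbelianGroup +-abelianGroup
      using (⁻¹-∙-comm; ε⁻¹≈ε; ⁻¹-anti-homo‿-)
    open import Algebra.Properties.CommutativeSemigroup +-commutativeSemigroup using (interchange)
    open import Algebra.Properties.Ring ring using (-‿distribˡ-*; -‿distribʳ-*)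
    open import Algebra.Properties.Semiring.Mult semiring using (×-homo-+; ×1-homo-*; ×-congˡ)
    open import Relation.Binary.Reasoning.Setoid setoid

    -- (a , b) stands for the integer a - b. The solver compares coefficients
    -- syntactically, so they are kept with a or b zero.
    normal : ℕ × ℕ → ℕ × ℕ
    normal (suc a , suc b) = normal (a , b)
    normal x               = x

    differences : RawRing 0ℓ 0ℓ
    differences = record
      { Carrier = ℕ × ℕ
      ; _≈_     = _≡_
      ; _+_     = λ (a , b) (a′ , b′) → normal (a ℕ.+ a′ , b ℕ.+ b′)
      ; _*_     = λ (a , b) (a′ , b′) →
                    normal (a ℕ.* a′ ℕ.+ b ℕ.* b′ , a ℕ.* b′ ℕ.+ b ℕ.* a′)
      ; -_      = λ (a , b) → b , a
      ; 0#      = 0 , 0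
      ; 1#      = 1 , 0
      }

    private
      module D = RawRing differences

      ι : ℕ → Carrier
      ι n = n · 1#

      difference : ℕ × ℕ → Carrier
      difference (a , b) = ι a - ι b

      -- The first clause makes the value of (n , 0) the multiple n · 1# itself.
      value : ℕ × ℕ → Carrier
      value (a , 0)     = ι a
      value (a , suc b) = ι a - ι (suc b)

      value≈ : ∀ x → value x ≈ difference x
      value≈ (a , 0)     = sym (trans (+-congˡ ε⁻¹≈ε) (+-identityʳ _))
      value≈ (a , suc b) = refl

      -‿+ : ∀ a b c d → (a + b) - (c + d) ≈ (a - c) + (b - d)
      -‿+ a b c d = trans (+-congˡ (sym (⁻¹-∙-comm c d))) (interchange a b (- c) (- d))

      difference-normal : ∀ x → difference (normal x) ≈ difference x
      difference-normal (0     , b)     = refl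
      difference-normal (suc a , 0)     = refl
      difference-normal (suc a , suc b) = begin
        difference (normal (a , b))    ≈⟨ difference-normal (a , b) ⟩
        ι a - ι b                      ≈⟨ +-identityˡ _ ⟨
        0# + (ι a - ι b)               ≈⟨ +-congʳ (-‿inverseʳ 1#) ⟨
        (1# - 1#) + (ι a - ι b)        ≈⟨ -‿+ _ _ _ _ ⟨
        (1# + ι a) - (1# + ι b)        ∎

      +-homo : ∀ x y → difference (x D.+ y) ≈ difference x + difference y
      +-homo (a , b) (c , d) = trans (difference-normal (a ℕ.+ c , b ℕ.+ d)) (
        trans (+-cong (×-homo-+ 1# a c) (-‿cong (×-homo-+ 1# b d))) (-‿+ _ _ _ _))

      *-homo : ∀ x y → difference (x D.* y) ≈ difference x * difference y
      *-homo (a , b) (c , d) = begin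
        difference (normal (a ℕ.* c ℕ.+ b ℕ.* d , a ℕ.* d ℕ.+ b ℕ.* c))
          ≈⟨ difference-normal (a ℕ.* c ℕ.+ b ℕ.* d , a ℕ.* d ℕ.+ b ℕ.* c) ⟩
        ι (a ℕ.* c ℕ.+ b ℕ.* d) - ι (a ℕ.* d ℕ.+ b ℕ.* c)
          ≈⟨ +-cong (products a c b d) (-‿cong (products a d b c)) ⟩
        (ι a * ι c + ι b * ι d) - (ι a * ι d + ι b * ι c)
          ≈⟨ -‿+ _ _ _ _ ⟩
        (ι a * ι c - ι a * ι d) + (ι b * ι d - ι b * ι c)
          ≈⟨ +-cong (x[y-z] _ _ _) (trans (x[y-z] _ _ _) (-x[y-z] _ _ _)) ⟩
        ι a * (ι c - ι d) + - ι b * (ι c - ι d)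
          ≈⟨ distribʳ _ _ _ ⟨
        (ι a - ι b) * (ι c - ι d) ∎
        where
        products : ∀ k l m n → ι (k ℕ.* l ℕ.+ m ℕ.* n) ≈ ι k * ι l + ι m * ι n
        products k l m n =
          trans (×-homo-+ 1# (k ℕ.* l) (m ℕ.* n)) (+-cong (×1-homo-* k l) (×1-homo-* m n))
        x[y-z] : ∀ x y z → x * y - x * z ≈ x * (y - z)
        x[y-z] x y z = trans (+-congˡ (-‿distribʳ-* x z)) (sym (distribˡ x y (- z)))
        -x[y-z] : ∀ x y z → x * (y - z) ≈ - x * (z - y)
        -x[y-z] x y z = begin
          x * (y - z)     ≈⟨ *-congˡ (⁻¹-anti-homo‿- z y) ⟨
          x * - (z - y)   ≈⟨ -‿distribʳ-* x (z - y) ⟨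
          - (x * (z - y)) ≈⟨ -‿distribˡ-* x (z - y) ⟩
          - x * (z - y)   ∎

      almost : AlmostCommutativeRing c ℓ
      almost = fromCommutativeRing R

      morphism : differences -Raw-AlmostCommutative⟶ almost
      morphism = record
        { ⟦_⟧    = value
        ; +-homo = λ x y → trans (value≈ (x D.+ y))
                     (trans (+-homo x y) (+-cong (sym (value≈ x)) (sym (value≈ y))))
        ; *-homo = λ x y → trans (value≈ (x D.* y))
                     (trans (*-homo x y) (*-cong (sym (value≈ x)) (sym (value≈ y))))
        ; -‿homo = λ { x@(a , b) → trans (value≈ (b , a))
                     (trans (sym (⁻¹-anti-homo‿- (ι a) (ι b))) (-‿cong (sym (value≈ x)))) }
        ; 0-homo = refl
        ; 1-homo = +-identityʳ 1#
        }

      _≟_ : ∀ x y → Maybe (value x ≈ value y)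
      x@(a , b) ≟ y@(c , d) with a ℕ.+ d ℕₚ.≟ c ℕ.+ b
      ... | no  _ = nothing
      ... | yes p = just (trans (value≈ x) (trans (begin
        ι a - ι b                   ≈⟨ +-identityʳ _ ⟨
        (ι a - ι b) + 0#            ≈⟨ +-congˡ (-‿inverseʳ (ι d)) ⟨
        (ι a - ι b) + (ι d - ι d)   ≈⟨ -‿+ _ _ _ _ ⟨
        (ι a + ι d) - (ι b + ι d)   ≈⟨ +-cong a+d (-‿cong (+-comm _ _)) ⟩
        (ι c + ι b) - (ι d + ι b)   ≈⟨ -‿+ _ _ _ _ ⟩
        (ι c - ι d) + (ι b - ι b)   ≈⟨ +-congˡ (-‿inverseʳ (ι b)) ⟩
        (ι c - ι d) + 0#            ≈⟨ +-identityʳ _ ⟩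
        ι c - ι d                   ∎) (sym (value≈ y))))
        where
        a+d : ι a + ι d ≈ ι c + ι b
        a+d = trans (sym (×-homo-+ 1# a d)) (trans (×-congˡ p) (×-homo-+ 1# c b))

    open import Algebra.Solver.Ring differences almost morphism _≟_ public
      using (solve; _:=_; _:+_; _:*_; _:-_; :-_; con; Polynomial)

    -- Its value is `# k` by definition, so identities written with `#` can be passed to the solver
    -- as they stand.
    :# : ∀ {n} → ℕ → Polynomial n
    :# k = con (k , 0)


-- The ring of power series and fixed points of x-adic contractions

module SeriesRing where

  open import Algebra.Bundles using (CommutativeRing)
  open import Algebra.Bundles.Raw using (RawRing)
  open import Data.Nat.Base as ℕ using (ℕ; zero; suc; _∸_; _<_; s≤s)
  import Data.Nat.Properties as ℕₚ
  open import Data.Product.Base using (_,_)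
  import Function.Endo.Propositional as Endo
  open import Defs using (module PowerSeries)

  module PowerSeriesRing {c ℓ} (R : CommutativeRing c ℓ) where
    open CommutativeRing R
    open PowerSeries rawRing
    private
      module S = RawRing seriesRing
    open S using () renaming (_≈_ to _≋_; _+_ to _⊕_; _*_ to _⊛_)
    open import Algebra.Properties.CommutativeSemigroup +-commutativeSemigroup
      using (interchange; x∙yz≈y∙xz)
    open import Relation.Binary.Reasoning.Setoid setoid

    infixr 7 _·_
    _·_ : Carrier → Series → Series
    (a · f) n = a * f n

    -- The product satisfies f g = f₀ g + x f′ g definitionally; the ring laws
    -- follow from this by induction on the exponent.
    ⊛-cong : ∀ {f f′ g g′} → f ≋ f′ → g ≋ g′ → f ⊛ g ≋ f′ ⊛ g′
    ⊛-cong p q zero    = +-congʳ (*-cong (p 0) (q 0))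
    ⊛-cong p q (suc n) = +-cong (*-cong (p 0) (q (suc n))) (⊛-cong (λ k → p (suc k)) q n)

    ⊛-distribʳ : ∀ h f g → (f ⊕ g) ⊛ h ≋ f ⊛ h ⊕ g ⊛ h
    ⊛-distribʳ h f g zero = begin
      (f 0 + g 0) * h 0 + 0#                ≈⟨ +-identityʳ _ ⟩
      (f 0 + g 0) * h 0                     ≈⟨ distribʳ _ _ _ ⟩
      f 0 * h 0 + g 0 * h 0                 ≈⟨ +-cong (+-identityʳ _) (+-identityʳ _) ⟨
      (f 0 * h 0 + 0#) + (g 0 * h 0 + 0#)   ∎
    ⊛-distribʳ h f g (suc n) =
      trans (+-cong (distribʳ _ _ _) (⊛-distribʳ h (tail f) (tail g) n)) (interchange _ _ _ _)

    ·-⊛ : ∀ a f g → (a · f) ⊛ g ≋ a · (f ⊛ g)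
    ·-⊛ a f g zero    = trans (+-cong (*-assoc _ _ _) (sym (zeroʳ a))) (sym (distribˡ _ _ _))
    ·-⊛ a f g (suc n) =
      trans (+-cong (*-assoc _ _ _) (·-⊛ a (tail f) g n)) (sym (distribˡ _ _ _))

    -- The mirror image of the defining recursion, taking the constant term off the right factor;
    -- `⊛-comm` matches one recursion against the other.
    ⊛-suc : ∀ f g n → (f ⊛ g) (suc n) ≈ f (suc n) * g 0 + (f ⊛ tail g) n
    ⊛-suc f g zero    = trans (+-congˡ (+-identityʳ _))
                          (trans (+-comm _ _) (+-congˡ (sym (+-identityʳ _))))
    ⊛-suc f g (suc n) = trans (+-congˡ (⊛-suc (tail f) g n)) (x∙yz≈y∙xz _ _ _)

    ⊛-comm : ∀ f g → f ⊛ g ≋ g ⊛ f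
    ⊛-comm f g zero    = +-congʳ (*-comm _ _)
    ⊛-comm f g (suc n) =
      trans (+-cong (*-comm _ _) (⊛-comm (tail f) g n)) (sym (⊛-suc g f n))

    ⊛-assoc : ∀ f g h → (f ⊛ g) ⊛ h ≋ f ⊛ (g ⊛ h)
    ⊛-assoc f g h zero = +-congʳ (begin
      (f 0 * g 0 + 0#) * h 0    ≈⟨ *-congʳ (+-identityʳ _) ⟩
      f 0 * g 0 * h 0           ≈⟨ *-assoc _ _ _ ⟩
      f 0 * (g 0 * h 0)         ≈⟨ *-congˡ (+-identityʳ _) ⟨
      f 0 * (g 0 * h 0 + 0#)    ∎)
    ⊛-assoc f g h (suc n) = begin
      (f 0 * g 0 + 0#) * h (suc n) + (tail (f ⊛ g) ⊛ h) n
        ≈⟨ +-cong (trans (*-congʳ (+-identityʳ _)) (*-assoc _ _ _))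
                  (⊛-distribʳ h (f 0 · tail g) (tail f ⊛ g) n) ⟩
      f 0 * (g 0 * h (suc n)) + (((f 0 · tail g) ⊛ h) n + ((tail f ⊛ g) ⊛ h) n)
        ≈⟨ +-congˡ (+-cong (·-⊛ (f 0) (tail g) h n) (⊛-assoc (tail f) g h n)) ⟩
      f 0 * (g 0 * h (suc n)) + (f 0 * (tail g ⊛ h) n + (tail f ⊛ (g ⊛ h)) n)
        ≈⟨ +-assoc _ _ _ ⟨
      f 0 * (g 0 * h (suc n)) + f 0 * (tail g ⊛ h) n + (tail f ⊛ (g ⊛ h)) n
        ≈⟨ +-congʳ (distribˡ _ _ _) ⟨
      f 0 * (g ⊛ h) (suc n) + (tail f ⊛ (g ⊛ h)) n ∎

    zeros-⊛ : ∀ f n → ((λ _ → 0#) ⊛ f) n ≈ 0#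
    zeros-⊛ f zero    = trans (+-identityʳ _) (zeroˡ _)
    zeros-⊛ f (suc n) = trans (+-cong (zeroˡ _) (zeros-⊛ f n)) (+-identityʳ _)

    -- `0#` is `const 0#`, which computes only at a constructor.
    0-coefficient : ∀ n → S.0# n ≈ 0#
    0-coefficient zero    = refl
    0-coefficient (suc n) = refl

    const-⊛ : ∀ a f → const a ⊛ f ≋ a · f
    const-⊛ a f zero    = +-identityʳ _
    const-⊛ a f (suc n) = trans (+-congˡ (zeros-⊛ f n)) (+-identityʳ _)

    ⊲-⊛ : ∀ f g → (0# ⊲ f) ⊛ g ≋ 0# ⊲ (f ⊛ g)
    ⊲-⊛ f g zero    = trans (+-identityʳ _) (zeroˡ _)
    ⊲-⊛ f g (suc n) = trans (+-congʳ (zeroˡ _)) (+-identityˡ _)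

    x-⊛ : ∀ f → x ⊛ f ≋ 0# ⊲ f
    x-⊛ f zero    = ⊲-⊛ (const 1#) f 0
    x-⊛ f (suc n) = trans (⊲-⊛ (const 1#) f (suc n)) (trans (const-⊛ 1# f n) (*-identityˡ _))

    seriesCommutativeRing : CommutativeRing c ℓ
    seriesCommutativeRing = record
      { Carrier = Series
      ; _≈_     = _≋_
      ; _+_     = _⊕_
      ; _*_     = _⊛_
      ; -_      = S.-_
      ; 0#      = S.0#
      ; 1#      = S.1#
      ; isCommutativeRing = record
        { isRing = record
          { +-isAbelianGroup = record
            { isGroup = record
              { isMonoid = record
                { isSemigroup = record
                  { isMagma = record
                    { isEquivalence = record
                      { refl  = λ n → refl
                      ; sym   = λ p n → sym (p n)
                      ; trans = λ p q n → trans (p n) (q n)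
                      }
                    ; ∙-cong = λ p q n → +-cong (p n) (q n)
                    }
                  ; assoc = λ f g h n → +-assoc _ _ _
                  }
                ; identity = (λ f n → trans (+-congʳ (0-coefficient n)) (+-identityˡ _))
                           , (λ f n → trans (+-congˡ (0-coefficient n)) (+-identityʳ _))
                }
              ; inverse = (λ f n → trans (-‿inverseˡ _) (sym (0-coefficient n)))
                        , (λ f n → trans (-‿inverseʳ _) (sym (0-coefficient n)))
              ; ⁻¹-cong = λ p n → -‿cong (p n)
              }
            ; comm = λ f g n → +-comm _ _
            }
          ; *-cong     = ⊛-cong
          ; *-assoc    = ⊛-assoc
          ; *-identity = 1-⊛ , λ f n → trans (⊛-comm f S.1# n) (1-⊛ f n)
          ; distrib    = (λ h f g n → trans (⊛-comm h (f ⊕ g) n)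
                           (trans (⊛-distribʳ h f g n) (+-cong (⊛-comm f h n) (⊛-comm g h n))))
                       , ⊛-distribʳ
          }
        ; *-comm = ⊛-comm
        }
      }
      where
      1-⊛ : ∀ f → S.1# ⊛ f ≋ f
      1-⊛ f n = trans (const-⊛ 1# f n) (*-identityˡ _)

    infix 4 _≋[_]_
    _≋[_]_ : Series → ℕ → Series → Set ℓ
    f ≋[ n ] g = ∀ {k} → k < n → f k ≈ g k

    ⊛-congˡ-below : ∀ h {f g n} → f ≋[ n ] g → h ⊛ f ≋[ n ] h ⊛ g
    ⊛-congˡ-below h p {zero}  0<n = +-congʳ (*-congˡ (p 0<n))
    ⊛-congˡ-below h p {suc k} k<n =
      +-cong (*-congˡ (p k<n)) (⊛-congˡ-below (tail h) p (ℕₚ.<-trans (ℕₚ.n<1+n k) k<n))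

    ⊛-cong-below : ∀ {f f′ g g′ n} → f ≋[ n ] f′ → g ≋[ n ] g′ → f ⊛ g ≋[ n ] f′ ⊛ g′
    ⊛-cong-below {f} {f′} {g} {g′} p q {k} k<n = begin
      (f ⊛ g) k   ≈⟨ ⊛-congˡ-below f q k<n ⟩
      (f ⊛ g′) k  ≈⟨ ⊛-comm f g′ k ⟩
      (g′ ⊛ f) k  ≈⟨ ⊛-congˡ-below g′ p k<n ⟩
      (g′ ⊛ f′) k ≈⟨ ⊛-comm g′ f′ k ⟩
      (f′ ⊛ g′) k ∎

    ⊲-cong-below : ∀ {a f g n} → f ≋[ n ] g → a ⊲ f ≋[ suc n ] a ⊲ g
    ⊲-cong-below p {zero}  _         = refl
    ⊲-cong-below p {suc k} (s≤s k<n) = p k<n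

    -- Multiplication by a series without constant term gains one exponent.
    ⊛-gain : ∀ {h f g n} → h 0 ≈ 0# → f ≋[ n ] g → h ⊛ f ≋[ suc n ] h ⊛ g
    ⊛-gain h₀ p {zero}  _ = +-congʳ (trans (*-congʳ h₀) (trans (zeroˡ _) (sym (trans (*-congʳ h₀) (zeroˡ _)))))
    ⊛-gain {h} {f} {g} h₀ p {suc k} (s≤s k<n) = +-cong
      (trans (*-congʳ h₀) (trans (zeroˡ _) (sym (trans (*-congʳ h₀) (zeroˡ _)))))
      (⊛-congˡ-below (tail h) p k<n)

    -- Contraction for the x-adic metric; the module below is then Banach's fixed point theorem.
    Contracting : (Series → Series) → Set _
    Contracting Φ = ∀ {n f g} → f ≋[ n ] g → Φ f ≋[ suc n ] Φ g

    module Fixpoint {Φ : Series → Series} (contracting : Contracting Φ) where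
      private
        Φ^ : ℕ → Series
        Φ^ n = Endo._^_ Series Φ n S.0#

        stable : ∀ n → Φ^ n ≋[ n ] Φ^ (suc n)
        stable zero    ()
        stable (suc n) = contracting (stable n)

        limit : ∀ d n → Φ^ n ≋[ n ] Φ^ (d ℕ.+ n)
        limit zero    n k<n = refl
        limit (suc d) n k<n = trans (limit d n k<n) (stable (d ℕ.+ n) (ℕₚ.<-≤-trans k<n (ℕₚ.m≤n+m n d)))

        -- `fixpoint` reads its k-th coefficient off the iterate k + 1, and by `limit` that
        -- coefficient no longer changes in later iterates.
        fixpoint-below : ∀ n → fixpoint Φ ≋[ n ] Φ^ n
        fixpoint-below n {k} k<n = trans (limit (n ∸ suc k) (suc k) (ℕₚ.n<1+n k))
          (reflexive (cong (λ j → Φ^ j k) (ℕₚ.m∸n+n≡m k<n)))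
          where open import Relation.Binary.PropositionalEquality using (cong)

      unfold : fixpoint Φ ≋ Φ (fixpoint Φ)
      unfold n = sym (contracting (fixpoint-below n) (ℕₚ.n<1+n n))

      unique : ∀ {f} → f ≋ Φ f → f ≋ fixpoint Φ
      unique {f} p n = agree (suc n) (ℕₚ.n<1+n n)
        where
        agree : ∀ n → f ≋[ n ] fixpoint Φ
        agree zero    ()
        agree (suc n) {k} k<n = trans (p k) (trans (contracting (agree n) k<n) (sym (unfold k)))


-- Division of series and substitution into series

module DivisionAndSubstitution where

  open import Algebra.Bundles using (CommutativeRing)
  open import Algebra.Definitions using (LeftInvertible)
  open import Data.Fin.Base using (toℕ)
  open import Data.Nat.Base as ℕ using (ℕ; zero; suc; _≤_; z≤n; s≤s)
  import Data.Nat.Properties as ℕₚ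
  open import Data.Product.Base using (_,_)
  open import Function.Base using (_∘_)
  open import Defs using (module PowerSeries; module RingNotation)
  open IntegerSolver
  open SeriesRing

  module Division {c ℓ} (R : CommutativeRing c ℓ) where
    open CommutativeRing R
    open PowerSeries rawRing
    open PowerSeriesRing R
    private
      module S = CommutativeRing seriesCommutativeRing
      module N = RingNotation seriesRing
    open RingSolver seriesCommutativeRing
    open import Relation.Binary.Reasoning.Setoid S.setoid

    ⊲-split : ∀ f → f S.≈ const (f 0) S.+ (0# ⊲ tail f)
    ⊲-split f zero    = sym (+-identityʳ _)
    ⊲-split f (suc n) = sym (+-identityˡ _)

    const-* : ∀ a b → const (a * b) S.≈ const a S.* const b
    const-* a b zero    = sym (+-identityʳ _)
    const-* a b (suc n) = sym (trans (const-⊛ a (const b) (suc n)) (zeroʳ a))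

    const-cong : ∀ {a b} → a ≈ b → const a S.≈ const b
    const-cong p zero    = p
    const-cong p (suc n) = refl

    -- The map iterated inside `divide`, named so that its contraction property applies to `divide`
    -- by definition.
    inverseStep : Carrier → Series → Series → Series
    inverseStep u g h = const u S.* (S.1# N.- (0# ⊲ tail g S.* h))

    private
      contracting : ∀ u g → Contracting (inverseStep u g)
      contracting u g {n} {h} {h′} p = ⊛-congˡ-below (const u)
        {S.1# N.- (0# ⊲ tail g S.* h)} {S.1# N.- (0# ⊲ tail g S.* h′)}
        λ k<n → +-congˡ (-‿cong (⊲-cong-below (⊛-congˡ-below (tail g) p) k<n))

    inverse : (g : Series) → LeftInvertible _≈_ 1# _*_ (g 0) → Series
    inverse g (u , _) = fixpoint (inverseStep u g)

    inverseˡ : ∀ g (p : LeftInvertible _≈_ 1# _*_ (g 0)) → inverse g p S.* g S.≈ S.1#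
    inverseˡ g p@(u , ug₀≈1) = begin
      h S.* g                           ≈⟨ S.*-congˡ {h} {g} {g₀ S.+ (0# ⊲ tail g)} (⊲-split g) ⟩
      h S.* (g₀ S.+ (0# ⊲ tail g))      ≈⟨ S.distribˡ h g₀ (0# ⊲ tail g) ⟩
      h S.* g₀ S.+ h S.* (0# ⊲ tail g)  ≈⟨ S.+-cong h*g₀ (S.trans (S.*-comm h _) (⊲-⊛ (tail g) h)) ⟩
      (S.1# N.- y) S.+ y                ≈⟨ solve 2 (λ o y → (o :- y) :+ y := o) S.refl S.1# y ⟩
      S.1#                              ∎
      where
      h = inverse g p
      g₀ = const (g 0)
      y = 0# ⊲ tail g S.* h
      u*g₀ : const u S.* g₀ S.≈ S.1#
      u*g₀ = S.trans (S.sym (const-* u (g 0))) (const-cong ug₀≈1)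
      h*g₀ : h S.* g₀ S.≈ S.1# N.- y
      h*g₀ = begin
        h S.* g₀
          ≈⟨ S.*-congʳ {g₀} {h} {const u S.* (S.1# N.- y)} (Fixpoint.unfold (contracting u g)) ⟩
        const u S.* (S.1# N.- y) S.* g₀
          ≈⟨ solve 3 (λ u v g → u :* v :* g := u :* g :* v) S.refl (const u) (S.1# N.- y) g₀ ⟩
        const u S.* g₀ S.* (S.1# N.- y)
          ≈⟨ S.*-congʳ {S.1# N.- y} {const u S.* g₀} {S.1#} u*g₀ ⟩
        S.1# S.* (S.1# N.- y)
          ≈⟨ S.*-identityˡ _ ⟩
        S.1# N.- y ∎

    divide-* : ∀ f g p → divide f g p S.* g S.≈ f
    divide-* f g p = begin
      f S.* inverse g p S.* g    ≈⟨ S.*-assoc f (inverse g p) g ⟩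
      f S.* (inverse g p S.* g)  ≈⟨ S.*-congˡ {f} {inverse g p S.* g} {S.1#} (inverseˡ g p) ⟩
      f S.* S.1#                 ≈⟨ S.*-identityʳ f ⟩
      f                          ∎

    -- Multiplication by the inverse of g. Only the constant term of g has to be inspected, so roots
    -- and denominators can be cancelled without knowing their other coefficients.
    *-cancelʳ : ∀ g → LeftInvertible _≈_ 1# _*_ (g 0) → ∀ {f h} → f S.* g S.≈ h S.* g → f S.≈ h
    *-cancelʳ g p {f} {h} fg≈hg = begin
      f                          ≈⟨ unit f ⟨
      f S.* g S.* inverse g p    ≈⟨ S.*-congʳ {inverse g p} {f S.* g} {h S.* g} fg≈hg ⟩
      h S.* g S.* inverse g p    ≈⟨ unit h ⟩
      h                          ∎
      where
      unit : ∀ f → f S.* g S.* inverse g p S.≈ f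
      unit f = begin
        f S.* g S.* inverse g p    ≈⟨ solve 3 (λ f g i → f :* g :* i := i :* g :* f) S.refl f g (inverse g p) ⟩
        inverse g p S.* g S.* f    ≈⟨ S.*-congʳ {f} {inverse g p S.* g} {S.1#} (inverseˡ g p) ⟩
        S.1# S.* f                 ≈⟨ S.*-identityˡ f ⟩
        f                          ∎

    divide-unique : ∀ {f g h} p → h S.* g S.≈ f → h S.≈ divide f g p
    divide-unique {f} {g} {h} p e = *-cancelʳ g p {h} {divide f g p} λ n → trans (e n) (sym (divide-* f g p n))

  module Substitution {c ℓ} (R : CommutativeRing c ℓ) where
    open CommutativeRing R
    open PowerSeries rawRing
    open PowerSeriesRing R
    private
      module S = CommutativeRing seriesCommutativeRing
      module S² = CommutativeRing (PowerSeriesRing.seriesCommutativeRing seriesCommutativeRing)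
      module N = RingNotation rawRing
      module NS = RingNotation seriesRing
    open RingSolver seriesCommutativeRing
    open import Relation.Binary.Reasoning.Setoid setoid

    private
      combination : ℕ → (F P : ℕ → Series) → Series
      combination N F P n = N.sum {N} λ k → (F (toℕ k) S.* P (toℕ k)) n

      combination-* : ∀ X N F P → combination N F (λ k → X S.* P k) S.≈ X S.* combination N F P
      combination-* X zero    F P n = sym (trans (⊛-comm X (λ _ → 0#) n) (zeros-⊛ X n))
      combination-* X (suc N) F P n = trans
        (+-cong (solve 3 (λ f x p → f :* (x :* p) := x :* (f :* p)) S.refl (F 0) X (P 0) n)
                (combination-* X N (F ∘ suc) (P ∘ suc) n))
        (sym (S.distribˡ X (F 0 S.* P 0) (combination N (F ∘ suc) (P ∘ suc)) n))

    module At (X : Series) (X₀≈0 : X 0 ≈ 0#) where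

      -- `substitute φ f X` is this sum at φ ∘ f. With φ absorbed into F, the same laws serve
      -- composition of univariate series and evaluation of bivariate ones.
      evaluateAt : (ℕ → Series) → Series
      evaluateAt F n = combination (suc n) F (X NS.^_) n

      private
        truncated : ℕ → (ℕ → Series) → Series
        truncated N F = combination N F (X NS.^_)

        truncated-suc : ∀ N F → truncated (suc N) F S.≈ F 0 S.+ X S.* truncated N (F ∘ suc)
        truncated-suc N F n =
          +-cong (S.*-identityʳ (F 0) n) (combination-* X N (F ∘ suc) (X NS.^_) n)

        -- Each coefficient of `evaluateAt` comes from a sum of a different length. They fit
        -- together because Xᵏ contributes nothing below exponent k.
        truncated-stable : ∀ {n N M} F → n ≤ N → n ≤ M → truncated N F ≋[ n ] truncated M F
        truncated-stable F z≤n z≤n ()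
        truncated-stable {suc n} {suc N} {suc M} F (s≤s n≤N) (s≤s n≤M) {k} k<n = begin
          truncated (suc N) F k
            ≈⟨ truncated-suc N F k ⟩
          (F 0 S.+ X S.* truncated N (F ∘ suc)) k
            ≈⟨ +-congˡ (⊛-gain {X} X₀≈0 (truncated-stable (F ∘ suc) n≤N n≤M) k<n) ⟩
          (F 0 S.+ X S.* truncated M (F ∘ suc)) k
            ≈⟨ truncated-suc M F k ⟨
          truncated (suc M) F k ∎

      -- Horner's rule. The homomorphism laws below rest on it: each is proved up to a given
      -- exponent, and the factor X pays for one step of the induction.
      unfold : ∀ F → evaluateAt F S.≈ F 0 S.+ X S.* evaluateAt (F ∘ suc)
      unfold F n = trans (truncated-suc n F n) (+-congˡ (⊛-gain {X} X₀≈0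
        (λ {k} k<n → truncated-stable {suc k} (F ∘ suc) k<n (ℕₚ.n<1+n k) (ℕₚ.n<1+n k))
        (ℕₚ.n<1+n n)))

      private
        unfold-below : ∀ F n {f} → evaluateAt (F ∘ suc) ≋[ n ] f →
                       evaluateAt F ≋[ suc n ] F 0 S.+ X S.* f
        unfold-below F n p {k} k<n = trans (unfold F k) (+-congˡ (⊛-gain {X} X₀≈0 p k<n))

      evaluateAt-cong : ∀ {F G} → F S².≈ G → evaluateAt F S.≈ evaluateAt G
      evaluateAt-cong {F} {G} p n = go (suc n) p (ℕₚ.n<1+n n)
        where
        go : ∀ n {F G} → F S².≈ G → evaluateAt F ≋[ n ] evaluateAt G
        go zero    p ()
        go (suc n) {F} {G} p {k} k<n = trans (unfold-below F n (go n (λ k → p (suc k))) k<n)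
          (trans (+-congʳ (p 0 k)) (sym (unfold G k)))

      evaluateAt-+ : ∀ F G → evaluateAt (F S².+ G) S.≈ evaluateAt F S.+ evaluateAt G
      evaluateAt-+ F G n = go (suc n) F G (ℕₚ.n<1+n n)
        where
        go : ∀ n F G → evaluateAt (F S².+ G) ≋[ n ] evaluateAt F S.+ evaluateAt G
        go zero    F G ()
        go (suc n) F G {k} k<n = begin
          evaluateAt (F S².+ G) k
            ≈⟨ unfold-below (F S².+ G) n (go n (F ∘ suc) (G ∘ suc)) k<n ⟩
          ((F 0 S.+ G 0) S.+ X S.* (evaluateAt (F ∘ suc) S.+ evaluateAt (G ∘ suc))) k
            ≈⟨ solve 5 (λ f g x f′ g′ → (f :+ g) :+ x :* (f′ :+ g′) := (f :+ x :* f′) :+ (g :+ x :* g′))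
                 S.refl (F 0) (G 0) X (evaluateAt (F ∘ suc)) (evaluateAt (G ∘ suc)) k ⟩
          ((F 0 S.+ X S.* evaluateAt (F ∘ suc)) S.+ (G 0 S.+ X S.* evaluateAt (G ∘ suc))) k
            ≈⟨ +-cong (unfold F k) (unfold G k) ⟨
          (evaluateAt F S.+ evaluateAt G) k ∎

      evaluateAt-scale : ∀ f G → evaluateAt (λ k → f S.* G k) S.≈ f S.* evaluateAt G
      evaluateAt-scale f G n = go (suc n) G (ℕₚ.n<1+n n)
        where
        go : ∀ n G → evaluateAt (λ k → f S.* G k) ≋[ n ] f S.* evaluateAt G
        go zero    G ()
        go (suc n) G {k} k<n = begin
          evaluateAt (λ k → f S.* G k) k
            ≈⟨ unfold-below (λ k → f S.* G k) n (go n (G ∘ suc)) k<n ⟩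
          (f S.* G 0 S.+ X S.* (f S.* evaluateAt (G ∘ suc))) k
            ≈⟨ solve 4 (λ f g x g′ → f :* g :+ x :* (f :* g′) := f :* (g :+ x :* g′))
                 S.refl f (G 0) X (evaluateAt (G ∘ suc)) k ⟩
          (f S.* (G 0 S.+ X S.* evaluateAt (G ∘ suc))) k
            ≈⟨ S.*-congˡ {f} (unfold G) k ⟨
          (f S.* evaluateAt G) k ∎

      -- The tail of F G is F₀ G′ + F′ G, so the induction generalises F and keeps G fixed; the
      -- first summand is a scaling.
      evaluateAt-* : ∀ F G → evaluateAt (F S².* G) S.≈ evaluateAt F S.* evaluateAt G
      evaluateAt-* F G n = go (suc n) F (ℕₚ.n<1+n n)
        where
        H = evaluateAt G
        go : ∀ n F → evaluateAt (F S².* G) ≋[ n ] evaluateAt F S.* H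
        go zero    F ()
        go (suc n) F {k} k<n = begin
          evaluateAt (F S².* G) k
            ≈⟨ unfold-below (F S².* G) n tails k<n ⟩
          ((F 0 S.* G 0 S.+ S.0#) S.+ X S.* (F 0 S.* G′ S.+ F′ S.* H)) k
            ≈⟨ solve 6 (λ f g x g′ f′ h → (f :* g :+ :# 0) :+ x :* (f :* g′ :+ f′ :* h)
                                       := f :* (g :+ x :* g′) :+ x :* f′ :* h)
                 S.refl (F 0) (G 0) X G′ F′ H k ⟩
          (F 0 S.* (G 0 S.+ X S.* G′) S.+ X S.* F′ S.* H) k
            ≈⟨ +-congʳ (S.*-congˡ {F 0} (unfold G) k) ⟨
          (F 0 S.* H S.+ X S.* F′ S.* H) k
            ≈⟨ S.distribʳ H (F 0) (X S.* F′) k ⟨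
          ((F 0 S.+ X S.* F′) S.* H) k
            ≈⟨ S.*-congʳ {H} (unfold F) k ⟨
          (evaluateAt F S.* H) k ∎
          where
          F′ = evaluateAt (F ∘ suc)
          G′ = evaluateAt (G ∘ suc)
          tails : evaluateAt ((F S².* G) ∘ suc) ≋[ n ] F 0 S.* G′ S.+ F′ S.* H
          tails {j} j<n = trans
            (evaluateAt-+ (λ k → F 0 S.* G (suc k)) ((F ∘ suc) S².* G) j)
            (+-cong (evaluateAt-scale (F 0) (G ∘ suc) j) (go n (F ∘ suc) j<n))

      evaluateAt-0 : evaluateAt (λ _ → S.0#) S.≈ S.0#
      evaluateAt-0 n = begin
        evaluateAt (λ _ → S.0#) n            ≈⟨ evaluateAt-cong {λ _ → S.0#} {λ _ → S.0# S.* S.0#} (λ _ k → sym (S.zeroˡ S.0# k)) n ⟩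
        evaluateAt (λ _ → S.0# S.* S.0#) n   ≈⟨ evaluateAt-scale S.0# (λ _ → S.0#) n ⟩
        (S.0# S.* evaluateAt (λ _ → S.0#)) n ≈⟨ S.zeroˡ (evaluateAt (λ _ → S.0#)) n ⟩
        S.0# n                               ∎

      evaluateAt-const : ∀ f → evaluateAt (PowerSeries.const S.rawRing f) S.≈ f
      evaluateAt-const f n = begin
        evaluateAt (PowerSeries.const S.rawRing f) n
          ≈⟨ unfold (PowerSeries.const S.rawRing f) n ⟩
        (f S.+ X S.* evaluateAt (λ _ → S.0#)) n
          ≈⟨ +-congˡ (trans (S.*-congˡ {X} evaluateAt-0 n) (S.zeroʳ X n)) ⟩
        (f S.+ S.0#) n
          ≈⟨ S.+-identityʳ f n ⟩
        f n ∎

      evaluateAt-x : evaluateAt (PowerSeries.x S.rawRing) S.≈ X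
      evaluateAt-x n = begin
        evaluateAt (PowerSeries.x S.rawRing) n
          ≈⟨ unfold (PowerSeries.x S.rawRing) n ⟩
        (S.0# S.+ X S.* evaluateAt (PowerSeries.const S.rawRing S.1#)) n
          ≈⟨ trans (S.+-identityˡ (X S.* evaluateAt (PowerSeries.const S.rawRing S.1#)) n)
                   (S.*-congˡ {X} (evaluateAt-const S.1#) n) ⟩
        (X S.* S.1#) n
          ≈⟨ S.*-identityʳ X n ⟩
        X n ∎

      evaluateAt-neg : ∀ F → evaluateAt (S².- F) S.≈ S.- evaluateAt F
      evaluateAt-neg F n = begin
        evaluateAt (S².- F) n                  ≈⟨ evaluateAt-cong {S².- F} {λ k → S.- S.1# S.* F k} (λ k j → sym (-1*x≈-x (F k) j)) n ⟩
        evaluateAt (λ k → S.- S.1# S.* F k) n  ≈⟨ evaluateAt-scale (S.- S.1#) F n ⟩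
        (S.- S.1# S.* evaluateAt F) n          ≈⟨ -1*x≈-x (evaluateAt F) n ⟩
        (S.- evaluateAt F) n                   ∎
        where open import Algebra.Properties.Ring S.ring using (-1*x≈-x)


-- Polynomial identities behind the closed forms

module Identities where

  open import Algebra.Bundles using (CommutativeRing)
  open import Defs using (module RingNotation)
  open IntegerSolver

  module RingIdentities {c ℓ} (R : CommutativeRing c ℓ) where
    open CommutativeRing R
    open RingNotation rawRing using (#_)
    open RingSolver R
    open import Relation.Binary.Reasoning.Setoid setoid

    -- One step of an ideal membership certificate: k is the cofactor of the hypothesis p = q.
    -- Nested uses collect a combination of several hypotheses and leave a single polynomial
    -- identity for the solver.
    modulo : ∀ k {p q f g} → p ≈ q → f ≈ g + k * (p - q) → f ≈ g
    modulo k {p} {q} {f} {g} p≈q e = begin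
      f                  ≈⟨ e ⟩
      g + k * (p - q)    ≈⟨ +-congˡ (*-congˡ (+-congʳ p≈q)) ⟩
      g + k * (q - q)    ≈⟨ solve 3 (λ g k q → g :+ k :* (q :- q) := g) refl g k q ⟩
      g                  ∎

    -- The zero is written as a multiple of s + t, ready for that factor to be cancelled by
    -- `*-cancelʳ`.
    square-difference : ∀ s t → s * s ≈ t * t → (s - t) * (s + t) ≈ 0# * (s + t)
    square-difference s t e = modulo (# 1) e
      (solve 2 (λ s t → (s :- t) :* (s :+ t) := :# 0 :* (s :+ t) :+ :# 1 :* (s :* s :- t :* t))
         refl s t)

    #1≈1# : # 1 ≈ 1#
    #1≈1# = +-identityʳ 1#

    -- Squaring s = 1 - 2zc and comparing with 1 - 4z. The factor 4z stays, since a general ring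
    -- offers no cancellation.
    quadratic-from-root : ∀ {s c z} → s ≈ # 1 - z * (# 2 * c) → s * s ≈ # 1 - # 4 * z →
                          # 4 * (z * (c - (# 1 + z * (c * c)))) ≈ 0#
    quadratic-from-root {s} {c} {z} s-eq s²-eq =
      modulo (# 1 - z * (# 2 * c) + s) s-eq (modulo (- # 1) s²-eq
        (solve 3 (λ s c z →
          :# 4 :* (z :* (c :- (:# 1 :+ z :* (c :* c))))
            := (:# 0 :+ (:# 1 :- z :* (:# 2 :* c) :+ s) :* (s :- (:# 1 :- z :* (:# 2 :* c))))
               :+ (:- :# 1) :* (s :* s :- (:# 1 :- :# 4 :* z)))
          refl s c z))

    module _
      {A C D y w z : Carrier}
      (C-eq : C ≈ # 1 + y * (C * C))
      (w-eq : w ≈ y * C)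
      (D-eq : D ≈ # 1 + w * (D * D))
      (A-eq : A ≈ # 1 + z * A + (w * (D * A) + w * (D * A)))
      where

      private
        S = C * (# 1 - # 2 * (w * D))

        -- Since w C = y C². This eliminates y from what follows.
        wC : w * C ≈ C - # 1
        wC = modulo C w-eq (modulo (# 1) (sym C-eq)
          (solve 3 (λ C y w → w :* C := (C :- :# 1 :+ C :* (w :- y :* C))
                                        :+ :# 1 :* ((:# 1 :+ y :* (C :* C)) :- C))
             refl C y w))

      -- (1 - 2wD)² = 1 - 4w (D - w D²) = 1 - 4w, the discriminant of the equation for D; then `wC`
      -- makes C² - 4C (w C) a polynomial in C.
      root-square : S * S ≈ C * (# 4 - # 3 * C)
      root-square = modulo (- (# 4 * C * C * w)) D-eq (modulo (- (# 4 * C)) wC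
        (solve 3 (λ C D w →
          let S = C :* (:# 1 :- :# 2 :* (w :* D)) in
          S :* S := (C :* (:# 4 :- :# 3 :* C)
                       :+ (:- (:# 4 :* C :* C :* w)) :* (D :- (:# 1 :+ w :* (D :* D))))
                    :+ (:- (:# 4 :* C)) :* (w :* C :- (C :- :# 1)))
          refl C D w))

      -- The equation for A says A (1 - z - 2wD) = 1; this is C times it.
      counting-series : A * (S - z * C) ≈ C
      counting-series = modulo C A-eq
        (solve 5 (λ A C D w z →
          A :* (C :* (:# 1 :- :# 2 :* (w :* D)) :- z :* C)
            := C :+ C :* (A :- (:# 1 :+ z :* A :+ (w :* (D :* A) :+ w :* (D :* A)))))
          refl A C D w z)

    -- Multiplied by `den`, the factor 1 + X T M becomes `den` + 2 T X = 1 + X + S = C + S. Moreover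
    -- Q (C + S)(S - zC) = C (C + S - 4Q (C - 1)), by S² = C (4 - 3C) and Q (1 - z) = 1, and the
    -- last bracket is `den`. The common factor `den` is kept for cancellation among series.
    substituted-form : ∀ {C Q X S M T den z} →
      X ≈ C - # 1 → Q * (# 1 - z) ≈ # 1 → T ≈ # 2 * Q →
      den ≈ # 1 - # 2 * T * X + X + S → M * den ≈ # 2 → S * S ≈ C * (# 4 - # 3 * C) →
      Q * (# 1 + X * T * M) * (S - z * C) * den ≈ C * den
    substituted-form {C} {Q} {X} {S} {M} {T} {den} {z} X-eq Q-eq T-eq den-eq M-eq S-eq =
      modulo (Q * X * T * (S - z * C)) M-eq
      (modulo (Q * (S - z * C) - C) den-eq
      (modulo (# 2 * X * C) T-eq
      (modulo ((# 4 * Q) * C + Q * (S - z * C) - C) X-eq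
      (modulo Q S-eq
      (modulo (C * (C + S)) Q-eq
      (solve 8 (λ C Q X S M T den z →
         Q :* (:# 1 :+ X :* T :* M) :* (S :- z :* C) :* den
           := ((((((C :* den)
              :+ (Q :* X :* T :* (S :- z :* C)) :* (M :* den :- :# 2))
              :+ (Q :* (S :- z :* C) :- C) :* (den :- (:# 1 :- :# 2 :* T :* X :+ X :+ S)))
              :+ (:# 2 :* X :* C) :* (T :- :# 2 :* Q))
              :+ (:# 4 :* Q :* C :+ Q :* (S :- z :* C) :- C) :* (X :- (C :- :# 1)))
              :+ Q :* (S :* S :- C :* (:# 4 :- :# 3 :* C)))
              :+ (C :* (C :+ S)) :* (Q :* (:# 1 :- z) :- :# 1))
         refl C Q X S M T den z))))))


-- Square roots and the Catalan series over ℚ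

module RationalSeries where

  open import Defs
  open import Algebra.Bundles using (CommutativeRing)
  open import Data.Nat.Base as ℕ using (ℕ; zero; suc)
  open import Data.Product.Base using (_,_)
  open import Data.Rational.Base as ℚ using (ℚ; 0ℚ; 1ℚ; ½)
  import Data.Rational.Properties as ℚₚ
  import Function.Endo.Propositional as Endo
  open import Relation.Binary.PropositionalEquality using (_≡_; refl; sym; trans; cong)
  open IntegerSolver
  open SeriesRing
  open DivisionAndSubstitution
  open Identities

  ℚ-ring : CommutativeRing _ _
  ℚ-ring = ℚₚ.+-*-commutativeRing

  open PowerSeriesRing ℚ-ring
  open Division ℚ-ring
  open Substitution ℚ-ring

  ℚ⟦z⟧ : CommutativeRing _ _
  ℚ⟦z⟧ = seriesCommutativeRing

  module S = CommutativeRing ℚ⟦z⟧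
  open RingIdentities ℚ⟦z⟧
  open RingSolver ℚ⟦z⟧ hiding (Polynomial)

  open import Relation.Binary.Reasoning.Setoid S.setoid

  half : const ½ * # 2 ≈ 1#
  half zero    = refl
  half (suc n) = trans (const-⊛ ½ (# 2) (suc n)) refl

  √-square : ∀ f p → √ f p * √ f p ≈ f
  √-square f f₀≡1 zero    = sym f₀≡1
  √-square f f₀≡1 (suc n) = begin′
    where
    Φ : Series → Series
    Φ r = const ½ * (tail f - (0ℚ ⊲ r * r))

    Φ-contracting : Contracting Φ
    Φ-contracting {n} {g} {h} p = ⊛-congˡ-below (const ½) λ {k} k<n →
      cong (λ q → tail f k ℚ.- q)
        (⊲-cong-below {0ℚ} {g * g} {h * h} (⊛-cong-below {g} {h} {g} {h} p p) k<n)

    r = fixpoint Φ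
    v = 0ℚ ⊲ r * r

    -- The left side is the tail of the square of 1 + x r as the product recursion computes it, with
    -- the scalar 1 turned into a constant series so that the ring laws apply.
    tail-square : const 1ℚ * r + r * √ f f₀≡1 ≈ tail f
    tail-square = begin
      const 1ℚ * r + r * √ f f₀≡1
        ≈⟨ S.+-congˡ {const 1ℚ * r} (S.*-congˡ {r} (⊲-split (√ f f₀≡1))) ⟩
      1# * r + r * (1# + (0ℚ ⊲ r))
        ≈⟨ solve 3 (λ o r x → o :* r :+ r :* (o :+ x) := (:# 2 :* o) :* r :+ x :* r) S.refl 1# r (0ℚ ⊲ r) ⟩
      (# 2 * 1#) * r + (0ℚ ⊲ r) * r
        ≈⟨ S.+-cong {(# 2 * 1#) * r} {# 2 * r} (S.*-congʳ {r} (S.*-identityʳ (# 2))) (⊲-⊛ r r) ⟩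
      # 2 * r + v
        ≈⟨ S.+-congʳ {v} (S.*-congˡ {# 2} (Fixpoint.unfold Φ-contracting)) ⟩
      # 2 * (const ½ * (tail f - v)) + v
        ≈⟨ solve 4 (λ t h f v → t :* (h :* (f :- v)) :+ v := (h :* t) :* (f :- v) :+ v)
             S.refl (# 2) (const ½) (tail f) v ⟩
      (const ½ * # 2) * (tail f - v) + v
        ≈⟨ S.+-congʳ {v} (S.*-congʳ {tail f - v} half) ⟩
      1# * (tail f - v) + v
        ≈⟨ S.+-congʳ {v} (S.*-identityˡ (tail f - v)) ⟩
      (tail f - v) + v
        ≈⟨ solve 2 (λ f v → (f :- v) :+ v := f) S.refl (tail f) v ⟩
      tail f ∎

    begin′ : (√ f f₀≡1 * √ f f₀≡1) (suc n) ≡ f (suc n)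
    begin′ = trans (cong (ℚ._+ (r * √ f f₀≡1) n) (sym (const-⊛ 1ℚ r n))) (tail-square n)

  -- With t = `√ f p`, (s - t)(s + t) = 0, and s + t has constant term 2 and can be cancelled: the
  -- constant term decides the sign of a root.
  √-unique : ∀ {f s} p → s 0 ≡ 1ℚ → s * s ≈ f → s ≈ √ f p
  √-unique {f} {s} p s₀≡1 s²≈f n =
    trans (solve 2 (λ s t → s := (s :- t) :+ t) S.refl s t n)
    (trans (cong (ℚ._+ t n) (s-t≈0 n)) (S.+-identityˡ t n))
    where
    t = √ f p
    s-t≈0 : s - t ≈ S.0#
    s-t≈0 = *-cancelʳ (s + t) (½ , cong (λ a → ½ ℚ.* (a ℚ.+ 1ℚ)) s₀≡1) {s - t} {S.0#}
      (square-difference s t λ k → trans (s²≈f k) (sym (√-square f p k)))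

  -- The definition of `c` says √(1 - 4z) = 1 - 2zc, so the quadratic equation appears multiplied by
  -- 4z. The factor 4 is invertible; z is not, and is removed by passing to the next coefficient.
  c-eq : c ≈ # 1 + z * (c * c)
  c-eq n = trans (solve 2 (λ c e → c := (c :- e) :+ e) S.refl c e n)
    (trans (cong (ℚ._+ e n) (d≈0 n)) (S.+-identityˡ e n))
    where
    f s d e r : Series
    f = 1# - # 4 * z
    s = √ f refl
    e = # 1 + z * (c * c)
    d = c - e
    r = tail s

    tail-1-s : tail (1# - s) ≈ - r
    tail-1-s n = ℚₚ.+-identityˡ (ℚ.- r n)

    2c : # 2 * c ≈ - r
    2c = begin
      # 2 * (const ½ * tail (1# - s))
        ≈⟨ solve 3 (λ t h u → t :* (h :* u) := (h :* t) :* u) S.refl (# 2) (const ½) (tail (1# - s)) ⟩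
      (const ½ * # 2) * tail (1# - s)
        ≈⟨ S.*-cong {const ½ * # 2} {1#} {tail (1# - s)} {(- r)} half tail-1-s ⟩
      1# * - r
        ≈⟨ S.*-identityˡ (- r) ⟩
      - r ∎

    s-eq : s ≈ 1# - z * (# 2 * c)
    s-eq = begin
      s                      ≈⟨ ⊲-split s ⟩
      1# + (0ℚ ⊲ r)          ≈⟨ S.+-congˡ {1#} (λ n → sym (x-⊛ r n)) ⟩
      1# + z * r             ≈⟨ solve 3 (λ o z r → o :+ z :* r := o :- z :* (:- r)) S.refl 1# z r ⟩
      1# - z * (- r)         ≈⟨ S.+-congˡ {1#} (S.-‿cong {z * (- r)} {z * (# 2 * c)}
                                   (S.*-congˡ {z} {(- r)} {# 2 * c} (λ n → sym (2c n)))) ⟩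
      1# - z * (# 2 * c)     ∎

    4zd : # 4 * (z * d) ≈ S.0#
    4zd = quadratic-from-root {s} {c} {z}
      (λ n → trans (s-eq n) (cong (ℚ._- (z * (# 2 * c)) n) (sym (#1≈1# n))))
      (λ n → trans (√-square f refl n) (cong (ℚ._- (# 4 * z) n) (sym (#1≈1# n))))

    zd : z * d ≈ S.0#
    zd = *-cancelʳ (# 4) (ℚ.1/ (# 4) 0 , refl) {z * d} {S.0#} λ n →
      trans (S.*-comm (z * d) (# 4) n) (trans (4zd n) (sym (S.zeroˡ (# 4) n)))

    d≈0 : d ≈ S.0#
    d≈0 n = trans (sym (x-⊛ d (suc n))) (trans (zd (suc n)) (sym (0-coefficient n)))

  tail-c : tail c ≈ c * c
  tail-c n = trans (c-eq (suc n)) (trans (S.+-identityˡ (z * (c * c)) (suc n)) (x-⊛ (c * c) (suc n)))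


-- Composition and evaluation at t = T as homomorphisms

module BivariateEvaluation where

  open import Defs
  open import Algebra.Bundles using (CommutativeRing)
  open import Algebra.Definitions using (LeftInvertible)
  open import Data.List.Base using ([]; _∷_; map)
  open import Data.Nat.Base as ℕ using (ℕ; zero; suc)
  open import Data.Product.Base using (_,_)
  open import Data.Rational.Base as ℚ using (ℚ; 0ℚ; 1ℚ)
  open import Function.Base using (_∘_)
  import Function.Endo.Propositional as Endo
  open import Relation.Binary.PropositionalEquality using (_≡_; refl; sym; trans; cong; cong₂)
  open IntegerSolver
  open SeriesRing
  open DivisionAndSubstitution
  open Identities
  open RationalSeries

  open PowerSeriesRing ℚ-ring
  open Division ℚ-ring
  open Substitution ℚ-ring
  open RingIdentities ℚ⟦z⟧
  open RingSolver ℚ⟦z⟧ hiding (Polynomial)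

  ℚ⟦z⟧⟦x⟧ : CommutativeRing _ _
  ℚ⟦z⟧⟦x⟧ = PowerSeriesRing.seriesCommutativeRing ℚ⟦z⟧

  module S² = CommutativeRing ℚ⟦z⟧⟦x⟧
  module S²-Series = PowerSeries S.rawRing

  module Composition (X : Series) (X₀≡0 : X 0 ≡ 0ℚ) where
    open At X X₀≡0

    const-+ : ∀ a b → const (a ℚ.+ b) ≈ const a + const b
    const-+ a b zero    = refl
    const-+ a b (suc n) = refl

    const-product : ∀ f g → const ∘ (f * g) S².≈ (const ∘ f) S².* (const ∘ g)
    const-product f g zero    k = trans (const-+ (f 0 ℚ.* g 0) 0ℚ k) (cong (ℚ._+ S.0# k) (const-* (f 0) (g 0) k))
    const-product f g (suc n) k = trans (const-+ (f 0 ℚ.* g (suc n)) ((tail f * g) n) k)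
      (cong₂ ℚ._+_ (const-* (f 0) (g (suc n)) k) (const-product (tail f) g n k))

    const-neg : ∀ a → const (ℚ.- a) ≈ - const a
    const-neg a zero    = refl
    const-neg a (suc n) = refl

    compose-cong : ∀ {f g} → f ≈ g → compose f X X₀≡0 ≈ compose g X X₀≡0
    compose-cong e = evaluateAt-cong λ k → const-cong (e k)

    compose-+ : ∀ f g → compose (f + g) X X₀≡0 ≈ compose f X X₀≡0 + compose g X X₀≡0
    compose-+ f g n = trans
      (evaluateAt-cong {const ∘ (f + g)} {(const ∘ f) S².+ (const ∘ g)} (λ k → const-+ (f k) (g k)) n)
      (evaluateAt-+ (const ∘ f) (const ∘ g) n)

    compose-* : ∀ f g → compose (f * g) X X₀≡0 ≈ compose f X X₀≡0 * compose g X X₀≡0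
    compose-* f g n = trans (evaluateAt-cong (const-product f g) n)
      (evaluateAt-* (const ∘ f) (const ∘ g) n)

    compose-neg : ∀ f → compose (- f) X X₀≡0 ≈ - compose f X X₀≡0
    compose-neg f n = trans
      (evaluateAt-cong {const ∘ (- f)} {S².- (const ∘ f)} (λ k → const-neg (f k)) n)
      (evaluateAt-neg (const ∘ f) n)

    compose-const : ∀ a → compose (const a) X X₀≡0 ≈ const a
    compose-const a n = trans
      (evaluateAt-cong {const ∘ const a} {S²-Series.const (const a)}
        (λ { zero k → refl ; (suc j) k → refl }) n)
      (evaluateAt-const (const a) n)

    compose-# : ∀ k → compose (# k) X X₀≡0 ≈ # k
    compose-# zero    n = compose-const 0ℚ n
    compose-# (suc k) n =
      trans (compose-+ 1# (# k) n) (cong₂ ℚ._+_ (compose-const 1ℚ n) (compose-# k n))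

    compose-z : compose z X X₀≡0 ≈ X
    compose-z n = trans
      (evaluateAt-cong {const ∘ z} {S²-Series.x}
        (λ { zero k → refl ; (suc zero) k → refl ; (suc (suc j)) k → refl }) n)
      (evaluateAt-x n)

    -- Horner's rule for f = 1 + x f². It is meant for f = `c`, with X = z³ as well as with X = w.
    compose-quadratic : ∀ f → f 0 ≡ 1ℚ → tail f ≈ f * f →
      compose f X X₀≡0 ≈ # 1 + X * (compose f X X₀≡0 * compose f X X₀≡0)
    compose-quadratic f f₀ f′ n = trans (unfold (const ∘ f) n)
      (cong₂ ℚ._+_ (trans (const-cong f₀ n) (sym (#1≈1# n)))
        (S.*-congˡ {X} (λ k → trans (compose-cong f′ k) (compose-* f f k)) n))

  module Evaluation (T : Series) where
    private
      module P = PowerSeries polynomialRing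
      module B = RingNotation P.seriesRing
      ⟦_⟧ : Polynomial → Series
      ⟦ p ⟧ = evaluate T p

    evaluate-+ : ∀ p q → ⟦ addᴾ p q ⟧ ≈ ⟦ p ⟧ + ⟦ q ⟧
    evaluate-+ []      q       n = sym (S.+-identityˡ ⟦ q ⟧ n)
    evaluate-+ (a ∷ p) []      n = sym (S.+-identityʳ ⟦ a ∷ p ⟧ n)
    evaluate-+ (a ∷ p) (b ∷ q) n = trans
      (cong₂ ℚ._+_ (const-+ a b n) (S.*-congˡ {T} (evaluate-+ p q) n))
      (solve 5 (λ a b t p q → (a :+ b) :+ t :* (p :+ q) := (a :+ t :* p) :+ (b :+ t :* q))
         S.refl (const a) (const b) T ⟦ p ⟧ ⟦ q ⟧ n)
      where open Composition z refl

    evaluate-scale : ∀ a p → ⟦ map (a ℚ.*_) p ⟧ ≈ const a * ⟦ p ⟧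
    evaluate-scale a []      n = sym (S.zeroʳ (const a) n)
    evaluate-scale a (b ∷ p) n = trans
      (cong₂ ℚ._+_ (const-* a b n) (S.*-congˡ {T} (evaluate-scale a p) n))
      (solve 4 (λ a b t p → a :* b :+ t :* (a :* p) := a :* (b :+ t :* p))
         S.refl (const a) (const b) T ⟦ p ⟧ n)

    evaluate-* : ∀ p q → ⟦ mulᴾ p q ⟧ ≈ ⟦ p ⟧ * ⟦ q ⟧
    evaluate-* []      q n = sym (S.zeroˡ ⟦ q ⟧ n)
    evaluate-* (a ∷ p) q n = trans (evaluate-+ (map (a ℚ.*_) q) (0ℚ ∷ mulᴾ p q) n) (trans
      (cong₂ ℚ._+_ (evaluate-scale a q n)
        (cong (S.0# n ℚ.+_) (S.*-congˡ {T} (evaluate-* p q) n)))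
      (solve 4 (λ a q t p → a :* q :+ (:# 0 :+ t :* (p :* q)) := (a :+ t :* p) :* q)
         S.refl (const a) ⟦ q ⟧ T ⟦ p ⟧ n))

    evaluate-neg : ∀ p → ⟦ map (λ a → ℚ.- a) p ⟧ ≈ - ⟦ p ⟧
    evaluate-neg []      zero    = refl
    evaluate-neg []      (suc n) = refl
    evaluate-neg (a ∷ p) n = trans
      (cong₂ ℚ._+_ (const-neg a n) (S.*-congˡ {T} (evaluate-neg p) n))
      (solve 3 (λ a t p → :- a :+ t :* (:- p) := :- (a :+ t :* p)) S.refl (const a) T ⟦ p ⟧ n)
      where open Composition z refl

    evaluate-constant : ∀ a → ⟦ a ∷ [] ⟧ ≈ const a
    evaluate-constant a n =
      trans (cong (const a n ℚ.+_) (S.zeroʳ T n)) (S.+-identityʳ (const a) n)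

    evaluate-0 : ∀ p → (∀ j → coefficient p j ≡ 0ℚ) → ⟦ p ⟧ ≈ S.0#
    evaluate-0 []      e n = refl
    evaluate-0 (a ∷ p) e n = trans
      (cong₂ ℚ._+_ (const-cong (e 0) n) (S.*-congˡ {T} (evaluate-0 p (e ∘ suc)) n))
      (trans (S.+-identityˡ (T * S.0#) n) (S.zeroʳ T n))

    -- Equality of polynomials disregards trailing zeros, so one list may be longer; its surplus
    -- evaluates to zero.
    evaluate-cong : ∀ p q → (∀ j → coefficient p j ≡ coefficient q j) → ⟦ p ⟧ ≈ ⟦ q ⟧
    evaluate-cong []      q       e n = sym (evaluate-0 q (sym ∘ e) n)
    evaluate-cong (a ∷ p) []      e n = evaluate-0 (a ∷ p) e n
    evaluate-cong (a ∷ p) (b ∷ q) e n = cong₂ ℚ._+_ (const-cong (e 0) n)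
      (S.*-congˡ {T} (evaluate-cong p q (e ∘ suc)) n)

    -- The map ℚ[t]⟦x⟧ → ℚ⟦z⟧⟦x⟧ induced by t ↦ T.
    values : BivariateSeries → S²-Series.Series
    values f k = ⟦ f k ⟧

    values-* : ∀ f g → values (f B.* g) S².≈ values f S².* values g
    values-* f g zero n = trans (evaluate-+ (mulᴾ (f 0) (g 0)) [] n)
      (cong (ℚ._+ S.0# n) (evaluate-* (f 0) (g 0) n))
    values-* f g (suc k) n = trans (evaluate-+ (mulᴾ (f 0) (g (suc k))) ((P.tail f B.* g) k) n)
      (cong₂ ℚ._+_ (evaluate-* (f 0) (g (suc k)) n) (values-* (P.tail f) g k n))

    values-+ : ∀ f g → values (f B.+ g) S².≈ values f S².+ values g
    values-+ f g k = evaluate-+ (f k) (g k)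

    values-neg : ∀ f → values (B.- f) S².≈ S².- values f
    values-neg f k = evaluate-neg (f k)

    values-const : ∀ p → values (P.const p) S².≈ S²-Series.const ⟦ p ⟧
    values-const p zero    n = refl
    values-const p (suc k) n = refl

    private
      module D² = Division ℚ⟦z⟧

      step : Polynomial → BivariateSeries → BivariateSeries → BivariateSeries
      step u g h = P.const u B.* (B.1# B.- ([] P.⊲ P.tail g B.* h))

    values-1 : values B.1# S².≈ S².1#
    values-1 zero    n = evaluate-constant 1ℚ n
    values-1 (suc k) n = refl

    values-step : ∀ u g {h h′} → values h S².≈ h′ →
                  values (step u g h) S².≈ D².inverseStep ⟦ u ⟧ (values g) h′
    values-step u g {h} {h′} e = S².trans {values (step u g h)} {values (P.const u) S².* values v}
        {D².inverseStep ⟦ u ⟧ (values g) h′}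
        (values-* (P.const u) v)
        (S².*-cong {values (P.const u)} {S²-Series.const ⟦ u ⟧} {values v}
          (values-const u) v-value)
      where
      w = [] P.⊲ P.tail g B.* h
      v = B.1# B.- w
      w′ = S.0# S²-Series.⊲ values (P.tail g) S².* h′
      w-value : values w S².≈ w′
      w-value zero    n = refl
      w-value (suc k) n = trans (values-* (P.tail g) h k n)
        (S².*-congˡ {values (P.tail g)} {values h} {h′} e k n)
      v-value : values v S².≈ S².1# S².+ (S².- w′)
      v-value k n = trans (values-+ B.1# (B.- w) k n)
        (cong₂ ℚ._+_ (values-1 k n) (trans (values-neg w k n) (cong ℚ.-_ (w-value k n))))

    -- `values` carries each iterate of the inversion over ℚ[t] to the corresponding iterate over
    -- ℚ⟦z⟧. The equation of the quotient is thus proved in ℚ⟦z⟧⟦x⟧, whose ring laws are at hand,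
    -- rather than in ℚ[t]⟦x⟧.
    values-divide : ∀ f g p → values (P.divide f g p) S².* values g S².≈ values f
    values-divide f g p@(u , ug₀≈1) k n = trans
        (S².*-congʳ {values g} {values (P.divide f g p)} {PowerSeries.divide S.rawRing (values f) (values g) p′}
          (λ j i → trans (values-* f (P.fixpoint (step u g)) j i)
            (S².*-congˡ {values f} {values (P.fixpoint (step u g))} {D².inverse (values g) p′} fixpoint-value j i)) k n)
        (D².divide-* (values f) (values g) p′ k n)
      where
      p′ : LeftInvertible S._≈_ 1# _*_ ⟦ g 0 ⟧
      p′ = ⟦ u ⟧ , λ n → trans (sym (evaluate-* u (g 0) n))
        (trans (evaluate-cong (mulᴾ u (g 0)) (1ℚ ∷ []) ug₀≈1 n) (evaluate-constant 1ℚ n))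

      iterate : ∀ k → values (Endo._^_ BivariateSeries (step u g) k B.0#)
                      S².≈ Endo._^_ S²-Series.Series (D².inverseStep ⟦ u ⟧ (values g)) k S².0#
      iterate zero    zero    n = refl
      iterate zero    (suc k) n = refl
      iterate (suc k) = values-step u g (iterate k)

      fixpoint-value : values (P.fixpoint (step u g)) S².≈ D².inverse (values g) p′
      fixpoint-value k = iterate (suc k) k


-- From functional equations to the two closed forms

module ClosedForms where

  open import Defs
  open import Data.List.Base using ([]; _∷_)
  open import Data.Nat.Base as ℕ using (ℕ; zero; suc)
  open import Data.Product.Base using (_,_)
  open import Data.Rational.Base as ℚ using (ℚ; 0ℚ; 1ℚ; ½)
  import Data.Rational.Properties as ℚₚ
  open import Function.Base using (_∘_)
  open import Relation.Binary.PropositionalEquality using (_≡_; refl; sym; trans; cong; cong₂)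
  open IntegerSolver
  open SeriesRing
  open DivisionAndSubstitution
  open Identities
  open RationalSeries
  open BivariateEvaluation

  open PowerSeriesRing ℚ-ring
  open Division ℚ-ring
  open RingIdentities ℚ⟦z⟧
  open RingSolver ℚ⟦z⟧ hiding (Polynomial)
  open import Relation.Binary.Reasoning.Setoid S.setoid

  module Substituted (T X : Series) (X₀≡0 : X 0 ≡ 0ℚ) where
    open Substitution.At ℚ-ring X X₀≡0
    open Evaluation T
    open Composition X X₀≡0
    private
      module B = RingNotation (PowerSeries.seriesRing polynomialRing)

      ⟪_⟫ : BivariateSeries → Series
      ⟪ f ⟫ = f ⟨ T , X ⟩[ X₀≡0 ]

    +-value : ∀ f g → ⟪ f B.+ g ⟫ ≈ ⟪ f ⟫ + ⟪ g ⟫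
    +-value f g n = trans (evaluateAt-cong (values-+ f g) n) (evaluateAt-+ (values f) (values g) n)

    *-value : ∀ f g → ⟪ f B.* g ⟫ ≈ ⟪ f ⟫ * ⟪ g ⟫
    *-value f g n = trans (evaluateAt-cong (values-* f g) n) (evaluateAt-* (values f) (values g) n)

    neg-value : ∀ f → ⟪ B.- f ⟫ ≈ - ⟪ f ⟫
    neg-value f n = trans (evaluateAt-cong (values-neg f) n) (evaluateAt-neg (values f) n)

    #-value : ∀ k → ⟪ B.# k ⟫ ≈ # k
    #-value zero    n = trans
      (evaluateAt-cong {values (B.# 0)} {λ _ → S.0#} (λ { zero k → refl ; (suc j) k → refl }) n)
      (evaluateAt-0 n)
    #-value (suc k) n = trans (+-value B.1# (B.# k) n)
      (cong₂ ℚ._+_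
        (trans (evaluateAt-cong {values B.1#} {S²-Series.const 1#} values-1 n) (evaluateAt-const 1# n))
        (#-value k n))

    x-value : ⟪ Bivariate.x ⟫ ≈ X
    x-value n = trans
      (evaluateAt-cong {values Bivariate.x} {S²-Series.x}
        (λ { zero k → refl ; (suc zero) k → evaluate-constant 1ℚ k ; (suc (suc j)) k → refl }) n)
      (evaluateAt-x n)

    t-value : ⟪ Bivariate.t ⟫ ≈ T
    t-value n = trans
      (evaluateAt-cong {values Bivariate.t} {S²-Series.const T}
        (λ { zero k → T-value k ; (suc j) k → refl }) n)
      (evaluateAt-const T n)
      where
      T-value : evaluate T (0ℚ ∷ 1ℚ ∷ []) ≈ T
      T-value = begin
        S.0# + T * (1# + T * S.0#)   ≈⟨ solve 2 (λ t o → :# 0 :+ t :* (o :+ t :* :# 0) := t :* o) S.refl T 1# ⟩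
        T * 1#                       ≈⟨ S.*-identityʳ T ⟩
        T                            ∎

    fromUnivariate-value : ∀ f → ⟪ Bivariate.fromUnivariate f ⟫ ≈ compose f X X₀≡0
    fromUnivariate-value f = evaluateAt-cong {values (Bivariate.fromUnivariate f)} {const ∘ f}
      (λ k → evaluate-constant (f k))

    private
      r = √ (# 1 - # 2 * z - # 3 * z ^ 2) refl

    denominator-value : ⟪ Bivariate.denominator ⟫ ≈ # 1 - # 2 * T * X + X + compose r X X₀≡0
    denominator-value n = trans (+-value (B.# 1 B.- B.# 2 B.* Bivariate.t B.* Bivariate.x B.+ Bivariate.x) (Bivariate.fromUnivariate r) n)
      (cong₂ ℚ._+_ (trans (+-value (B.# 1 B.- B.# 2 B.* Bivariate.t B.* Bivariate.x) Bivariate.x n)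
        (cong₂ ℚ._+_ (trans (+-value (B.# 1) (B.- (B.# 2 B.* Bivariate.t B.* Bivariate.x)) n)
          (cong₂ ℚ._+_ (#-value 1 n) (trans (neg-value (B.# 2 B.* Bivariate.t B.* Bivariate.x) n)
            (cong ℚ.-_ (2tx n)))))
          (x-value n)))
        (fromUnivariate-value r n))
      where
      2tx : ⟪ B.# 2 B.* Bivariate.t B.* Bivariate.x ⟫ ≈ # 2 * T * X
      2tx k = trans (*-value (B.# 2 B.* Bivariate.t) Bivariate.x k)
        (S.*-cong {⟪ B.# 2 B.* Bivariate.t ⟫} {# 2 * T} {⟪ Bivariate.x ⟫} {X}
          (λ j → trans (*-value (B.# 2) Bivariate.t j)
            (S.*-cong {⟪ B.# 2 ⟫} {# 2} {⟪ Bivariate.t ⟫} {T} (#-value 2) t-value j))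
          x-value k)

    m-value : ⟪ m ⟫ * ⟪ Bivariate.denominator ⟫ ≈ # 2
    m-value n = trans (sym (evaluateAt-* (values m) (values Bivariate.denominator) n))
      (trans (evaluateAt-cong {values m S².* values Bivariate.denominator} {values (B.# 2)}
               (values-divide (B.# 2) Bivariate.denominator
                 (½ ∷ [] , λ { 0 → refl ; 1 → refl ; (suc (suc j)) → refl })) n)
             (#-value 2 n))

    F-value : ⟪ F ⟫ ≈ # 1 + X * T * ⟪ m ⟫
    F-value n = trans (+-value (B.# 1) (Bivariate.x B.* Bivariate.t B.* m) n)
      (cong₂ ℚ._+_ (#-value 1 n) (trans (*-value (Bivariate.x B.* Bivariate.t) m n)
        (S.*-congʳ {⟪ m ⟫} {⟪ Bivariate.x B.* Bivariate.t ⟫} {X * T}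
          (λ k → trans (*-value Bivariate.x Bivariate.t k)
            (S.*-cong {⟪ Bivariate.x ⟫} {X} {⟪ Bivariate.t ⟫} {T} x-value t-value k)) n)))

    root-value : compose r X X₀≡0 * compose r X X₀≡0 ≈ # 1 - # 2 * X - # 3 * (X * X)
    root-value = begin
      compose r X X₀≡0 * compose r X X₀≡0
        ≈⟨ compose-* r r ⟨
      compose (r * r) X X₀≡0
        ≈⟨ compose-cong {r * r} {# 1 - # 2 * z - # 3 * z ^ 2} (√-square (# 1 - # 2 * z - # 3 * z ^ 2) refl) ⟩
      compose (# 1 - # 2 * z - # 3 * z ^ 2) X X₀≡0
        ≈⟨ minus (# 1 - # 2 * z) (# 3 * z ^ 2) ⟩
      compose (# 1 - # 2 * z) X X₀≡0 - compose (# 3 * z ^ 2) X X₀≡0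
        ≈⟨ S.+-cong {compose (# 1 - # 2 * z) X X₀≡0} {# 1 - # 2 * X} (λ n → trans (minus (# 1) (# 2 * z) n)
             (cong₂ ℚ._-_ (compose-# 1 n) (times 2 z X compose-z n)))
           (λ n → cong ℚ.-_ (times 3 (z ^ 2) (X * X) square n)) ⟩
      # 1 - # 2 * X - # 3 * (X * X) ∎
      where
      minus : ∀ f g → compose (f - g) X X₀≡0 ≈ compose f X X₀≡0 - compose g X X₀≡0
      minus f g n = trans (compose-+ f (- g) n) (cong (compose f X X₀≡0 n ℚ.+_) (compose-neg g n))
      times : ∀ k f Y → compose f X X₀≡0 ≈ Y → compose (# k * f) X X₀≡0 ≈ # k * Y
      times k f Y e n = trans (compose-* (# k) f n)
        (S.*-cong {compose (# k) X X₀≡0} {# k} {compose f X X₀≡0} {Y} (compose-# k) e n)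
      square : compose (z ^ 2) X X₀≡0 ≈ X * X
      square n = trans (compose-cong {z ^ 2} {z * z} (S.*-congˡ {z} (S.*-identityʳ z)) n)
        (trans (compose-* z z n) (S.*-cong {compose z X X₀≡0} {X} {compose z X X₀≡0} {X} compose-z compose-z n))

  /-* : ∀ f g .{{_ : ℚ.NonZero (g 0)}} → f / g * g ≈ f
  /-* f g = divide-* f g (ℚ.1/ g 0 , ℚₚ.*-inverseˡ (g 0))

  /-unique : ∀ {f g h} .{{_ : ℚ.NonZero (g 0)}} → h * g ≈ f → h ≈ f / g
  /-unique {f} {g} {h} = divide-unique {f} {g} {h} (ℚ.1/ g 0 , ℚₚ.*-inverseˡ (g 0))

  -- `S₀` fixes the sign of the root, which `√-unique` needs.
  record IsRoot (C S : Series) : Set where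
    field
      C₀     : C 0 ≡ 1ℚ
      S₀     : S 0 ≡ 1ℚ
      square : S * S ≈ C * (# 4 - # 3 * C)

  -- C, w and D are the series c(z³), z³ c(z³) and c(w); A (1 - z - 2wD) = 1 and
  -- (1 - 2wD)² = 1 - 4w = (4 - 3C) / C.
  root-equation : ∀ {A C w D S} → IsRoot C S →
    C ≈ # 1 + z ^ 3 * (C * C) → w ≈ z ^ 3 * C → D ≈ # 1 + w * (D * D) →
    A ≈ # 1 + z * A + (w * (D * A) + w * (D * A)) → A * (S - z * C) ≈ C
  root-equation {A} {C} {w} {D} {S} isRoot C-eq w-eq D-eq A-eq n = trans
      (S.*-congˡ {A} {S - z * C} {root - z * C} (λ k → cong (ℚ._- (z * C) k) (sym (root≈S k))) n)
      (counting-series {A} {C} {D} {z ^ 3} {w} {z} C-eq w-eq D-eq A-eq n)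
    where
    open IsRoot isRoot renaming (square to S-eq)
    root : Series
    root = C * (# 1 - # 2 * (w * D))

    w₀ : w 0 ℚ.* D 0 ≡ 0ℚ
    w₀ = trans (cong (ℚ._* D 0) (trans (w-eq 0) (cong (λ a → 0ℚ ℚ.* a ℚ.+ 0ℚ) C₀))) (ℚₚ.*-zeroˡ (D 0))

    -- The factor z³ of w kills the constant term of w D, so `root` starts with C 0 = 1 and is the
    -- root that `√` selects.
    root₀ : root 0 ≡ 1ℚ
    root₀ = cong₂ (λ a b → a ℚ.* ((1ℚ ℚ.+ 0ℚ) ℚ.- ((# 2) 0 ℚ.* (b ℚ.+ 0ℚ) ℚ.+ 0ℚ)) ℚ.+ 0ℚ) C₀ w₀

    root≈S : root ≈ S
    root≈S k = trans (√-unique {root * root} {root} square₀ root₀ (λ _ → refl) k)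
      (sym (√-unique {root * root} {S} square₀ S₀ (λ j → trans (S-eq j) (sym (root-square′ j))) k))
      where
      root-square′ : root * root ≈ C * (# 4 - # 3 * C)
      root-square′ = root-square {A} {C} {D} {z ^ 3} {w} {z} C-eq w-eq D-eq A-eq
      square₀ : (root * root) 0 ≡ 1ℚ
      square₀ = cong (λ a → a ℚ.* a ℚ.+ 0ℚ) root₀

  -- Both sides satisfy the same linear equation Y (S - zC) = C, and S - zC has constant term 1.
  motzkin-substitution : ∀ {A C S Q T X} → IsRoot C S →
    Q * (# 1 - z) ≈ # 1 → T * (# 1 - z) ≈ # 2 → X ≈ C - # 1 → (X₀≡0 : X 0 ≡ 0ℚ) →
    A * (S - z * C) ≈ C → A ≈ Q * F ⟨ T , X ⟩[ X₀≡0 ]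
  motzkin-substitution {A} {C} {S} {Q} {T} {X} isRoot Q-eq T-eq′ X-eq X₀≡0 A-eq n = trans
      (*-cancelʳ (S - z * C) (1ℚ , cong₂ (λ s c → 1ℚ ℚ.* (s ℚ.- (0ℚ ℚ.* c ℚ.+ 0ℚ))) S₀ C₀)
        {A} {Q * (# 1 + X * T * M)} (λ k → trans (A-eq k) (sym (product k))) n)
      (S.*-congˡ {Q} {# 1 + X * T * M} {F ⟨ T , X ⟩[ X₀≡0 ]} (λ k → sym (F-value k)) n)
    where
    open IsRoot isRoot renaming (square to S-eq)
    open Substituted T X X₀≡0
    M den r : Series
    M = m ⟨ T , X ⟩[ X₀≡0 ]
    den = Bivariate.denominator ⟨ T , X ⟩[ X₀≡0 ]
    r = compose (√ (# 1 - # 2 * z - # 3 * z ^ 2) refl) X X₀≡0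

    T-eq : T ≈ # 2 * Q
    T-eq = *-cancelʳ (# 1 - z) (1ℚ , refl) {T} {# 2 * Q} λ n → trans (T-eq′ n) (sym (2Q n))
      where
      2Q : # 2 * Q * (# 1 - z) ≈ # 2
      2Q = begin
        # 2 * Q * (# 1 - z)    ≈⟨ S.*-assoc (# 2) Q (# 1 - z) ⟩
        # 2 * (Q * (# 1 - z))  ≈⟨ S.*-congˡ {# 2} Q-eq ⟩
        # 2 * # 1              ≈⟨ solve 0 (:# 2 :* :# 1 := :# 2) S.refl ⟩
        # 2                    ∎

    -- For X = C - 1 the radicand 1 - 2X - 3X² equals C (4 - 3C), so both roots have the same square
    -- and the same constant term.
    r≈S : r ≈ S
    r≈S k = trans (√-unique {S * S} {r} square₀ refl
        (λ j → trans (root-value j) (trans (r-eq j) (sym (S-eq j)))) k)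
      (sym (√-unique {S * S} {S} square₀ S₀ (λ _ → refl) k))
      where
      square₀ : (S * S) 0 ≡ 1ℚ
      square₀ = cong (λ a → a ℚ.* a ℚ.+ 0ℚ) S₀
      r-eq : # 1 - # 2 * X - # 3 * (X * X) ≈ C * (# 4 - # 3 * C)
      r-eq = modulo (- (# 3 * (X + C - # 1) + # 2)) X-eq (solve 2 (λ C X →
        :# 1 :- :# 2 :* X :- :# 3 :* (X :* X) := C :* (:# 4 :- :# 3 :* C)
          :+ (:- (:# 3 :* (X :+ C :- :# 1) :+ :# 2)) :* (X :- (C :- :# 1))) S.refl C X)

    den-eq : den ≈ # 1 - # 2 * T * X + X + S
    den-eq n = trans (denominator-value n) (cong ((# 1 - # 2 * T * X + X) n ℚ.+_) (r≈S n))

    -- The constant term of `den` is 1 - 0 + 0 + 1 = 2 for every T, because X has none.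
    den₀ : ½ ℚ.* den 0 ≡ 1ℚ
    den₀ = trans (cong (½ ℚ.*_) (den-eq 0)) (trans
      (cong₂ (λ x s → ½ ℚ.* ((1ℚ ℚ.+ 0ℚ ℚ.- ((# 2 * T) 0 ℚ.* x ℚ.+ 0ℚ)) ℚ.+ x ℚ.+ s)) X₀≡0 S₀)
      (cong (λ y → ½ ℚ.* ((1ℚ ℚ.+ 0ℚ ℚ.- (y ℚ.+ 0ℚ)) ℚ.+ 0ℚ ℚ.+ 1ℚ)) (ℚₚ.*-zeroʳ ((# 2 * T) 0))))

    product : Q * (# 1 + X * T * M) * (S - z * C) ≈ C
    product = *-cancelʳ den (½ , den₀) {Q * (# 1 + X * T * M) * (S - z * C)} {C}
      (substituted-form {C} {Q} {X} {S} {M} {T} {den} {z} X-eq Q-eq T-eq den-eq m-value S-eq)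

  -- Wrapping ≈ into a record keeps the type checker from comparing series by
  -- their unfolded coefficients.
  infix 4 _≈ᴿ_
  record _≈ᴿ_ (f g : Series) : Set where
    constructor wrap
    field unwrap : f ≈ g
  open _≈ᴿ_

  -- Here too the series of the theorem are variables tied by equations. The concrete ones enter
  -- only as instances of these records, where the equations hold by `refl` or by the law of
  -- division.
  record Denominator (C f : Series) (p : f 0 ≡ 1ℚ) (g : Series) : Set where
    field
      C₀   : C 0 ≡ 1ℚ
      f-eq : f ≈ C * (# 4 - # 3 * C)
      g-eq : g ≈ √ f p - z * C

    isRoot : IsRoot C (√ f p)
    isRoot = record { C₀ = C₀ ; S₀ = refl ; square = λ n → trans (√-square f p n) (f-eq n) }

  record Arguments (C Q T X : Series) : Set where
    field
      Q-eq : Q * (# 1 - z) ≈ # 1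
      T-eq : T * (# 1 - z) ≈ # 2
      X-eq : X ≈ C - # 1
      X₀≡0 : X 0 ≡ 0ℚ

  record Equations (C A : Series) : Set where
    field
      w D  : Series
      C-eq : C ≈ # 1 + z ^ 3 * (C * C)
      w-eq : w ≈ z ^ 3 * C
      D-eq : D ≈ # 1 + w * (D * D)
      A-eq : A ≈ # 1 + z * A + (w * (D * A) + w * (D * A))

  module _ {C f p g A} (denominator : Denominator C f p g) (equations : Equations C A) where
    open Denominator denominator
    open Equations equations

    private
      A-root : A * (√ f p - z * C) ≈ C
      A-root = root-equation {A} {C} {w} {D} {√ f p} isRoot C-eq w-eq D-eq A-eq

    quotient : .{{_ : ℚ.NonZero (g 0)}} → A ≈ᴿ C / g
    quotient = wrap (/-unique {C} {g} {A} λ n →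
      trans (S.*-congˡ {A} {g} {√ f p - z * C} g-eq n) (A-root n))

    motzkinValue : ∀ {Q T X} → (arguments : Arguments C Q T X) →
                   A ≈ᴿ Q * F ⟨ T , X ⟩[ Arguments.X₀≡0 arguments ]
    motzkinValue {Q} {T} {X} arguments =
      wrap (motzkin-substitution {A} {C} {√ f p} {Q} {T} {X} isRoot Q-eq T-eq X-eq X₀≡0 A-root)
      where open Arguments arguments

  module _ {A : Series} (equations : Equations c[z³] A) where

    private
      denominator : Denominator c[z³] (c[z³] * (# 4 - # 3 * c[z³])) refl
                      (√ (c[z³] * (# 4 - # 3 * c[z³])) refl - z * c[z³])
      denominator = record { C₀ = refl ; f-eq = λ n → refl ; g-eq = λ n → refl }

      isQuotient : A ≈ᴿ c[z³] / (√ (c[z³] * (# 4 - # 3 * c[z³])) refl - z * c[z³])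
      isQuotient = quotient denominator equations

      Q-eq : # 1 / (# 1 - z) * (# 1 - z) ≈ # 1
      Q-eq = /-* (# 1) (# 1 - z)

      T-eq : # 2 / (# 1 - z) * (# 1 - z) ≈ # 2
      T-eq = /-* (# 2) (# 1 - z)

      arguments : Arguments c[z³] (# 1 / (# 1 - z)) (# 2 / (# 1 - z)) (c[z³] - # 1)
      arguments = record { Q-eq = Q-eq ; T-eq = T-eq ; X-eq = λ n → refl ; X₀≡0 = refl }

      isMotzkinValue : A ≈ᴿ (# 1 / (# 1 - z)) * F ⟨ # 2 / (# 1 - z) , c[z³] - # 1 ⟩[ refl ]
      isMotzkinValue = motzkinValue denominator equations arguments

    closed-form : A ≈ c[z³] / (√ (c[z³] * (# 4 - # 3 * c[z³])) refl - z * c[z³])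
    closed-form = unwrap isQuotient

    motzkin-form : A ≈ (# 1 / (# 1 - z)) * F ⟨ # 2 / (# 1 - z) , c[z³] - # 1 ⟩[ refl ]
    motzkin-form = unwrap isMotzkinValue


-- Graded sets, their sums and products, and cardinalities

module GradedFamilies where

  open import Data.Empty using (⊥)
  open import Data.Fin.Base using (Fin)
  open import Data.Fin.Properties using (+↔⊎; *↔×; 0↔⊥; 1↔⊤)
  open import Data.Nat.Base using (ℕ; zero; suc; _+_; _*_; _≤_; z≤n; s≤s)
  import Data.Nat.Properties as ℕₚ
  open import Data.Product.Base using (Σ; ∃; _×_; _,_)
  open import Data.Product.Function.NonDependent.Propositional using (_×-↔_)
  open import Data.Sum.Base using (_⊎_; inj₁; inj₂; [_,_]′)
  open import Data.Sum.Function.Propositional using (_⊎-↔_)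
  open import Data.Unit.Base using (⊤; tt)
  open import Function.Base using (_∘_)
  open import Function.Bundles using (_↔_; mk↔ₛ′; module Inverse)
  open import Function.Properties.Inverse using (↔-sym; ↔-trans; ↔-refl)
  open import Relation.Binary.PropositionalEquality using (_≡_; refl; sym; trans; cong)

  Graded : Set₁
  Graded = ℕ → Set

  Fiber : {X : Set} → (X → ℕ) → Graded
  Fiber size n = ∃ λ x → size x ≡ n

  One : Graded
  One zero    = ⊤
  One (suc n) = ⊥

  Shift : Graded → Graded
  Shift G zero    = ⊥
  Shift G (suc n) = G n

  -- Defined by the same recursion as the product of series, so that cardinalities translate into
  -- coefficients of a product without reindexing a sum.
  Convolution : Graded → Graded → Graded
  Convolution G H zero    = G 0 × H 0
  Convolution G H (suc n) = G 0 × H (suc n) ⊎ Convolution (G ∘ suc) H n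

  infix 4 _≅_
  _≅_ : Graded → Graded → Set
  G ≅ H = ∀ n → G n ↔ H n

  Shift-cong : ∀ {G H} → G ≅ H → Shift G ≅ Shift H
  Shift-cong e zero    = ↔-refl
  Shift-cong e (suc n) = e n

  module _ {X Y : Set} {s : X → ℕ} {t : Y → ℕ} where

    Fiber-cong : (e : X ↔ Y) → (∀ x → t (Inverse.to e x) ≡ s x) → Fiber s ≅ Fiber t
    Fiber-cong e st n = mk↔ₛ′
      (λ (x , p) → to x , trans (st x) p)
      (λ (y , p) → from y , trans (sym (st (from y))) (trans (cong t (strictlyInverseˡ y)) p))
      (λ (y , p) → Σ-≡ (strictlyInverseˡ y))
      (λ (x , p) → Σ-≡ (strictlyInverseʳ x))
      where
      open Inverse e
      Σ-≡ : ∀ {Z : Set} {u : Z → ℕ} {a b : Z} {p : u a ≡ n} {q : u b ≡ n} → a ≡ b → (a , p) ≡ (b , q)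
      Σ-≡ refl = cong (_ ,_) (ℕₚ.≡-irrelevant _ _)

    Fiber-⊎ : Fiber [ s , t ]′ ≅ λ n → Fiber s n ⊎ Fiber t n
    Fiber-⊎ n = mk↔ₛ′
      (λ { (inj₁ x , p) → inj₁ (x , p) ; (inj₂ y , p) → inj₂ (y , p) })
      (λ { (inj₁ (x , p)) → inj₁ x , p ; (inj₂ (y , p)) → inj₂ y , p })
      (λ { (inj₁ _) → refl ; (inj₂ _) → refl })
      (λ { (inj₁ _ , _) → refl ; (inj₂ _ , _) → refl })

  Fiber-suc : ∀ {X : Set} {s : X → ℕ} → Fiber (suc ∘ s) ≅ Shift (Fiber s)
  Fiber-suc zero    = mk↔ₛ′ (λ ()) (λ ()) (λ ()) (λ ())
  Fiber-suc (suc n) = mk↔ₛ′ (λ (x , p) → x , ℕₚ.suc-injective p) (λ (x , p) → x , cong suc p)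
    (λ (x , p) → cong (x ,_) (ℕₚ.≡-irrelevant _ _)) (λ (x , p) → cong (x ,_) (ℕₚ.≡-irrelevant _ _))

  Fiber-⊤ : Fiber {⊤} (λ _ → 0) ≅ One
  Fiber-⊤ zero    = mk↔ₛ′ (λ _ → tt) (λ _ → tt , refl) (λ _ → refl) (λ { (tt , refl) → refl })
  Fiber-⊤ (suc n) = mk↔ₛ′ (λ ()) (λ ()) (λ ()) (λ ())

  module _ {X Y : Set} (s : X → ℕ) (t : Y → ℕ) where

    private
      Splitting : Graded → Graded → Graded
      Splitting G H n = Σ ℕ λ i → Σ ℕ λ j → (i + j ≡ n) × G i × H j

      Splitting↔Convolution : ∀ G H → Splitting G H ≅ Convolution G H
      Splitting↔Convolution G H zero = mk↔ₛ′
        (λ { (zero , zero , refl , x , y) → x , y })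
        (λ (x , y) → 0 , 0 , refl , x , y)
        (λ _ → refl)
        (λ { (zero , zero , refl , x , y) → refl })
      Splitting↔Convolution G H (suc n) = mk↔ₛ′ to′ from′ invˡ invʳ
        where
        module I = Inverse (Splitting↔Convolution (G ∘ suc) H n)
        up : Splitting (G ∘ suc) H n → Splitting G H (suc n)
        up (i , j , p , x , y) = suc i , j , cong suc p , x , y
        to′ : Splitting G H (suc n) → Convolution G H (suc n)
        to′ (zero  , _ , refl , x , y) = inj₁ (x , y)
        to′ (suc i , j , p    , x , y) = inj₂ (I.to (i , j , ℕₚ.suc-injective p , x , y))
        from′ : Convolution G H (suc n) → Splitting G H (suc n)
        from′ (inj₁ (x , y)) = 0 , suc n , refl , x , y
        from′ (inj₂ c)       = up (I.from c)
        to-up : ∀ a → to′ (up a) ≡ inj₂ (I.to a)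
        to-up (i , j , p , x , y) =
          cong (λ q → inj₂ (I.to (i , j , q , x , y))) (ℕₚ.≡-irrelevant _ _)
        invˡ : ∀ c → to′ (from′ c) ≡ c
        invˡ (inj₁ _) = refl
        invˡ (inj₂ c) = trans (to-up (I.from c)) (cong inj₂ (I.strictlyInverseˡ c))
        invʳ : ∀ a → from′ (to′ a) ≡ a
        invʳ (zero  , _ , refl , x , y) = refl
        invʳ (suc i , j , p    , x , y) = trans (cong up (I.strictlyInverseʳ _))
          (cong (λ q → suc i , j , q , x , y) (ℕₚ.≡-irrelevant _ _))

    Fiber-× : Fiber (λ (x , y) → s x + t y) ≅ Convolution (Fiber s) (Fiber t)
    Fiber-× n = ↔-trans (mk↔ₛ′
      (λ ((x , y) , p) → s x , t y , p , (x , refl) , (y , refl))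
      (λ { (_ , _ , p , (x , refl) , (y , refl)) → (x , y) , p })
      (λ { (_ , _ , p , (x , refl) , (y , refl)) → refl })
      (λ _ → refl)) (Splitting↔Convolution (Fiber s) (Fiber t) n)

  Finite : Set → Set
  Finite A = ∃ λ k → A ↔ Fin k

  finite-↔ : ∀ {A B} → A ↔ B → Finite B → Finite A
  finite-↔ e (k , f) = k , ↔-trans e f

  finite-⊎ : ∀ {A B} → Finite A → Finite B → Finite (A ⊎ B)
  finite-⊎ (k , e) (l , f) = k + l , ↔-trans (e ⊎-↔ f) (↔-sym +↔⊎)

  finite-× : ∀ {A B} → Finite A → Finite B → Finite (A × B)
  finite-× (k , e) (l , f) = k * l , ↔-trans (e ×-↔ f) (↔-sym *↔×)

  finite-One : ∀ n → Finite (One n)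
  finite-One zero    = 1 , ↔-sym 1↔⊤
  finite-One (suc n) = 0 , ↔-sym 0↔⊥

  -- The premise asks only for the predecessor of n, as a well-founded induction on the size can
  -- supply; likewise the bounds in `finite-Convolution`.
  finite-Shift : ∀ {G} n → (∀ {k} → suc k ≡ n → Finite (G k)) → Finite (Shift G n)
  finite-Shift zero    fin = 0 , ↔-sym 0↔⊥
  finite-Shift (suc n) fin = fin refl

  finite-Convolution : ∀ {G H} n → (∀ {k} → k ≤ n → Finite (G k)) → (∀ {k} → k ≤ n → Finite (H k)) →
                       Finite (Convolution G H n)
  finite-Convolution zero    g h = finite-× (g z≤n) (h z≤n)
  finite-Convolution (suc n) g h = finite-⊎ (finite-× (g z≤n) (h ℕₚ.≤-refl))
    (finite-Convolution n (g ∘ s≤s) (h ∘ ℕₚ.m≤n⇒m≤1+n))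

  one : ℕ → ℕ
  one zero    = 1
  one (suc n) = 0

  shift : (ℕ → ℕ) → ℕ → ℕ
  shift f zero    = 0
  shift f (suc n) = f n

  convolution : (ℕ → ℕ) → (ℕ → ℕ) → ℕ → ℕ
  convolution f g zero    = f 0 * g 0
  convolution f g (suc n) = f 0 * g (suc n) + convolution (f ∘ suc) g n

  infix 4 _countedBy_
  -- Whereas `Finite` merely provides a cardinality for one size, this names the counting function
  -- for all sizes, which the recurrences below relate.
  _countedBy_ : Graded → (ℕ → ℕ) → Set
  G countedBy f = ∀ n → G n ↔ Fin (f n)

  counted-⊎ : ∀ {G H f g} → G countedBy f → H countedBy g →
              (λ n → G n ⊎ H n) countedBy (λ n → f n + g n)
  counted-⊎ a b n = ↔-trans (a n ⊎-↔ b n) (↔-sym +↔⊎)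

  counted-One : One countedBy one
  counted-One zero    = ↔-sym 1↔⊤
  counted-One (suc n) = ↔-sym 0↔⊥

  counted-Shift : ∀ {G f} → G countedBy f → Shift G countedBy shift f
  counted-Shift a zero    = ↔-sym 0↔⊥
  counted-Shift a (suc n) = a n

  counted-Convolution : ∀ {G H f g} → G countedBy f → H countedBy g →
                        Convolution G H countedBy convolution f g
  counted-Convolution a b zero    = ↔-trans (a 0 ×-↔ b 0) (↔-sym *↔×)
  counted-Convolution a b (suc n) = ↔-trans
    (↔-trans (a 0 ×-↔ b (suc n)) (↔-sym *↔×) ⊎-↔ counted-Convolution (a ∘ suc) b n)
    (↔-sym +↔⊎)


-- Trees with walks: decomposition by the first letter and recurrences

module Codes where

  open import Data.Empty using (⊥-elim)
  open import Data.Fin.Permutation using (↔⇒≡)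
  open import Data.Nat.Base using (ℕ; zero; suc; _+_; _≤_; _<_; s≤s)
  open import Data.Nat.Induction using (<-rec)
  import Data.Nat.Properties as ℕₚ
  open import Data.Product.Base using (Σ; ∃; _×_; _,_; proj₁; proj₂)
  open import Data.Sum.Base using (_⊎_; inj₁; inj₂; [_,_]′)
  open import Data.Sum.Function.Propositional using (_⊎-↔_)
  open import Data.Unit.Base using (⊤; tt)
  open import Function.Base using (_∘_)
  open import Function.Bundles using (_↔_; mk↔ₛ′; module Inverse)
  open import Function.Properties.Inverse using (↔-sym; ↔-trans; ↔-refl)
  open import Relation.Binary.PropositionalEquality using (_≡_; refl; sym; trans; cong; cong₂)
  open GradedFamilies

  -- node L R stands for (L ⊕ 1) ⊖ R, so that the right spine of a tree lists the
  -- skew-indecomposable components of the permutation.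
  data Tree : Set where
    leaf : Tree
    node : Tree → Tree → Tree

  ∣_∣ : Tree → ℕ
  ∣ leaf ∣     = 0
  ∣ node L R ∣ = suc (∣ L ∣ + ∣ R ∣)

  spine : Tree → ℕ
  spine leaf       = 0
  spine (node L R) = suc (spine R)

  -- Words with p letters a and q letters b, in which the letter g may occur where
  -- as many letters a as b remain.
  data Walk : ℕ → ℕ → Set where
    end : Walk 0 0
    a   : ∀ {p q} → Walk p q → Walk (suc p) q
    b   : ∀ {p q} → Walk p q → Walk p (suc q)
    g   : ∀ {p q} → p ≡ q → Walk p q → Walk p q

  flats : ∀ {p q} → Walk p q → ℕ
  flats end     = 0
  flats (a w)   = flats w
  flats (b w)   = flats w
  flats (g _ w) = suc (flats w)

  reflect : ∀ {p q} → Walk p q → Walk q p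
  reflect end     = end
  reflect (a w)   = b (reflect w)
  reflect (b w)   = a (reflect w)
  reflect (g e w) = g (sym e) (reflect w)

  reflect-involutive : ∀ {p q} (w : Walk p q) → reflect (reflect w) ≡ w
  reflect-involutive end     = refl
  reflect-involutive (a w)   = cong a (reflect-involutive w)
  reflect-involutive (b w)   = cong b (reflect-involutive w)
  reflect-involutive (g e w) = cong₂ g (ℕₚ.≡-irrelevant _ _) (reflect-involutive w)

  flats-reflect : ∀ {p q} (w : Walk p q) → flats (reflect w) ≡ flats w
  flats-reflect end     = refl
  flats-reflect (a w)   = flats-reflect w
  flats-reflect (b w)   = flats-reflect w
  flats-reflect (g e w) = cong suc (flats-reflect w)

  -- Three per node: a node is an entry of β, hence a 3-cycle of π with one point among the first
  -- positions, one letter a and one letter b.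
  weight : Tree → ℕ
  weight leaf       = 0
  weight (node L R) = 3 + (weight L + weight R)

  -- The walk starts at height h, the excess of letters b over letters a.
  Code : ℕ → Set
  Code h = Σ Tree λ T → ∃ λ q → q ≡ h + spine T × Walk (spine T) q

  -- The h surplus letters b belong to components opened earlier, whose weight was split off
  -- together with them; so only T and the fixed points count.
  size : ∀ {h} → Code h → ℕ
  size (T , _ , _ , w) = weight T + flats w

  trees : Graded
  trees = Fiber weight

  codes : ℕ → Graded
  codes h = Fiber (size {h})

  trees-≅ : trees ≅ λ n → One n ⊎ Shift (Shift (Shift (Convolution trees trees))) n
  trees-≅ n = ↔-trans (Fiber-cong {t = [ (λ _ → 0) , (λ (L , R) → 3 + (weight L + weight R)) ]′}
      decompose (λ { leaf → refl ; (node L R) → refl }) n)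
    (↔-trans (Fiber-⊎ n) (Fiber-⊤ n ⊎-↔ Fiber-3+ n))
    where
    decompose : Tree ↔ (⊤ ⊎ (Tree × Tree))
    decompose = mk↔ₛ′
      (λ { leaf → inj₁ tt ; (node L R) → inj₂ (L , R) })
      (λ { (inj₁ tt) → leaf ; (inj₂ (L , R)) → node L R })
      (λ { (inj₁ tt) → refl ; (inj₂ _) → refl })
      (λ { leaf → refl ; (node L R) → refl })
    Fiber-3+ : Fiber (λ (L , R) → 3 + (weight L + weight R)) ≅ Shift (Shift (Shift (Convolution trees trees)))
    Fiber-3+ n = ↔-trans (Fiber-suc n) (Shift-cong (λ n → ↔-trans (Fiber-suc n)
      (Shift-cong (λ n → ↔-trans (Fiber-suc n) (Shift-cong (Fiber-× weight weight) n)) n)) n)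

  private
    Branch : ℕ → Graded
    Branch h = Shift (Shift (Shift (Convolution trees (codes h))))

    branch-size : ∀ {h} → Tree × Code h → ℕ
    branch-size (L , c) = 3 + (weight L + size c)

    Fiber-branch : ∀ {h} → Fiber (branch-size {h}) ≅ Branch h
    Fiber-branch n = ↔-trans (Fiber-suc n) (Shift-cong (λ n → ↔-trans (Fiber-suc n)
      (Shift-cong (λ n → ↔-trans (Fiber-suc n) (Shift-cong (Fiber-× weight size) n)) n)) n)

    code-≡ : ∀ {h T q} {e e′ : q ≡ h + spine T} {w w′ : Walk (spine T) q} → w ≡ w′ →
             _≡_ {A = Code h} (T , q , e , w) (T , q , e′ , w′)
    code-≡ {T = T} {q} {e} {e′} {w} refl = cong (λ e → T , q , e , w) (ℕₚ.≡-irrelevant e e′)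

    raise : ∀ h T → suc (h + spine T) ≡ h + suc (spine T)
    raise h T = sym (ℕₚ.+-suc h (spine T))

  -- Letter `b` lowers the height. Letter `a` raises it and takes the leading component off the
  -- tree, at the cost of three plus the weight of L. Letter `g` would require height 0.
  codes-suc-≅ : ∀ h → codes (suc h) ≅ λ n → codes h n ⊎ Branch (2 + h) n
  codes-suc-≅ h n = ↔-trans (Fiber-cong {t = [ size , branch-size ]′} (mk↔ₛ′ to from to-from from-to) sizes n)
    (↔-trans (Fiber-⊎ n) (↔-refl ⊎-↔ Fiber-branch n))
    where
    to : Code (suc h) → Code h ⊎ (Tree × Code (2 + h))
    to (leaf     , _ , e , b w)   = inj₁ (leaf , _ , ℕₚ.suc-injective e , w)
    to (node L R , _ , e , b w)   = inj₁ (node L R , _ , ℕₚ.suc-injective e , w)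
    to (node L R , _ , e , a w)   = inj₂ (L , R , _ , trans e (cong suc (sym (raise h R))) , w)
    to (T , _ , e , g e′ w)       = ⊥-elim (ℕₚ.m≢1+n+m (spine T) (trans e′ e))

    from : Code h ⊎ (Tree × Code (2 + h)) → Code (suc h)
    from (inj₁ (T , _ , e , w))     = T , _ , cong suc e , b w
    from (inj₂ (L , R , _ , e , w)) = node L R , _ , trans e (cong suc (raise h R)) , a w

    to-from : ∀ c → to (from c) ≡ c
    to-from (inj₁ (leaf , _ , e , w))     = cong inj₁ (code-≡ refl)
    to-from (inj₁ (node _ _ , _ , e , w)) = cong inj₁ (code-≡ refl)
    to-from (inj₂ (L , R , _ , e , w))    = cong (λ c → inj₂ (L , c)) (code-≡ refl)

    from-to : ∀ c → from (to c) ≡ c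
    from-to (leaf     , _ , e , b w)    = code-≡ refl
    from-to (node _ _ , _ , e , b w)    = code-≡ refl
    from-to (node L R , _ , e , a w)    = code-≡ refl
    from-to (T , _ , e , g e′ w)        = ⊥-elim (ℕₚ.m≢1+n+m (spine T) (trans e′ e))

    sizes : ∀ c → [ size , branch-size ]′ (to c) ≡ size c
    sizes (leaf     , _ , e , b w)    = refl
    sizes (node _ _ , _ , e , b w)    = refl
    sizes (node L R , _ , e , a w)    = cong (3 +_) (sym (ℕₚ.+-assoc (weight L) (weight R) (flats w)))
    sizes (T , _ , e , g e′ w)        = ⊥-elim (ℕₚ.m≢1+n+m (spine T) (trans e′ e))

  -- A first letter `b` would lead below height 0. Exchanging `a` and `b` in the rest makes it a
  -- walk at height 1, hence the second copy of the branch.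
  codes-0-≅ : codes 0 ≅ λ n → One n ⊎ (Shift (codes 0) n ⊎ (Branch 1 n ⊎ Branch 1 n))
  codes-0-≅ n = ↔-trans (Fiber-cong {t = t} (mk↔ₛ′ to from to-from from-to) sizes n)
    (↔-trans (Fiber-⊎ n) (Fiber-⊤ n ⊎-↔ ↔-trans (Fiber-⊎ n) (Fiber-suc n ⊎-↔
      ↔-trans (Fiber-⊎ n) (Fiber-branch n ⊎-↔ Fiber-branch n))))
    where
    X = ⊤ ⊎ (Code 0 ⊎ ((Tree × Code 1) ⊎ (Tree × Code 1)))
    t : X → ℕ
    t = [ (λ _ → 0) , [ suc ∘ size , [ branch-size , branch-size ]′ ]′ ]′

    to : Code 0 → X
    to (leaf , _ , e , end)       = inj₁ tt
    to (T , _ , e , g e′ w)       = inj₂ (inj₁ (T , _ , e , w))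
    to (node L R , _ , e , a w)   = inj₂ (inj₂ (inj₁ (L , R , _ , e , w)))
    to (node L R , _ , refl , b w) = inj₂ (inj₂ (inj₂ (L , R , _ , refl , reflect w)))

    from : X → Code 0
    from (inj₁ tt)                                 = leaf , _ , refl , end
    from (inj₂ (inj₁ (T , _ , e , w)))             = T , _ , e , g (sym e) w
    from (inj₂ (inj₂ (inj₁ (L , R , _ , e , w))))  = node L R , _ , e , a w
    from (inj₂ (inj₂ (inj₂ (L , R , _ , refl , w)))) = node L R , _ , refl , b (reflect w)

    to-from : ∀ x → to (from x) ≡ x
    to-from (inj₁ tt)                                   = refl
    to-from (inj₂ (inj₁ (leaf , _ , e , w)))            = refl
    to-from (inj₂ (inj₁ (node _ _ , _ , e , w)))        = refl
    to-from (inj₂ (inj₂ (inj₁ (L , R , _ , e , w))))    = refl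
    to-from (inj₂ (inj₂ (inj₂ (L , R , _ , refl , w)))) =
      cong (λ w → inj₂ (inj₂ (inj₂ (L , R , _ , refl , w)))) (reflect-involutive w)

    from-to : ∀ c → from (to c) ≡ c
    from-to (leaf , _ , refl , end)         = refl
    from-to (leaf , _ , e , g e′ w)         = code-≡ (cong (λ e → g e w) (ℕₚ.≡-irrelevant _ _))
    from-to (node L R , _ , e , g e′ w)     = code-≡ (cong (λ e → g e w) (ℕₚ.≡-irrelevant _ _))
    from-to (node L R , _ , e , a w)        = refl
    from-to (node L R , _ , refl , b w)     =
      cong (λ w → node L R , _ , refl , b w) (reflect-involutive w)

    sizes : ∀ c → t (to c) ≡ size c
    sizes (leaf , _ , e , end)            = refl
    sizes (leaf , _ , e , g e′ w)         = refl
    sizes (node L R , _ , e , g e′ w)     = sym (ℕₚ.+-suc (weight (node L R)) (flats w))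
    sizes (node L R , _ , e , a w)        = cong (3 +_) (sym (ℕₚ.+-assoc (weight L) (weight R) (flats w)))
    sizes (node L R , _ , refl , b w)     = cong (3 +_) (trans
      (cong (λ k → weight L + (weight R + k)) (flats-reflect w))
      (sym (ℕₚ.+-assoc (weight L) (weight R) (flats w))))

  private
    finite-Shift³ : ∀ {G} n → (∀ {k} → 3 + k ≡ n → Finite (G k)) → Finite (Shift (Shift (Shift G)) n)
    finite-Shift³ {G} n fin = finite-Shift {Shift (Shift G)} n λ { {k} refl →
      finite-Shift {Shift G} k λ { {k} refl → finite-Shift {G} k λ { refl → fin refl } } }

    below : ∀ {j k} → j ≤ k → j < 3 + k
    below {k = k} j≤k = ℕₚ.≤-trans (s≤s j≤k) (ℕₚ.m≤n+m (suc k) 2)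

  trees-finite : ∀ n → Finite (trees n)
  trees-finite = <-rec _ λ n rec → finite-↔ (trees-≅ n)
    (finite-⊎ (finite-One n) (finite-Shift³ n λ { {k} refl →
      finite-Convolution k (rec ∘ below) (rec ∘ below) }))

  -- Lexicographic induction: a letter `b` lowers the height at the same size, while a branch raises
  -- the height but lowers the size by at least 3.
  codes-finite : ∀ n h → Finite (codes h n)
  codes-finite = <-rec _ step
    where
    step : ∀ n → (∀ {k} → k < n → ∀ h → Finite (codes h k)) → ∀ h → Finite (codes h n)
    step n rec = by-height
      where
      branch : ∀ h → Finite (Branch h n)
      branch h = finite-Shift³ n λ { {k} refl →
        finite-Convolution k (λ {j} _ → trees-finite j) (λ j≤k → rec (below j≤k) h) }

      by-height : ∀ h → Finite (codes h n)
      by-height zero    = finite-↔ (codes-0-≅ n) (finite-⊎ (finite-One n)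
        (finite-⊎ (finite-Shift n λ { refl → rec ℕₚ.≤-refl 0 })
          (finite-⊎ (branch 1) (branch 1))))
      by-height (suc h) = finite-↔ (codes-suc-≅ h n) (finite-⊎ (by-height h) (branch (2 + h)))

  abstract
    -- The cardinalities stay opaque. They are known through their recurrences, which follow from
    -- the decompositions because a finite set has only one cardinality.
    treeCount : ℕ → ℕ
    treeCount n = proj₁ (trees-finite n)

    codeCount : ℕ → ℕ → ℕ
    codeCount h n = proj₁ (codes-finite n h)

  abstract
    trees-counted : trees countedBy treeCount
    trees-counted n = proj₂ (trees-finite n)

    codes-counted : ∀ h → codes h countedBy codeCount h
    codes-counted h n = proj₂ (codes-finite n h)

  private
    counts-agree : ∀ {G f h} → G countedBy f → G countedBy h → ∀ n → f n ≡ h n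
    counts-agree e e′ n = ↔⇒≡ (↔-trans (↔-sym (e n)) (e′ n))

  branchCount : ℕ → ℕ → ℕ
  branchCount h = shift (shift (shift (convolution treeCount (codeCount h))))

  private
    branch-counted : ∀ h → Branch h countedBy branchCount h
    branch-counted h = counted-Shift (counted-Shift (counted-Shift
      (counted-Convolution trees-counted (codes-counted h))))

  treeCount-eq : ∀ n → treeCount n ≡ one n + shift (shift (shift (convolution treeCount treeCount))) n
  treeCount-eq = counts-agree trees-counted λ n → ↔-trans (trees-≅ n)
    (counted-⊎ counted-One (counted-Shift (counted-Shift (counted-Shift
      (counted-Convolution trees-counted trees-counted)))) n)

  codeCount-0 : ∀ n → codeCount 0 n ≡ one n + (shift (codeCount 0) n + (branchCount 1 n + branchCount 1 n))
  codeCount-0 = counts-agree (codes-counted 0) λ n → ↔-trans (codes-0-≅ n)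
    (counted-⊎ counted-One (counted-⊎ (counted-Shift (codes-counted 0))
      (counted-⊎ (branch-counted 1) (branch-counted 1))) n)

  codeCount-suc : ∀ h n → codeCount (suc h) n ≡ codeCount h n + branchCount (2 + h) n
  codeCount-suc h = counts-agree (codes-counted (suc h)) λ n → ↔-trans (codes-suc-≅ h n)
    (counted-⊎ (codes-counted h) (branch-counted (2 + h)) n)


-- Generating functions of trees and codes

module GeneratingFunctions where

  open import Defs
  import Data.Integer.Base as ℤ
  import Data.Integer.Properties as ℤₚ
  open import Data.Nat.Base as ℕ using (ℕ; zero; suc)
  import Data.Nat.Properties as ℕₚ
  open import Data.Product.Base using (_×_; _,_)
  open import Data.Rational.Base as ℚ using (ℚ; 0ℚ; 1ℚ)
  import Data.Rational.Properties as ℚₚ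
  import Data.Rational.Unnormalised.Base as ℚᵘ
  import Data.Rational.Unnormalised.Properties as ℚᵘₚ
  open import Function.Base using (_∘_)
  open import Relation.Binary.PropositionalEquality using (_≡_; refl; sym; trans; cong; cong₂)
  open IntegerSolver
  open SeriesRing
  open DivisionAndSubstitution
  open Identities
  open RationalSeries
  open BivariateEvaluation
  open ClosedForms
  open GradedFamilies using (one; shift; convolution)
  open Codes using (treeCount; codeCount; branchCount; treeCount-eq; codeCount-0; codeCount-suc)

  open PowerSeriesRing ℚ-ring
  open RingIdentities ℚ⟦z⟧
  open RingSolver ℚ⟦z⟧ hiding (Polynomial)

  abstract
    fromℕ : ℕ → ℚ
    fromℕ n = ℤ.+ n ℚ./ 1

    fromℕ-/1 : ∀ n → fromℕ n ≡ ℤ.+ n ℚ./ 1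
    fromℕ-/1 n = refl

    fromℕ-0 : fromℕ 0 ≡ 0ℚ
    fromℕ-0 = refl

    fromℕ-1 : fromℕ 1 ≡ 1ℚ
    fromℕ-1 = refl

    private
      fromℕ-toℚᵘ : ∀ n → ℚ.toℚᵘ (fromℕ n) ℚᵘ.≃ (ℤ.+ n ℚᵘ./ 1)
      fromℕ-toℚᵘ n = ℚₚ.toℚᵘ-fromℚᵘ (ℤ.+ n ℚᵘ./ 1)

    fromℕ-+ : ∀ m n → fromℕ (m ℕ.+ n) ≡ fromℕ m ℚ.+ fromℕ n
    fromℕ-+ m n = ℚₚ.toℚᵘ-injective (begin
      ℚ.toℚᵘ (fromℕ (m ℕ.+ n))                      ≈⟨ fromℕ-toℚᵘ (m ℕ.+ n) ⟩
      ℤ.+ (m ℕ.+ n) ℚᵘ./ 1                          ≈⟨ ℚᵘ.*≡* (cong (ℤ._* ℤ.1ℤ) (cong₂ ℤ._+_ (sym (ℤₚ.*-identityʳ (ℤ.+ m))) (sym (ℤₚ.*-identityʳ (ℤ.+ n))))) ⟩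
      (ℤ.+ m ℚᵘ./ 1) ℚᵘ.+ (ℤ.+ n ℚᵘ./ 1)            ≈⟨ ℚᵘₚ.+-cong (fromℕ-toℚᵘ m) (fromℕ-toℚᵘ n) ⟨
      ℚ.toℚᵘ (fromℕ m) ℚᵘ.+ ℚ.toℚᵘ (fromℕ n)        ≈⟨ ℚₚ.toℚᵘ-homo-+ (fromℕ m) (fromℕ n) ⟨
      ℚ.toℚᵘ (fromℕ m ℚ.+ fromℕ n)                  ∎)
      where open ℚᵘₚ.≃-Reasoning

    fromℕ-* : ∀ m n → fromℕ (m ℕ.* n) ≡ fromℕ m ℚ.* fromℕ n
    fromℕ-* m n = ℚₚ.toℚᵘ-injective (begin
      ℚ.toℚᵘ (fromℕ (m ℕ.* n))                      ≈⟨ fromℕ-toℚᵘ (m ℕ.* n) ⟩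
      ℤ.+ (m ℕ.* n) ℚᵘ./ 1                          ≈⟨ ℚᵘ.*≡* (cong (ℤ._* ℤ.1ℤ) (ℤₚ.pos-* m n)) ⟩
      (ℤ.+ m ℚᵘ./ 1) ℚᵘ.* (ℤ.+ n ℚᵘ./ 1)            ≈⟨ ℚᵘₚ.*-cong (fromℕ-toℚᵘ m) (fromℕ-toℚᵘ n) ⟨
      ℚ.toℚᵘ (fromℕ m) ℚᵘ.* ℚ.toℚᵘ (fromℕ n)        ≈⟨ ℚₚ.toℚᵘ-homo-* (fromℕ m) (fromℕ n) ⟨
      ℚ.toℚᵘ (fromℕ m ℚ.* fromℕ n)                  ∎)
      where open ℚᵘₚ.≃-Reasoning

  generating : (ℕ → ℕ) → Series
  generating f n = fromℕ (f n)

  generating-+ : ∀ f g → generating (λ n → f n ℕ.+ g n) ≈ generating f + generating g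
  generating-+ f g n = fromℕ-+ (f n) (g n)

  generating-one : generating one ≈ # 1
  generating-one zero    = fromℕ-1
  generating-one (suc n) = fromℕ-0

  generating-shift : ∀ f → generating (shift f) ≈ z * generating f
  generating-shift f n = trans (shifted n) (sym (x-⊛ (generating f) n))
    where
    shifted : generating (shift f) ≈ 0ℚ ⊲ generating f
    shifted zero    = fromℕ-0
    shifted (suc n) = refl

  generating-convolution : ∀ f g → generating (convolution f g) ≈ generating f * generating g
  generating-convolution f g zero    =
    trans (fromℕ-* (f 0) (g 0)) (sym (ℚₚ.+-identityʳ _))
  generating-convolution f g (suc n) = trans (fromℕ-+ (f 0 ℕ.* g (suc n)) (convolution (f ∘ suc) g n))
    (cong₂ ℚ._+_ (fromℕ-* (f 0) (g (suc n))) (generating-convolution (f ∘ suc) g n))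

  generating-branch : ∀ f g → generating (shift (shift (shift (convolution f g)))) ≈
                      z ^ 3 * (generating f * generating g)
  generating-branch f g n =
    trans (generating-shift (shift (shift h)) n) (trans
      (S.*-congˡ {z} (λ k → trans (generating-shift (shift h) k) (S.*-congˡ {z} (λ j → trans
        (generating-shift h j) (S.*-congˡ {z} (generating-convolution f g) j)) k)) n)
      (trans (solve 2 (λ z p → z :* (z :* (z :* p)) := z :* (z :* z) :* p)
                S.refl z (generating f * generating g) n)
        (S.*-congʳ {generating f * generating g} {z * (z * z)} {z ^ 3}
          (S.*-congˡ {z} {z * z} {z * (z * 1#)} (S.*-congˡ {z} {z} {z * 1#} λ k → sym (S.*-identityʳ z k))) n)))
    where h = convolution f g

  -- Both are fixed points of f ↦ 1 + z³ f², which is contracting.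
  treeSeries : generating treeCount ≈ c[z³]
  treeSeries n = trans (Fixpoint.unique contracting {generating treeCount} eq n)
    (sym (Fixpoint.unique contracting {c[z³]} (Composition.compose-quadratic (z ^ 3) refl c refl tail-c) n))
    where
    Φ : Series → Series
    Φ f = # 1 + z ^ 3 * (f * f)
    contracting : Contracting Φ
    contracting {n} {f} {g} p {k} k<n = cong ((# 1) k ℚ.+_)
      (⊛-gain {z ^ 3} {f * f} {g * g} refl (⊛-cong-below {f} {g} {f} {g} p p) k<n)
    eq : generating treeCount ≈ Φ (generating treeCount)
    eq n = trans (cong fromℕ (treeCount-eq n))
      (trans (generating-+ one (shift (shift (shift (convolution treeCount treeCount)))) n) (cong₂ ℚ._+_ (generating-one n) (generating-branch treeCount treeCount n)))

  private
    w D : Series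
    w = z ^ 3 * c[z³]
    D = compose c w refl

    E : ℕ → Series
    E h = generating (codeCount h)

    branch : ∀ h → generating (branchCount h) ≈ w * E h
    branch h n = trans (generating-branch treeCount (codeCount h) n) (trans
      (S.*-congˡ {z ^ 3} (S.*-congʳ {E h} {generating treeCount} {c[z³]} treeSeries) n)
      (sym (S.*-assoc (z ^ 3) c[z³] (E h) n)))

    E-0 : E 0 ≈ # 1 + (z * E 0 + (w * E 1 + w * E 1))
    E-0 n = trans (cong fromℕ (codeCount-0 n)) (trans (generating-+ one (λ n → shift (codeCount 0) n ℕ.+ (branchCount 1 n ℕ.+ branchCount 1 n)) n)
      (cong₂ ℚ._+_ (generating-one n) (trans (generating-+ (shift (codeCount 0)) (λ n → branchCount 1 n ℕ.+ branchCount 1 n) n)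
        (cong₂ ℚ._+_ (generating-shift (codeCount 0) n) (trans (generating-+ (branchCount 1) (branchCount 1) n)
          (cong₂ ℚ._+_ (branch 1 n) (branch 1 n)))))))

    E-suc : ∀ h → E (suc h) ≈ E h + w * E (2 ℕ.+ h)
    E-suc h n = trans (cong fromℕ (codeCount-suc h n)) (trans (generating-+ (codeCount h) (branchCount (2 ℕ.+ h)) n)
      (cong (E h n ℚ.+_) (branch (2 ℕ.+ h) n)))

    D-eq : D ≈ # 1 + w * (D * D)
    D-eq = Composition.compose-quadratic w refl c refl tail-c

    power : ℕ → Series
    power zero    = E 0
    power (suc h) = D * power h

    -- The equation of D multiplied by Dʰ E₀: the powers of D solve the recursion `E-suc`.
    power-suc : ∀ h → power (suc h) ≈ power h + w * power (2 ℕ.+ h)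
    power-suc h = modulo (power h) D-eq
      (solve 3 (λ D w P → D :* P := (P :+ w :* (D :* (D :* P))) :+ P :* (D :- (:# 1 :+ w :* (D :* D))))
         S.refl D w (power h))

    -- `E-suc` expresses height h + 1 through the greater height h + 2, but there the factor w gains
    -- an exponent. Hence induction on the precision n first and on h second.
    E-below : ∀ n h → E h ≋[ n ] power h
    E-below zero    h       ()
    E-below (suc n) zero    _ = refl
    E-below (suc n) (suc h) {k} k<n = trans (E-suc h k) (trans
      (cong₂ ℚ._+_ (E-below (suc n) h k<n)
        (⊛-gain {w} {E (2 ℕ.+ h)} {power (2 ℕ.+ h)} refl (E-below n (2 ℕ.+ h)) k<n))
      (sym (power-suc h k)))

    codeSeries-eq : E 0 ≈ # 1 + z * E 0 + (w * (D * E 0) + w * (D * E 0))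
    codeSeries-eq n = trans (E-0 n) (trans (sym (S.+-assoc (# 1) (z * E 0) (w * E 1 + w * E 1) n))
      (cong ((# 1 + z * E 0) n ℚ.+_) (cong₂ ℚ._+_ (wE₁ n) (wE₁ n))))
      where
      wE₁ : w * E 1 ≈ w * (D * E 0)
      wE₁ = S.*-congˡ {w} {E 1} {D * E 0} (λ k → E-below (suc k) 1 (ℕₚ.n<1+n k))

  codeSeries-equations : Equations c[z³] (generating (codeCount 0))
  codeSeries-equations = record
    { w    = w
    ; D    = D
    ; C-eq = Composition.compose-quadratic (z ^ 3) refl c refl tail-c
    ; w-eq = λ n → refl
    ; D-eq = D-eq
    ; A-eq = codeSeries-eq
    }

  generating-forms : ∀ {A f} → Equations c[z³] (generating f) → (∀ n → A n ≡ fromℕ (f n)) →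
    (A ≈ (# 1 / (# 1 - z)) * F ⟨ # 2 / (# 1 - z) , c[z³] - # 1 ⟩[ refl ])
    × (A ≈ c[z³] / (√ (c[z³] * (# 4 - # 3 * c[z³])) refl - z * c[z³]))
  generating-forms {A} {f} e p = (λ n → trans (p n) (motzkin-form e n)) , (λ n → trans (p n) (closed-form e n))


-- 132-avoiding sequences and decreasing binary trees

module TreeShapes where

  open import Data.Empty using (⊥-elim)
  open import Data.Fin.Base as Fin using (Fin; zero; suc; toℕ; fromℕ; inject₁; _↑ˡ_; _↑ʳ_; splitAt; cast; punchIn)
  open import Data.Fin.Permutation as Perm using (Permutation′; _⟨$⟩ʳ_; insert; insert-punchIn; cast-id)
  import Data.Fin.Properties as Finₚ
  open import Data.Fin.Relation.Unary.Top using (view; ‵fromℕ; ‵inj₁)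
  open import Data.Nat.Base as ℕ using (ℕ; zero; suc; _+_; _≤_; _<_; s≤s)
  open import Data.Nat.Induction using (<-rec)
  import Data.Nat.Properties as ℕₚ
  open import Data.Product.Base using (∃; _×_; _,_; proj₂)
  open import Data.Sum.Algebra using (⊎-comm)
  open import Data.Sum.Base using (inj₁; inj₂)
  open import Data.Sum.Function.Propositional using (_⊎-↔_)
  open import Data.Unit.Base using (⊤; tt)
  open import Function.Base using (_∘_)
  open import Function.Properties.Inverse using (↔-sym; ↔-trans; ↔-refl)
  open import Relation.Binary.PropositionalEquality using (_≡_; _≢_; refl; sym; trans; cong; cong₂; subst; subst₂)
  open import Relation.Nullary using (¬_)
  open import Relation.Nullary.Decidable using (dec-yes; yes; no)
  open Codes using (Tree; leaf; node; ∣_∣)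

  private variable k l r : ℕ

  -- Values lie in ℕ so that a restriction to an interval of positions need not be renumbered.
  No132 : (Fin k → ℕ) → Set
  No132 f = ∀ {x y z} → x Fin.< y → y Fin.< z → f x < f z → ¬ f z < f y

  leftᵢ : ∀ l r → Fin l → Fin (suc (l + r))
  leftᵢ l r i = inject₁ i ↑ˡ r

  rootᵢ : ∀ l r → Fin (suc (l + r))
  rootᵢ l r = fromℕ l ↑ˡ r

  rightᵢ : ∀ l r → Fin r → Fin (suc (l + r))
  rightᵢ l r j = suc l ↑ʳ j

  data Position (l r : ℕ) : Fin (suc (l + r)) → Set where
    isLeft  : ∀ i → Position l r (leftᵢ l r i)
    isRoot  : Position l r (rootᵢ l r)
    isRight : ∀ j → Position l r (rightᵢ l r j)

  position : ∀ l r x → Position l r x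
  position l r x with splitAt (suc l) x in eq
  ... | inj₂ j = subst (Position l r) (Finₚ.splitAt⁻¹-↑ʳ {suc l} eq) (isRight j)
  ... | inj₁ i = subst (Position l r) (Finₚ.splitAt⁻¹-↑ˡ {suc l} eq) (fromTop i)
    where
    fromTop : ∀ i → Position l r (i ↑ˡ r)
    fromTop i with view i
    ... | ‵fromℕ       = isRoot
    ... | ‵inj₁ {i = j} _ = isLeft j

  toℕ-left : ∀ l r i → toℕ (leftᵢ l r i) ≡ toℕ i
  toℕ-left l r i = trans (Finₚ.toℕ-↑ˡ (inject₁ i) r) (Finₚ.toℕ-inject₁ i)

  toℕ-root : ∀ l r → toℕ (rootᵢ l r) ≡ l
  toℕ-root l r = trans (Finₚ.toℕ-↑ˡ (fromℕ l) r) (Finₚ.toℕ-fromℕ l)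

  toℕ-right : ∀ l r j → toℕ (rightᵢ l r j) ≡ suc l + toℕ j
  toℕ-right l r j = Finₚ.toℕ-↑ʳ (suc l) j

  left<left : ∀ {i j} → leftᵢ l r i Fin.< leftᵢ l r j → i Fin.< j
  left<left {l} {r} {i} {j} = subst₂ _<_ (toℕ-left l r i) (toℕ-left l r j)

  left<left⁺ : ∀ {i j} → i Fin.< j → leftᵢ l r i Fin.< leftᵢ l r j
  left<left⁺ {l} {r} {i} {j} = subst₂ _<_ (sym (toℕ-left l r i)) (sym (toℕ-left l r j))

  right<right : ∀ {i j} → rightᵢ l r i Fin.< rightᵢ l r j → i Fin.< j
  right<right {l} {r} {i} {j} p =
    ℕₚ.+-cancelˡ-< (suc l) _ _ (subst₂ _<_ (toℕ-right l r i) (toℕ-right l r j) p)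

  right<right⁺ : ∀ {i j} → i Fin.< j → rightᵢ l r i Fin.< rightᵢ l r j
  right<right⁺ {l} {r} {i} {j} p =
    subst₂ _<_ (sym (toℕ-right l r i)) (sym (toℕ-right l r j)) (ℕₚ.+-monoʳ-< (suc l) p)

  left<root : ∀ i → leftᵢ l r i Fin.< rootᵢ l r
  left<root {l} {r} i = subst₂ _<_ (sym (toℕ-left l r i)) (sym (toℕ-root l r)) (Finₚ.toℕ<n i)

  root<right : ∀ j → rootᵢ l r Fin.< rightᵢ l r j
  root<right {l} {r} j = subst₂ _<_ (sym (toℕ-root l r)) (sym (toℕ-right l r j)) (ℕₚ.m≤m+n (suc l) (toℕ j))

  left<right : ∀ i j → leftᵢ l r i Fin.< rightᵢ l r j
  left<right {l} {r} i j = ℕₚ.<-trans (left<root {l} {r} i) (root<right {l} {r} j)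

  -- T is the decreasing binary tree of f, with its root at the maximum; avoiding 132 means that at
  -- every node the entries before the maximum exceed those after it.
  Shape : (T : Tree) → (Fin ∣ T ∣ → ℕ) → Set
  Shape leaf       f = ⊤
  Shape (node L R) f =
      Shape L (f ∘ leftᵢ ∣ L ∣ ∣ R ∣)
    × Shape R (f ∘ rightᵢ ∣ L ∣ ∣ R ∣)
    × (∀ i → f (leftᵢ ∣ L ∣ ∣ R ∣ i) < f (rootᵢ ∣ L ∣ ∣ R ∣))
    × (∀ i j → f (rightᵢ ∣ L ∣ ∣ R ∣ j) < f (leftᵢ ∣ L ∣ ∣ R ∣ i))
    × (∀ j → f (rightᵢ ∣ L ∣ ∣ R ∣ j) < f (rootᵢ ∣ L ∣ ∣ R ∣))

  -- A 132 lies within one block: an ascent cannot end in the right block unless it starts there,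
  -- nothing exceeds the root, and if the last position is in the left block then so are the others.
  shape-no132 : ∀ T {f} → Shape T f → No132 f
  shape-no132 (node L R) {f} (sL , sR , L< , R<L , R<) {x} {y} {z} = go (position _ _ x) (position _ _ y) (position _ _ z)
    where
    l′ = ∣ L ∣
    r′ = ∣ R ∣
    go : ∀ {x y z} → Position l′ r′ x → Position l′ r′ y → Position l′ r′ z →
         x Fin.< y → y Fin.< z → f x < f z → ¬ f z < f y
    go (isLeft i)  q           (isRight k) x<y y<z p q′ = ℕₚ.<-asym p (R<L i k)
    go isRoot      q           (isRight k) x<y y<z p q′ = ℕₚ.<-asym p (R< k)
    go (isRight i) (isRight j) (isRight k) x<y y<z p q′ =
      shape-no132 R sR (right<right {l′} {r′} x<y) (right<right {l′} {r′} y<z) p q′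
    go (isRight i) (isLeft j)  (isRight k) x<y y<z p q′ = ℕₚ.<-asym x<y (left<right {l′} {r′} j i)
    go (isRight i) isRoot      (isRight k) x<y y<z p q′ = ℕₚ.<-asym x<y (root<right {l′} {r′} i)
    go x (isLeft j)  isRoot x<y y<z p q′ = ℕₚ.<-asym q′ (L< j)
    go x isRoot      isRoot x<y y<z p q′ = ℕₚ.<-irrefl refl q′
    go x (isRight j) isRoot x<y y<z p q′ = ℕₚ.<-asym q′ (R< j)
    go x isRoot      (isLeft k) x<y y<z p q′ = ℕₚ.<-asym y<z (left<root {l′} {r′} k)
    go x (isRight j) (isLeft k) x<y y<z p q′ = ℕₚ.<-asym y<z (left<right {l′} {r′} k j)
    go (isLeft i)  (isLeft j) (isLeft k) x<y y<z p q′ =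
      shape-no132 L sL (left<left {l′} {r′} x<y) (left<left {l′} {r′} y<z) p q′
    go isRoot      (isLeft j) (isLeft k) x<y y<z p q′ = ℕₚ.<-asym x<y (left<root {l′} {r′} j)
    go (isRight i) (isLeft j) (isLeft k) x<y y<z p q′ = ℕₚ.<-asym x<y (left<right {l′} {r′} j i)

  shape-order : ∀ T {f g} → Shape T f → Shape T g → ∀ {x y} → f x < f y → g x < g y
  shape-order (node L R) {f} {g} (sL , sR , L< , R<L , R<) (tL , tR , L<′ , R<L′ , R<′) {x} {y} =
    go (position _ _ x) (position _ _ y)
    where
    go : ∀ {x y} → Position ∣ L ∣ ∣ R ∣ x → Position ∣ L ∣ ∣ R ∣ y → f x < f y → g x < g y
    go (isLeft i)  (isLeft j)  p = shape-order L sL tL p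
    go (isLeft i)  isRoot      p = L<′ i
    go (isLeft i)  (isRight j) p = ⊥-elim (ℕₚ.<-asym p (R<L i j))
    go isRoot      (isLeft j)  p = ⊥-elim (ℕₚ.<-asym p (L< j))
    go isRoot      isRoot      p = ⊥-elim (ℕₚ.<-irrefl refl p)
    go isRoot      (isRight j) p = ⊥-elim (ℕₚ.<-asym p (R< j))
    go (isRight i) (isLeft j)  p = R<L′ j i
    go (isRight i) isRoot      p = R<′ i
    go (isRight i) (isRight j) p = shape-order R sR tR p

  -- An inductive family, so that matching replaces k by the size of the tree.
  data HasShape : (k : ℕ) → (Fin k → ℕ) → Set where
    has : ∀ T {f} → Shape T f → HasShape ∣ T ∣ f

  private
    maximum : ∀ k (f : Fin (suc k) → ℕ) → ∃ λ m → ∀ i → f i ≤ f m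
    maximum zero    f = zero , λ { zero → ℕₚ.≤-refl }
    maximum (suc k) f with maximum k (f ∘ suc)
    ... | m , max with ℕₚ.≤-total (f zero) (f (suc m))
    ...   | inj₁ p = suc m , λ { zero → p ; (suc i) → max i }
    ...   | inj₂ p = zero , λ { zero → ℕₚ.≤-refl ; (suc i) → ℕₚ.≤-trans (max i) p }

    data Split : (k : ℕ) → Fin (suc k) → Set where
      split : ∀ l r → Split (l + r) (rootᵢ l r)

    splitAtRoot : ∀ k m → Split k m
    splitAtRoot k       zero    = split 0 k
    splitAtRoot (suc k) (suc m) with splitAtRoot k m
    ... | split l r = split (suc l) r

  Distinct : (Fin k → ℕ) → Set
  Distinct f = ∀ {x y} → x Fin.< y → f x ≢ f y

  -- Split at the position of the maximum and recurse on both sides.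
  no132-shape : ∀ k (f : Fin k → ℕ) → Distinct f → No132 f → HasShape k f
  no132-shape = <-rec _ step
    where
    step : ∀ k → (∀ {j} → j < k → ∀ f → Distinct f → No132 f → HasShape j f) →
           ∀ f → Distinct f → No132 f → HasShape k f
    step zero    rec f d n = has leaf tt
    step (suc k) rec f d n with maximum k f
    ... | m , max with splitAtRoot k m
    ... | split l r
      with rec (s≤s (ℕₚ.m≤m+n l r)) (f ∘ leftᵢ l r) (d ∘ left<left⁺ {l} {r})
             (λ p q → n (left<left⁺ {l} {r} p) (left<left⁺ {l} {r} q))
         | rec (s≤s (ℕₚ.m≤n+m r l)) (f ∘ rightᵢ l r) (d ∘ right<right⁺ {l} {r})
             (λ p q → n (right<right⁺ {l} {r} p) (right<right⁺ {l} {r} q))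
    ... | has L sL | has R sR = has (node L R) (sL , sR , L< , R<L , R<)
      where
      L< : ∀ i → f (leftᵢ ∣ L ∣ ∣ R ∣ i) < f (rootᵢ ∣ L ∣ ∣ R ∣)
      L< i = ℕₚ.≤∧≢⇒< (max _) (d (left<root {∣ L ∣} {∣ R ∣} i))
      R< : ∀ j → f (rightᵢ ∣ L ∣ ∣ R ∣ j) < f (rootᵢ ∣ L ∣ ∣ R ∣)
      R< j = ℕₚ.≤∧≢⇒< (max _) (d (root<right {∣ L ∣} {∣ R ∣} j) ∘ sym)
      R<L : ∀ i j → f (rightᵢ ∣ L ∣ ∣ R ∣ j) < f (leftᵢ ∣ L ∣ ∣ R ∣ i)
      -- Otherwise the left entry, the maximum and the right entry would form a 132.
      R<L i j = ℕₚ.≤∧≢⇒<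
        (ℕₚ.≮⇒≥ λ p → n (left<root {∣ L ∣} {∣ R ∣} i) (root<right {∣ L ∣} {∣ R ∣} j) p (R< j))
        (d (left<right {∣ L ∣} {∣ R ∣} i j) ∘ sym)

  private
    root-max : ∀ L R {f} → Shape (node L R) f → ∀ {x} → toℕ x ≢ ∣ L ∣ → f x < f (rootᵢ ∣ L ∣ ∣ R ∣)
    root-max L R (_ , _ , L< , _ , R<) {x} x≢ with position ∣ L ∣ ∣ R ∣ x
    ... | isLeft i  = L< i
    ... | isRoot    = ⊥-elim (x≢ (toℕ-root ∣ L ∣ ∣ R ∣))
    ... | isRight j = R< j

  -- The size of the left subtree is the position of the maximum. Were the positions different, each
  -- maximum would be smaller than the other.
  shape-unique : ∀ T U {f g} → Shape T f → Shape U g → ∣ T ∣ ≡ ∣ U ∣ →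
                 (∀ i j → toℕ i ≡ toℕ j → f i ≡ g j) → T ≡ U
  shape-unique leaf       leaf       s t e h = refl
  shape-unique (node L R) (node L′ R′) {f} {g} s@(sL , sR , _) t@(tL , tR , _) e h =
    cong₂ node
      (shape-unique L L′ sL tL l≡ λ i j p → h _ _
        (trans (toℕ-left ∣ L ∣ ∣ R ∣ i) (trans p (sym (toℕ-left ∣ L′ ∣ ∣ R′ ∣ j)))))
      (shape-unique R R′ sR tR r≡ λ i j p → h _ _
        (trans (toℕ-right ∣ L ∣ ∣ R ∣ i) (trans (cong₂ (λ a b → suc (a + b)) l≡ p) (sym (toℕ-right ∣ L′ ∣ ∣ R′ ∣ j)))))
    where
    root root′ : _
    root  = rootᵢ ∣ L ∣ ∣ R ∣
    root′ = rootᵢ ∣ L′ ∣ ∣ R′ ∣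
    l≡ : ∣ L ∣ ≡ ∣ L′ ∣
    l≡ with ∣ L ∣ ℕₚ.≟ ∣ L′ ∣
    ... | yes p = p
    ... | no  p = ⊥-elim (ℕₚ.<-asym f-root<g-root′ g-root′<f-root)
      where
      f-root<g-root′ : f root < g root′
      f-root<g-root′ = subst (_< g root′)
        (sym (h root (cast e root) (sym (Finₚ.toℕ-cast e root))))
        (root-max L′ R′ {g} t λ q → p (trans (sym (toℕ-root ∣ L ∣ ∣ R ∣)) (trans (sym (Finₚ.toℕ-cast e root)) q)))
      g-root′<f-root : g root′ < f root
      g-root′<f-root = subst (_< f root)
        (h (cast (sym e) root′) root′ (Finₚ.toℕ-cast (sym e) root′))
        (root-max L R {f} s λ q → p (sym (trans (sym (toℕ-root ∣ L′ ∣ ∣ R′ ∣)) (trans (sym (Finₚ.toℕ-cast (sym e) root′)) q))))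
    r≡ : ∣ R ∣ ≡ ∣ R′ ∣
    r≡ = ℕₚ.+-cancelˡ-≡ ∣ L ∣ _ _ (trans (ℕₚ.suc-injective e) (cong (_+ ∣ R′ ∣) (sym l≡)))

  private
    punchIn-fromℕ : ∀ l (i : Fin l) → punchIn (fromℕ l) i ≡ inject₁ i
    punchIn-fromℕ (suc l) zero    = refl
    punchIn-fromℕ (suc l) (suc i) = cong suc (punchIn-fromℕ l i)

    insert-self : ∀ {m n} (i : Fin (suc m)) (j : Fin (suc n)) π → insert i j π ⟨$⟩ʳ i ≡ j
    insert-self i j π rewrite proj₂ (dec-yes (i Finₚ.≟ i) refl) = refl

    withTop : Permutation′ l → Permutation′ (suc l)
    withTop {l} π = insert (fromℕ l) (fromℕ l) π

    withTop-inject₁ : ∀ (π : Permutation′ l) i → withTop π ⟨$⟩ʳ inject₁ i ≡ inject₁ (π ⟨$⟩ʳ i)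
    withTop-inject₁ {l} π i = trans (cong (withTop π ⟨$⟩ʳ_) (sym (punchIn-fromℕ l i)))
      (trans (insert-punchIn (fromℕ l) (fromℕ l) π i) (punchIn-fromℕ l (π ⟨$⟩ʳ i)))

  -- (L ⊕ 1) ⊖ R: `withTop` forms L ⊕ 1, and `⊎-comm` exchanges the blocks on the side of the
  -- values, putting those of R at the bottom.
  treePermutation : ∀ T → Permutation′ ∣ T ∣
  treePermutation leaf       = ↔-refl
  treePermutation (node L R) =
    ↔-trans (Finₚ.+↔⊎ {suc ∣ L ∣}) (↔-trans (withTop (treePermutation L) ⊎-↔ treePermutation R)
      (↔-trans (⊎-comm _ _) (↔-trans (↔-sym (Finₚ.+↔⊎ {∣ R ∣})) (cast-id (ℕₚ.+-comm ∣ R ∣ (suc ∣ L ∣))))))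

  values : ∀ T → Fin ∣ T ∣ → ℕ
  values T i = toℕ (treePermutation T ⟨$⟩ʳ i)

  private
    module _ (L R : Tree) where
      l′ = ∣ L ∣
      r′ = ∣ R ∣

      value-comp : ∀ k → values (node L R) (k ↑ˡ r′) ≡ r′ + toℕ (withTop (treePermutation L) ⟨$⟩ʳ k)
      value-comp k rewrite Finₚ.splitAt-↑ˡ (suc l′) k r′ =
        trans (Finₚ.toℕ-cast (ℕₚ.+-comm r′ (suc l′)) (r′ ↑ʳ (withTop (treePermutation L) ⟨$⟩ʳ k)))
              (Finₚ.toℕ-↑ʳ r′ (withTop (treePermutation L) ⟨$⟩ʳ k))

      value-left : ∀ i → values (node L R) (leftᵢ l′ r′ i) ≡ r′ + values L i
      value-left i = trans (value-comp (inject₁ i)) (cong (r′ +_)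
        (trans (cong toℕ (withTop-inject₁ (treePermutation L) i)) (Finₚ.toℕ-inject₁ _)))

      value-root : values (node L R) (rootᵢ l′ r′) ≡ r′ + l′
      value-root = trans (value-comp (fromℕ l′)) (cong (r′ +_)
        (trans (cong toℕ (insert-self (fromℕ l′) (fromℕ l′) (treePermutation L))) (Finₚ.toℕ-fromℕ l′)))

      value-right : ∀ j → values (node L R) (rightᵢ l′ r′ j) ≡ values R j
      value-right j rewrite Finₚ.splitAt-↑ʳ l′ r′ j =
        trans (Finₚ.toℕ-cast (ℕₚ.+-comm r′ (suc l′)) ((treePermutation R ⟨$⟩ʳ j) ↑ˡ suc l′))
              (Finₚ.toℕ-↑ˡ (treePermutation R ⟨$⟩ʳ j) (suc l′))

  shape-resp : ∀ T {f g} → (∀ {x y} → f x < f y → g x < g y) → Shape T f → Shape T g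
  shape-resp leaf       m s = tt
  shape-resp (node L R) m (sL , sR , L< , R<L , R<) =
    shape-resp L m sL , shape-resp R m sR , (λ i → m (L< i)) , (λ i j → m (R<L i j)) , (λ j → m (R< j))

  treePermutation-shape : ∀ T → Shape T (values T)
  treePermutation-shape leaf       = tt
  treePermutation-shape (node L R) =
      shape-resp L (λ {x} {y} p → subst₂ _<_ (sym (value-left L R x)) (sym (value-left L R y)) (ℕₚ.+-monoʳ-< ∣ R ∣ p))
        (treePermutation-shape L)
    , shape-resp R (λ {x} {y} → subst₂ _<_ (sym (value-right L R x)) (sym (value-right L R y)))
        (treePermutation-shape R)
    , (λ i → subst₂ _<_ (sym (value-left L R i)) (sym (value-root L R)) (ℕₚ.+-monoʳ-< ∣ R ∣ (Finₚ.toℕ<n _)))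
    , (λ i j → subst₂ _<_ (sym (value-right L R j)) (sym (value-left L R i)) (ℕₚ.<-≤-trans (Finₚ.toℕ<n _) (ℕₚ.m≤m+n ∣ R ∣ _)))
    , (λ j → subst₂ _<_ (sym (value-right L R j)) (sym (value-root L R)) (ℕₚ.<-≤-trans (Finₚ.toℕ<n _) (ℕₚ.m≤m+n ∣ R ∣ _)))


-- Words in a, b, g and the permutations they encode

module Words where

  open import Data.Empty using (⊥; ⊥-elim)
  open import Data.Fin.Base as Fin using (Fin; zero; suc; toℕ; _↑ˡ_; _↑ʳ_; splitAt)
  open import Data.Fin.Permutation as Perm using (Permutation′; permutation; _⟨$⟩ʳ_; _⟨$⟩ˡ_)
  import Data.Fin.Properties as Finₚ
  open import Data.Nat.Base as ℕ using (ℕ; zero; suc; _+_; _≤_; _<_; s≤s; s<s; z<s)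
  import Data.Nat.Properties as ℕₚ
  open import Data.Product.Base using (∃; _,_)
  open import Data.Sum.Base using (_⊎_; inj₁; inj₂; [_,_]′)
  open import Data.Unit.Base using (⊤; tt)
  open import Function.Base using (_∘_)
  open import Relation.Binary.Definitions using (tri<; tri≈; tri>)
  open import Relation.Binary.PropositionalEquality using (_≡_; _≢_; refl; sym; trans; cong; subst; subst₂)
  open import Relation.Nullary using (¬_)
  open TreeShapes using (No132)

  private variable k m n N : ℕ

  -- Shuffle k m N: words of length N with k letters a and m letters b, the others
  -- being g.
  infixr 5 a∷_ b∷_ g∷_
  data Shuffle : ℕ → ℕ → ℕ → Set where
    []  : Shuffle 0 0 0
    a∷_ : Shuffle k m N → Shuffle (suc k) m (suc N)
    b∷_ : Shuffle k m N → Shuffle k (suc m) (suc N)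
    g∷_ : Shuffle k m N → Shuffle k m (suc N)

  posA : Shuffle k m N → Fin k → Fin N
  posA (a∷ w) zero    = zero
  posA (a∷ w) (suc i) = suc (posA w i)
  posA (b∷ w) i       = suc (posA w i)
  posA (g∷ w) i       = suc (posA w i)

  posB : Shuffle k m N → Fin m → Fin N
  posB (b∷ w) zero    = zero
  posB (b∷ w) (suc i) = suc (posB w i)
  posB (a∷ w) i       = suc (posB w i)
  posB (g∷ w) i       = suc (posB w i)

  IsG : Shuffle k m N → Fin N → Set
  IsG (a∷ w) zero    = ⊥
  IsG (b∷ w) zero    = ⊥
  IsG (g∷ w) zero    = ⊤
  IsG (a∷ w) (suc p) = IsG w p
  IsG (b∷ w) (suc p) = IsG w p
  IsG (g∷ w) (suc p) = IsG w p

  data Kind (w : Shuffle k m N) : Fin N → Set where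
    isA : ∀ i → Kind w (posA w i)
    isB : ∀ i → Kind w (posB w i)
    isG : ∀ p → IsG w p → Kind w p

  kind : (w : Shuffle k m N) → ∀ p → Kind w p
  kind (a∷ w) zero    = isA zero
  kind (b∷ w) zero    = isB zero
  kind (g∷ w) zero    = isG zero tt
  kind (a∷ w) (suc p) with kind w p
  ... | isA i   = isA (suc i)
  ... | isB i   = isB i
  ... | isG p h = isG (suc p) h
  kind (b∷ w) (suc p) with kind w p
  ... | isA i   = isA i
  ... | isB i   = isB (suc i)
  ... | isG p h = isG (suc p) h
  kind (g∷ w) (suc p) with kind w p
  ... | isA i   = isA i
  ... | isB i   = isB i
  ... | isG p h = isG (suc p) h

  letter : Shuffle k m N → Fin N → Fin k ⊎ (Fin m ⊎ ⊤)
  letter w p with kind w p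
  ... | isA i   = inj₁ i
  ... | isB i   = inj₂ (inj₁ i)
  ... | isG _ _ = inj₂ (inj₂ tt)

  posA-mono : (w : Shuffle k m N) → ∀ {i j} → i Fin.< j → posA w i Fin.< posA w j
  posA-mono (a∷ w) {zero}  {suc j} p         = z<s
  posA-mono (a∷ w) {suc i} {suc j} (s<s p)   = s<s (posA-mono w p)
  posA-mono (b∷ w) p = s<s (posA-mono w p)
  posA-mono (g∷ w) p = s<s (posA-mono w p)

  posB-mono : (w : Shuffle k m N) → ∀ {i j} → i Fin.< j → posB w i Fin.< posB w j
  posB-mono (b∷ w) {zero}  {suc j} p         = z<s
  posB-mono (b∷ w) {suc i} {suc j} (s<s p)   = s<s (posB-mono w p)
  posB-mono (a∷ w) p = s<s (posB-mono w p)
  posB-mono (g∷ w) p = s<s (posB-mono w p)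

  module _ {f : Fin k → Fin N} (mono : ∀ {i j} → i Fin.< j → f i Fin.< f j) where

    mono-reflects : ∀ {i j} → f i Fin.< f j → i Fin.< j
    mono-reflects {i} {j} p with Finₚ.<-cmp i j
    ... | tri< q _ _    = q
    ... | tri≈ _ refl _ = ⊥-elim (Finₚ.<-irrefl refl p)
    ... | tri> _ _ q    = ⊥-elim (ℕₚ.<-asym p (mono q))

    mono-injective : ∀ {i j} → f i ≡ f j → i ≡ j
    mono-injective {i} {j} p with Finₚ.<-cmp i j
    ... | tri< q _ _ = ⊥-elim (Finₚ.<⇒≢ (mono q) p)
    ... | tri≈ _ q _ = q
    ... | tri> _ _ q = ⊥-elim (Finₚ.<⇒≢ (mono q) (sym p))

  posA≢posB : (w : Shuffle k m N) → ∀ i j → posA w i ≢ posB w j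
  posA≢posB (a∷ w) zero    j       ()
  posA≢posB (a∷ w) (suc i) j       e = posA≢posB w i j (Finₚ.suc-injective e)
  posA≢posB (b∷ w) i       zero    ()
  posA≢posB (b∷ w) i       (suc j) e = posA≢posB w i j (Finₚ.suc-injective e)
  posA≢posB (g∷ w) i       j       e = posA≢posB w i j (Finₚ.suc-injective e)

  posA≢G : (w : Shuffle k m N) → ∀ i → ¬ IsG w (posA w i)
  posA≢G (a∷ w) (suc i) h = posA≢G w i h
  posA≢G (b∷ w) i       h = posA≢G w i h
  posA≢G (g∷ w) i       h = posA≢G w i h

  posB≢G : (w : Shuffle k m N) → ∀ i → ¬ IsG w (posB w i)
  posB≢G (b∷ w) (suc i) h = posB≢G w i h
  posB≢G (a∷ w) i       h = posB≢G w i h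
  posB≢G (g∷ w) i       h = posB≢G w i h

  letter-A : (w : Shuffle k m N) → ∀ i → letter w (posA w i) ≡ inj₁ i
  letter-A w i = go (kind w (posA w i)) refl
    where
    go : ∀ {p} (K : Kind w p) → posA w i ≡ p → letter w p ≡ inj₁ i
    go {p} _ e with kind w p
    ... | isA j   = cong inj₁ (sym (mono-injective (posA-mono w) e))
    ... | isB j   = ⊥-elim (posA≢posB w i j e)
    ... | isG p h = ⊥-elim (posA≢G w i (subst (IsG w) (sym e) h))

  letter-B : (w : Shuffle k m N) → ∀ i → letter w (posB w i) ≡ inj₂ (inj₁ i)
  letter-B w i = go (kind w (posB w i)) refl
    where
    go : ∀ {p} (K : Kind w p) → posB w i ≡ p → letter w p ≡ inj₂ (inj₁ i)
    go {p} _ e with kind w p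
    ... | isA j   = ⊥-elim (posA≢posB w j i (sym e))
    ... | isB j   = cong (inj₂ ∘ inj₁) (sym (mono-injective (posB-mono w) e))
    ... | isG p h = ⊥-elim (posB≢G w i (subst (IsG w) (sym e) h))

  letter-G : (w : Shuffle k m N) → ∀ {p} → IsG w p → letter w p ≡ inj₂ (inj₂ tt)
  letter-G w {p} h with kind w p
  ... | isA j   = ⊥-elim (posA≢G w j h)
  ... | isB j   = ⊥-elim (posB≢G w j h)
  ... | isG _ _ = refl

  -- The numbers of letters a and b from position p on.
  restA : Shuffle k m N → Fin N → ℕ
  restA {k} w      zero    = k
  restA     (a∷ w) (suc p) = restA w p
  restA     (b∷ w) (suc p) = restA w p
  restA     (g∷ w) (suc p) = restA w p

  restB : Shuffle k m N → Fin N → ℕ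
  restB {m = m} w  zero    = m
  restB     (a∷ w) (suc p) = restB w p
  restB     (b∷ w) (suc p) = restB w p
  restB     (g∷ w) (suc p) = restB w p

  restA≤ : (w : Shuffle k m N) → ∀ p → restA w p ≤ k
  restA≤ w      zero    = ℕₚ.≤-refl
  restA≤ (a∷ w) (suc p) = ℕₚ.m≤n⇒m≤1+n (restA≤ w p)
  restA≤ (b∷ w) (suc p) = restA≤ w p
  restA≤ (g∷ w) (suc p) = restA≤ w p

  restB≤ : (w : Shuffle k m N) → ∀ p → restB w p ≤ m
  restB≤ w      zero    = ℕₚ.≤-refl
  restB≤ (b∷ w) (suc p) = ℕₚ.m≤n⇒m≤1+n (restB≤ w p)
  restB≤ (a∷ w) (suc p) = restB≤ w p
  restB≤ (g∷ w) (suc p) = restB≤ w p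

  -- The letters a before p are those with index below k - `restA w p`; the sum avoids subtraction.
  restA-before : (w : Shuffle k m N) → ∀ {p i} → posA w i Fin.< p → toℕ i + restA w p < k
  restA-before (a∷ w) {suc p} {zero}  q       = s≤s (restA≤ w p)
  restA-before (a∷ w) {suc p} {suc i} (s<s q) = s<s (restA-before w q)
  restA-before (b∷ w) {suc p} {i}     (s<s q) = restA-before w q
  restA-before (g∷ w) {suc p} {i}     (s<s q) = restA-before w q

  before-restA : (w : Shuffle k m N) → ∀ {p i} → toℕ i + restA w p < k → posA w i Fin.< p
  before-restA {k} w      {zero}  {i}     q       = ⊥-elim (ℕₚ.<⇒≱ q (ℕₚ.m≤n+m k (toℕ i)))
  before-restA     (a∷ w) {suc p} {zero}  q       = z<s
  before-restA     (a∷ w) {suc p} {suc i} (s<s q) = s<s (before-restA w q)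
  before-restA     (b∷ w) {suc p} {i}     q       = s<s (before-restA w q)
  before-restA     (g∷ w) {suc p} {i}     q       = s<s (before-restA w q)

  restB-before : (w : Shuffle k m N) → ∀ {p i} → posB w i Fin.< p → toℕ i + restB w p < m
  restB-before (b∷ w) {suc p} {zero}  q       = s≤s (restB≤ w p)
  restB-before (b∷ w) {suc p} {suc i} (s<s q) = s<s (restB-before w q)
  restB-before (a∷ w) {suc p} {i}     (s<s q) = restB-before w q
  restB-before (g∷ w) {suc p} {i}     (s<s q) = restB-before w q

  before-restB : (w : Shuffle k m N) → ∀ {p i} → toℕ i + restB w p < m → posB w i Fin.< p
  before-restB {m = m} w  {zero}  {i}     q       = ⊥-elim (ℕₚ.<⇒≱ q (ℕₚ.m≤n+m m (toℕ i)))
  before-restB     (b∷ w) {suc p} {zero}  q       = z<s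
  before-restB     (b∷ w) {suc p} {suc i} (s<s q) = s<s (before-restB w q)
  before-restB     (a∷ w) {suc p} {i}     q       = s<s (before-restB w q)
  before-restB     (g∷ w) {suc p} {i}     q       = s<s (before-restB w q)

  -- Counting the letters still to come makes the condition pass to suffixes of the word. When both
  -- letters occur equally often in total it agrees with counting those already seen.
  Level : Shuffle k m N → Set
  Level w = ∀ p → IsG w p → restA w p ≡ restB w p

  -- Only skew cuts of f may be separated by other letters.
  Contiguous : (Fin k → ℕ) → (Fin k → Fin N) → Set
  Contiguous f pos = ∀ {i j} → i Fin.< j → f i < f j →
    ∀ q → pos i Fin.< q → q Fin.< pos j → ∃ λ h → q ≡ pos h

  Increasing132 : (Fin n → Fin n) → Set
  Increasing132 π = No132 (toℕ ∘ π)

  Cube : (Fin n → Fin n) → Set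
  Cube π = ∀ i → π (π (π i)) ≡ i

  module Decoding {m N} (β : Permutation′ m) (w : Shuffle m m N) where

    P : Fin m → Fin (m + N)
    P i = i ↑ˡ N

    W : Fin N → Fin (m + N)
    W p = m ↑ʳ p

    private
      βʳ = β ⟨$⟩ʳ_
      βˡ = β ⟨$⟩ˡ_

    P<P : ∀ {i j} → P i Fin.< P j → i Fin.< j
    P<P {i} {j} = subst₂ _<_ (Finₚ.toℕ-↑ˡ i N) (Finₚ.toℕ-↑ˡ j N)

    W<W : ∀ {p q} → W p Fin.< W q → p Fin.< q
    W<W {p} {q} h = ℕₚ.+-cancelˡ-< m _ _ (subst₂ _<_ (Finₚ.toℕ-↑ʳ m p) (Finₚ.toℕ-↑ʳ m q) h)

    W<W⁺ : ∀ {p q} → p Fin.< q → W p Fin.< W q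
    W<W⁺ {p} {q} h = subst₂ _<_ (sym (Finₚ.toℕ-↑ʳ m p)) (sym (Finₚ.toℕ-↑ʳ m q)) (ℕₚ.+-monoʳ-< m h)

    P<W : ∀ i p → P i Fin.< W p
    P<W i p = subst₂ _<_ (sym (Finₚ.toℕ-↑ˡ i N)) (sym (Finₚ.toℕ-↑ʳ m p))
      (ℕₚ.<-≤-trans (Finₚ.toℕ<n i) (ℕₚ.m≤m+n m (toℕ p)))

    W≮P : ∀ {p i} → ¬ W p Fin.< P i
    W≮P {p} {i} h = ℕₚ.<-asym h (P<W i p)

    data Element : Fin (m + N) → Set where
      inP : ∀ i → Element (P i)
      inA : ∀ i → Element (W (posA w i))
      inB : ∀ i → Element (W (posB w i))
      inG : ∀ p → IsG w p → Element (W p)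

    element : ∀ x → Element x
    element x with splitAt m x in eq
    ... | inj₁ i = subst Element (Finₚ.splitAt⁻¹-↑ˡ eq) (inP i)
    ... | inj₂ p = subst Element (Finₚ.splitAt⁻¹-↑ʳ eq) (go (kind w p))
      where
      go : ∀ {p} → Kind w p → Element (W p)
      go (isA i)   = inA i
      go (isB i)   = inB i
      go (isG p h) = inG p h

    -- The nontrivial cycles are (i-th b, β i, i-th a).
    to : Fin (m + N) → Fin (m + N)
    to x = [ (λ i → W (posA w (βˡ i)))
           , (λ p → [ W ∘ posB w , [ P ∘ βʳ , (λ _ → W p) ]′ ]′ (letter w p)) ]′ (splitAt m x)

    from : Fin (m + N) → Fin (m + N)
    from x = [ (λ i → W (posB w (βˡ i)))
             , (λ p → [ P ∘ βʳ , [ W ∘ posA w , (λ _ → W p) ]′ ]′ (letter w p)) ]′ (splitAt m x)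

    to-P : ∀ i → to (P i) ≡ W (posA w (βˡ i))
    to-P i rewrite Finₚ.splitAt-↑ˡ m i N = refl

    to-A : ∀ i → to (W (posA w i)) ≡ W (posB w i)
    to-A i rewrite Finₚ.splitAt-↑ʳ m N (posA w i) | letter-A w i = refl

    to-B : ∀ i → to (W (posB w i)) ≡ P (βʳ i)
    to-B i rewrite Finₚ.splitAt-↑ʳ m N (posB w i) | letter-B w i = refl

    to-G : ∀ {p} → IsG w p → to (W p) ≡ W p
    to-G {p} h rewrite Finₚ.splitAt-↑ʳ m N p | letter-G w h = refl

    from-P : ∀ i → from (P i) ≡ W (posB w (βˡ i))
    from-P i rewrite Finₚ.splitAt-↑ˡ m i N = refl

    from-A : ∀ i → from (W (posA w i)) ≡ P (βʳ i)
    from-A i rewrite Finₚ.splitAt-↑ʳ m N (posA w i) | letter-A w i = refl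

    from-B : ∀ i → from (W (posB w i)) ≡ W (posA w i)
    from-B i rewrite Finₚ.splitAt-↑ʳ m N (posB w i) | letter-B w i = refl

    from-G : ∀ {p} → IsG w p → from (W p) ≡ W p
    from-G {p} h rewrite Finₚ.splitAt-↑ʳ m N p | letter-G w h = refl

    to-from : ∀ x → to (from x) ≡ x
    to-from x with element x
    ... | inP i   = trans (cong to (from-P i)) (trans (to-B (βˡ i)) (cong P (Perm.inverseʳ β)))
    ... | inA i   = trans (cong to (from-A i)) (trans (to-P (βʳ i)) (cong (W ∘ posA w) (Perm.inverseˡ β)))
    ... | inB i   = trans (cong to (from-B i)) (to-A i)
    ... | inG p h = trans (cong to (from-G h)) (to-G h)

    from-to : ∀ x → from (to x) ≡ x
    from-to x with element x
    ... | inP i   = trans (cong from (to-P i)) (trans (from-A (βˡ i)) (cong P (Perm.inverseʳ β)))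
    ... | inA i   = trans (cong from (to-A i)) (from-B i)
    ... | inB i   = trans (cong from (to-B i)) (trans (from-P (βʳ i)) (cong (W ∘ posB w) (Perm.inverseˡ β)))
    ... | inG p h = trans (cong from (to-G h)) (from-G h)

    decoded : Permutation′ (m + N)
    decoded = permutation to from to-from from-to

    cube : Cube to
    cube x with element x
    ... | inP i   = trans (cong (to ∘ to) (to-P i)) (trans (cong to (to-A (βˡ i)))
                      (trans (to-B (βˡ i)) (cong P (Perm.inverseʳ β))))
    ... | inA i   = trans (cong (to ∘ to) (to-A i)) (trans (cong to (to-B i))
                      (trans (to-P (βʳ i)) (cong (W ∘ posA w) (Perm.inverseˡ β))))
    ... | inB i   = trans (cong (to ∘ to) (to-B i)) (trans (cong to (to-P (βʳ i)))
                      (trans (to-A (βˡ (βʳ i))) (cong (W ∘ posB w) (Perm.inverseˡ β))))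
    ... | inG p h = trans (cong (to ∘ to) (to-G h)) (trans (cong to (to-G h)) (to-G h))

    module _ (β-no132 : No132 (toℕ ∘ βʳ)) (level : Level w)
             (contiguousA : Contiguous (toℕ ∘ βʳ) (posA w))
             (contiguousB : Contiguous (toℕ ∘ βʳ) (posB w)) where

      private
        value : ∀ {x} → Element x → Fin (m + N)
        value (inP i)   = W (posA w (βˡ i))
        value (inA i)   = W (posB w i)
        value (inB i)   = P (βʳ i)
        value (inG p h) = W p

        to-value : ∀ {x} (e : Element x) → to x ≡ value e
        to-value (inP i)   = to-P i
        to-value (inA i)   = to-A i
        to-value (inB i)   = to-B i
        to-value (inG p h) = to-G h

        A<G⇒B<G : ∀ {i p} → IsG w p → posA w i Fin.< p → posB w i Fin.< p
        A<G⇒B<G {i} {p} h q =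
          before-restB w (subst (λ r → toℕ i + r < m) (level p h) (restA-before w q))

        G<A⇒G<B : ∀ {i p} → IsG w p → p Fin.< posA w i → p Fin.< posB w i
        G<A⇒G<B {i} {p} h q with Finₚ.<-cmp p (posB w i)
        ... | tri< r _ _    = r
        ... | tri≈ _ refl _ = ⊥-elim (posB≢G w i h)
        ... | tri> _ _ r    = ⊥-elim (ℕₚ.<-asym q
          (before-restA w (subst (λ r → toℕ i + r < m) (sym (level p h)) (restB-before w r))))

        A∪G : ∀ {x} → Element x → Set
        A∪G (inP _)   = ⊥
        A∪G (inA _)   = ⊤
        A∪G (inB _)   = ⊥
        A∪G (inG _ _) = ⊤

        -- The i-th a goes to the i-th b, which preserves order among letters a. A fixed point g has
        -- equally many a and b before it, so passing from a to b does not cross it.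
        increasing : ∀ {y z} (e : Element y) (f : Element z) → A∪G e → A∪G f →
                     y Fin.< z → value e Fin.< value f
        increasing (inA i)   (inA j)   _ _ q = W<W⁺ (posB-mono w (mono-reflects (posA-mono w) (W<W q)))
        increasing (inA i)   (inG p h) _ _ q = W<W⁺ (A<G⇒B<G h (W<W q))
        increasing (inG p h) (inA j)   _ _ q = W<W⁺ (G<A⇒G<B h (W<W q))
        increasing (inG p h) (inG _ _) _ _ q = q

        β-recover : ∀ {i j} → i Fin.< j → toℕ (βʳ (βˡ i)) < toℕ (βʳ (βˡ j))
        β-recover = subst₂ Fin._<_ (sym (Perm.inverseʳ β)) (sym (Perm.inverseʳ β))

        P-before-W : ∀ {i j q} → i Fin.< j → posA w (βˡ i) Fin.< q → q Fin.< posA w (βˡ j) →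
                     ∃ λ h → q ≡ posA w h
        P-before-W i<j r s = contiguousA
          (mono-reflects (posA-mono w) (ℕₚ.<-trans r s)) (β-recover i<j) _ r s

        -- Values at letters b are the low ones. So a 132 with middle at b consists of letters b,
        -- and one with middle among the first positions starts there. If the middle is a or g, the
        -- end is b by `increasing`, and so is the start. What remains beyond β itself are low, low,
        -- a or g, and b, a or g, b, which contiguity excludes.
        go : ∀ {x y z} (d : Element x) (e : Element y) (f : Element z) → x Fin.< y → y Fin.< z →
             value d Fin.< value f → ¬ value f Fin.< value e
        go (inB i) (inB j) (inB k) xy yz p q =
          β-no132 (mono-reflects (posB-mono w) (W<W xy)) (mono-reflects (posB-mono w) (W<W yz)) (P<P p) (P<P q)
        go (inP i) (inB j) (inB k) xy yz p q = W≮P p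
        go (inA i) (inB j) (inB k) xy yz p q = W≮P p
        go (inG _ _) (inB j) (inB k) xy yz p q = W≮P p
        go d (inB j) (inP k) xy yz p q = W≮P q
        go d (inB j) (inA k) xy yz p q = W≮P q
        go d (inB j) (inG k _) xy yz p q = W≮P q
        -- 132 is an involution, so a 132 in the inverse of β is one in β with positions and values
        -- exchanged.
        go (inP i) (inP j) (inP k) xy yz p q = β-no132
          (mono-reflects (posA-mono w) (W<W p)) (mono-reflects (posA-mono w) (W<W q))
          (β-recover (P<P xy)) (β-recover (P<P yz))
        go (inA _) (inP j) f xy yz p q = W≮P xy
        go (inB _) (inP j) f xy yz p q = W≮P xy
        go (inG _ _) (inP j) f xy yz p q = W≮P xy
        go d (inA j) (inP k) xy yz p q = W≮P yz
        go d (inG j _) (inP k) xy yz p q = W≮P yz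
        go (inP i) (inP j) (inB k) xy yz p q = W≮P p
        -- The value at z is a position of the word between two letters a belonging to an ascent of
        -- β, so it would have to be a letter a as well.
        go (inP i) (inP j) (inA k) xy yz p q with P-before-W (P<P xy) (W<W p) (W<W q)
        ... | h , e = posA≢posB w h k (sym e)
        go (inP i) (inP j) (inG k g) xy yz p q with P-before-W (P<P xy) (W<W p) (W<W q)
        ... | h , refl = posA≢G w h g
        go d e@(inA _) f@(inA _) xy yz p q = ℕₚ.<-asym q (increasing e f tt tt yz)
        go d e@(inA _) f@(inG _ _) xy yz p q = ℕₚ.<-asym q (increasing e f tt tt yz)
        go d e@(inG _ _) f@(inA _) xy yz p q = ℕₚ.<-asym q (increasing e f tt tt yz)
        go d e@(inG _ _) f@(inG _ _) xy yz p q = ℕₚ.<-asym q (increasing e f tt tt yz)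
        go (inP i) (inA j) (inB k) xy yz p q = W≮P p
        go (inA i) (inA j) (inB k) xy yz p q = W≮P p
        go (inG _ _) (inA j) (inB k) xy yz p q = W≮P p
        go (inP i) (inG j _) (inB k) xy yz p q = W≮P p
        go (inA i) (inG j _) (inB k) xy yz p q = W≮P p
        go (inG _ _) (inG j _) (inB k) xy yz p q = W≮P p
        go (inB i) (inA j) (inB k) xy yz p q
          with contiguousB (mono-reflects (posB-mono w) (ℕₚ.<-trans (W<W xy) (W<W yz))) (P<P p) _ (W<W xy) (W<W yz)
        ... | h , e = posA≢posB w j h e
        go (inB i) (inG j g) (inB k) xy yz p q
          with contiguousB (mono-reflects (posB-mono w) (ℕₚ.<-trans (W<W xy) (W<W yz))) (P<P p) _ (W<W xy) (W<W yz)
        ... | h , refl = posB≢G w h g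

      decoded-no132 : Increasing132 to
      decoded-no132 {x} {y} {z} xy yz p q = go (element x) (element y) (element z) xy yz
        (subst₂ Fin._<_ (to-value (element x)) (to-value (element z)) p)
        (subst₂ Fin._<_ (to-value (element z)) (to-value (element y)) q)


-- Walks over trees, expansion into words, and parsing

module Walks where

  open import Data.Empty using (⊥-elim)
  open import Data.Fin.Base as Fin using (Fin; zero; suc; toℕ; _↑ˡ_; _↑ʳ_; splitAt)
  import Data.Fin.Properties as Finₚ
  open import Data.List.Base using (List; []; _∷_; _++_; replicate)
  import Data.List.Properties as Listₚ
  open import Data.Nat.Base as ℕ using (ℕ; zero; suc; _+_; _≤_; _<_; s≤s; s<s; z<s)
  import Data.Nat.Properties as ℕₚ
  open import Data.Product.Base using (∃; _×_; _,_)
  open import Data.Sum.Base using (_⊎_; inj₁; inj₂)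
  open import Data.Unit.Base using (tt)
  open import Function.Base using (_∘_)
  open import Relation.Binary.PropositionalEquality using (_≡_; _≢_; refl; sym; trans; cong; cong₂; subst; subst₂)
  open Codes using (Tree; leaf; node; ∣_∣; spine; Walk; flats; end; a; b; g)
  open TreeShapes
  open Words

  private variable
    k l m N r : ℕ
    L R T U X : Tree

  -- The indices are the components still to be read by letters `a` and by letters `b`. Each step
  -- thus knows its component and with it the length of the block it expands to.
  data TreeWalk : Tree → Tree → Set where
    end : TreeWalk leaf leaf
    a   : TreeWalk R U → TreeWalk (node L R) U
    b   : TreeWalk T R → TreeWalk T (node L R)
    g   : spine T ≡ spine U → TreeWalk T U → TreeWalk T U

  fromWalk : ∀ T U → Walk (spine T) (spine U) → TreeWalk T U
  fromWalk leaf       leaf       end     = end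
  fromWalk leaf       leaf       (g e w) = g e (fromWalk leaf leaf w)
  fromWalk leaf       (node L R) (b w)   = b (fromWalk leaf R w)
  fromWalk leaf       (node L R) (g e w) = g e (fromWalk leaf (node L R) w)
  fromWalk (node L R) leaf       (a w)   = a (fromWalk R leaf w)
  fromWalk (node L R) (node M S) (a w)   = a (fromWalk R (node M S) w)
  fromWalk (node L R) leaf       (g e w) = g e (fromWalk (node L R) leaf w)
  fromWalk (node L R) (node M S) (b w)   = b (fromWalk (node L R) S w)
  fromWalk (node L R) (node M S) (g e w) = g e (fromWalk (node L R) (node M S) w)

  toWalk : TreeWalk T U → Walk (spine T) (spine U)
  toWalk end     = end
  toWalk (a w)   = a (toWalk w)
  toWalk (b w)   = b (toWalk w)
  toWalk (g e w) = g e (toWalk w)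

  toWalk-fromWalk : ∀ T U w → toWalk (fromWalk T U w) ≡ w
  toWalk-fromWalk leaf       leaf       end     = refl
  toWalk-fromWalk leaf       leaf       (g e w) = cong (g e) (toWalk-fromWalk leaf leaf w)
  toWalk-fromWalk leaf       (node L R) (b w)   = cong b (toWalk-fromWalk leaf R w)
  toWalk-fromWalk leaf       (node L R) (g e w) = cong (g e) (toWalk-fromWalk leaf (node L R) w)
  toWalk-fromWalk (node L R) leaf       (a w)   = cong a (toWalk-fromWalk R leaf w)
  toWalk-fromWalk (node L R) (node M S) (a w)   = cong a (toWalk-fromWalk R (node M S) w)
  toWalk-fromWalk (node L R) leaf       (g e w) = cong (g e) (toWalk-fromWalk (node L R) leaf w)
  toWalk-fromWalk (node L R) (node M S) (b w)   = cong b (toWalk-fromWalk (node L R) S w)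
  toWalk-fromWalk (node L R) (node M S) (g e w) = cong (g e) (toWalk-fromWalk (node L R) (node M S) w)

  fromWalk-toWalk : (w : TreeWalk T U) → fromWalk T U (toWalk w) ≡ w
  fromWalk-toWalk end                                = refl
  fromWalk-toWalk {U = leaf}     (a w)               = cong a (fromWalk-toWalk w)
  fromWalk-toWalk {U = node _ _} (a w)               = cong a (fromWalk-toWalk w)
  fromWalk-toWalk {leaf}     (b w)                   = cong b (fromWalk-toWalk w)
  fromWalk-toWalk {node _ _} (b w)                   = cong b (fromWalk-toWalk w)
  fromWalk-toWalk {leaf}     {leaf}     (g e w)      = cong (g e) (fromWalk-toWalk w)
  fromWalk-toWalk {leaf}     {node _ _} (g e w)      = cong (g e) (fromWalk-toWalk w)
  fromWalk-toWalk {node _ _} {leaf}     (g e w)      = cong (g e) (fromWalk-toWalk w)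
  fromWalk-toWalk {node _ _} {node _ _} (g e w)      = cong (g e) (fromWalk-toWalk w)

  blockA : ∀ l → Shuffle k m N → Shuffle (l + k) m (l + N)
  blockA zero    w = w
  blockA (suc l) w = a∷ blockA l w

  blockB : ∀ l → Shuffle k m N → Shuffle k (l + m) (l + N)
  blockB zero    w = w
  blockB (suc l) w = b∷ blockB l w

  width : TreeWalk T U → ℕ
  width end           = 0
  width (a {L = L} w) = suc (∣ L ∣ + width w)
  width (b {L = L} w) = suc (∣ L ∣ + width w)
  width (g e w)       = suc (width w)

  expand : (w : TreeWalk T U) → Shuffle ∣ T ∣ ∣ U ∣ (width w)
  expand end           = []
  expand (a {L = L} w) = blockA (suc ∣ L ∣) (expand w)
  expand (b {L = L} w) = blockB (suc ∣ L ∣) (expand w)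
  expand (g e w)       = g∷ expand w

  width-eq : (w : TreeWalk T U) → width w ≡ ∣ T ∣ + ∣ U ∣ + flats (toWalk w)
  width-eq end = refl
  width-eq {U = U} (a {R} {L = L} w) = cong suc (begin
    ∣ L ∣ + width w                         ≡⟨ cong (∣ L ∣ +_) (width-eq w) ⟩
    ∣ L ∣ + (∣ R ∣ + ∣ U ∣ + f)             ≡⟨ ℕₚ.+-assoc ∣ L ∣ (∣ R ∣ + ∣ U ∣) f ⟨
    ∣ L ∣ + (∣ R ∣ + ∣ U ∣) + f             ≡⟨ cong (_+ f) (ℕₚ.+-assoc (∣ L ∣) (∣ R ∣) (∣ U ∣)) ⟨
    ∣ L ∣ + ∣ R ∣ + ∣ U ∣ + f               ∎)
    where
    open Relation.Binary.PropositionalEquality.≡-Reasoning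
    f = flats (toWalk w)
  width-eq {T} (b {R = R} {L} w) = begin
    suc (∣ L ∣ + width w)                   ≡⟨ cong (λ j → suc (∣ L ∣ + j)) (width-eq w) ⟩
    suc ∣ L ∣ + (∣ T ∣ + ∣ R ∣ + f)         ≡⟨ ℕₚ.+-assoc (suc ∣ L ∣) (∣ T ∣ + ∣ R ∣) f ⟨
    suc ∣ L ∣ + (∣ T ∣ + ∣ R ∣) + f         ≡⟨ cong (_+ f) (x∙yz≈y∙xz (suc ∣ L ∣) (∣ T ∣) (∣ R ∣)) ⟩
    ∣ T ∣ + suc (∣ L ∣ + ∣ R ∣) + f         ∎
    where
    open Relation.Binary.PropositionalEquality.≡-Reasoning
    open import Algebra.Properties.CommutativeSemigroup ℕₚ.+-commutativeSemigroup using (x∙yz≈y∙xz)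
    f = flats (toWalk w)
  width-eq {T} {U} (g e w) = trans (cong suc (width-eq w)) (sym (ℕₚ.+-suc (∣ T ∣ + ∣ U ∣) (flats (toWalk w))))

  posA-block-↑ˡ : ∀ l (w : Shuffle k m N) c → posA (blockA l w) (c ↑ˡ k) ≡ c ↑ˡ N
  posA-block-↑ˡ (suc l) w zero    = refl
  posA-block-↑ˡ (suc l) w (suc c) = cong suc (posA-block-↑ˡ l w c)

  posA-block-↑ʳ : ∀ l (w : Shuffle k m N) j → posA (blockA l w) (l ↑ʳ j) ≡ l ↑ʳ posA w j
  posA-block-↑ʳ zero    w j = refl
  posA-block-↑ʳ (suc l) w j = cong suc (posA-block-↑ʳ l w j)

  posB-blockA : ∀ l (w : Shuffle k m N) j → posB (blockA l w) j ≡ l ↑ʳ posB w j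
  posB-blockA zero    w j = refl
  posB-blockA (suc l) w j = cong suc (posB-blockA l w j)

  posB-block-↑ˡ : ∀ l (w : Shuffle k m N) c → posB (blockB l w) (c ↑ˡ m) ≡ c ↑ˡ N
  posB-block-↑ˡ (suc l) w zero    = refl
  posB-block-↑ˡ (suc l) w (suc c) = cong suc (posB-block-↑ˡ l w c)

  posB-block-↑ʳ : ∀ l (w : Shuffle k m N) j → posB (blockB l w) (l ↑ʳ j) ≡ l ↑ʳ posB w j
  posB-block-↑ʳ zero    w j = refl
  posB-block-↑ʳ (suc l) w j = cong suc (posB-block-↑ʳ l w j)

  posA-blockB : ∀ l (w : Shuffle k m N) j → posA (blockB l w) j ≡ l ↑ʳ posA w j
  posA-blockB zero    w j = refl
  posA-blockB (suc l) w j = cong suc (posA-blockB l w j)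

  data Side (l N : ℕ) : Fin (l + N) → Set where
    inˡ : ∀ c → Side l N (c ↑ˡ N)
    inʳ : ∀ q → Side l N (l ↑ʳ q)

  side : ∀ l N x → Side l N x
  side l N x with splitAt l x in eq
  ... | inj₁ c = subst (Side l N) (Finₚ.splitAt⁻¹-↑ˡ eq) (inˡ c)
  ... | inj₂ q = subst (Side l N) (Finₚ.splitAt⁻¹-↑ʳ {l} eq) (inʳ q)

  ↑ˡ<↑ʳ : ∀ {l N} (c : Fin l) (q : Fin N) → c ↑ˡ N Fin.< l ↑ʳ q
  ↑ˡ<↑ʳ {l} {N} c q = subst₂ _<_ (sym (Finₚ.toℕ-↑ˡ c N)) (sym (Finₚ.toℕ-↑ʳ l q))
    (ℕₚ.<-≤-trans (Finₚ.toℕ<n c) (ℕₚ.m≤m+n l (toℕ q)))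

  ↑ʳ<↑ʳ : ∀ {N} l {p q : Fin N} → l ↑ʳ p Fin.< l ↑ʳ q → p Fin.< q
  ↑ʳ<↑ʳ l {p} {q} h = ℕₚ.+-cancelˡ-< l _ _ (subst₂ _<_ (Finₚ.toℕ-↑ʳ l p) (Finₚ.toℕ-↑ʳ l q) h)

  ↑ʳ<↑ʳ⁺ : ∀ {N} l {p q : Fin N} → p Fin.< q → l ↑ʳ p Fin.< l ↑ʳ q
  ↑ʳ<↑ʳ⁺ l {p} {q} h = subst₂ _<_ (sym (Finₚ.toℕ-↑ʳ l p)) (sym (Finₚ.toℕ-↑ʳ l q)) (ℕₚ.+-monoʳ-< l h)

  ↑ˡ≢↑ʳ : ∀ {l N} (c : Fin l) (q : Fin N) → l ↑ʳ q ≢ c ↑ˡ N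
  ↑ˡ≢↑ʳ c q e = Finₚ.<⇒≢ (↑ˡ<↑ʳ c q) (sym e)

  module _ {f : Fin k → ℕ} {pos : Fin k → Fin (l + N)} {pos′ : Fin k → Fin N}
           (shift : ∀ j → pos j ≡ l ↑ʳ pos′ j) where

    shift-contiguous : Contiguous f pos′ → Contiguous f pos
    shift-contiguous c {i} {j} i<j fi<fj q p<q q<p with side l N q
    ... | inˡ d = ⊥-elim (ℕₚ.<-asym (subst (Fin._< d ↑ˡ N) (shift i) p<q) (↑ˡ<↑ʳ d (pos′ i)))
    ... | inʳ q′ with c i<j fi<fj q′ (↑ʳ<↑ʳ l (subst (Fin._< l ↑ʳ q′) (shift i) p<q))
                                    (↑ʳ<↑ʳ l (subst (l ↑ʳ q′ Fin.<_) (shift j) q<p))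
    ...   | h , e = h , trans (cong (l ↑ʳ_) e) (sym (shift h))

    unshift-contiguous : Contiguous f pos → Contiguous f pos′
    unshift-contiguous c {i} {j} i<j fi<fj q p<q q<p
      with c i<j fi<fj (l ↑ʳ q) (subst (Fin._< l ↑ʳ q) (sym (shift i)) (↑ʳ<↑ʳ⁺ l p<q))
                                (subst (l ↑ʳ q Fin.<_) (sym (shift j)) (↑ʳ<↑ʳ⁺ l q<p))
    ... | h , e = h , Finₚ.↑ʳ-injective l _ _ (trans e (shift h))

  module _ {f : Fin (l + r) → ℕ} {pos : Fin (l + r) → Fin (l + N)} {pos′ : Fin r → Fin N}
           (initial : ∀ c → pos (c ↑ˡ r) ≡ c ↑ˡ N) (shift : ∀ j → pos (l ↑ʳ j) ≡ l ↑ʳ pos′ j) where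

    -- The letters of the block are adjacent, and from the block to the rest f only descends, so
    -- contiguity concerns just the block and the rest separately.
    block-contiguous : (∀ c j → f (l ↑ʳ j) < f (c ↑ˡ r)) → Contiguous (f ∘ (l ↑ʳ_)) pos′ → Contiguous f pos
    block-contiguous f< c {i} {j} i<j fi<fj q p<q q<p with side l r i | side l r j | side l N q
    ... | _      | inˡ d  | inˡ h  = h ↑ˡ r , sym (initial h)
    ... | _      | inˡ d  | inʳ q′ =
      ⊥-elim (ℕₚ.<-asym (subst (l ↑ʳ q′ Fin.<_) (initial d) q<p) (↑ˡ<↑ʳ d q′))
    ... | inˡ d  | inʳ j′ | _      = ⊥-elim (ℕₚ.<-asym fi<fj (f< d j′))
    ... | inʳ i′ | inʳ j′ | inˡ d  =
      ⊥-elim (ℕₚ.<-asym (subst (Fin._< d ↑ˡ N) (shift i′) p<q) (↑ˡ<↑ʳ d (pos′ i′)))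
    ... | inʳ i′ | inʳ j′ | inʳ q′
      with c (↑ʳ<↑ʳ l i<j) fi<fj q′ (↑ʳ<↑ʳ l (subst (Fin._< l ↑ʳ q′) (shift i′) p<q))
                                   (↑ʳ<↑ʳ l (subst (l ↑ʳ q′ Fin.<_) (shift j′) q<p))
    ...   | h , e = l ↑ʳ h , trans (cong (l ↑ʳ_) e) (sym (shift h))

    unblock-contiguous : Contiguous f pos → Contiguous (f ∘ (l ↑ʳ_)) pos′
    unblock-contiguous c {i} {j} i<j fi<fj q p<q q<p
      with c (↑ʳ<↑ʳ⁺ l i<j) fi<fj (l ↑ʳ q) (subst (Fin._< l ↑ʳ q) (sym (shift i)) (↑ʳ<↑ʳ⁺ l p<q))
                                          (subst (l ↑ʳ q Fin.<_) (sym (shift j)) (↑ʳ<↑ʳ⁺ l q<p))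
    ... | h , e with side l r h
    ...   | inˡ d  = ⊥-elim (↑ˡ≢↑ʳ d q (trans e (initial d)))
    ...   | inʳ h′ = h′ , Finₚ.↑ʳ-injective l _ _ (trans e (shift h′))

  shape-components : ∀ L R {f} → Shape (node L R) f → ∀ c j → f (suc ∣ L ∣ ↑ʳ j) < f (c ↑ˡ ∣ R ∣)
  shape-components L R {f} (_ , _ , _ , R<L , R<) c j = go (position ∣ L ∣ ∣ R ∣ (c ↑ˡ ∣ R ∣)) refl
    where
    go : ∀ {x} → Position ∣ L ∣ ∣ R ∣ x → c ↑ˡ ∣ R ∣ ≡ x → f (suc ∣ L ∣ ↑ʳ j) < f x
    go (isLeft i)  e = R<L i j
    go isRoot      e = R< j
    go (isRight i) e = ⊥-elim (↑ˡ≢↑ʳ c i (sym e))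

  expand-contiguousA : (w : TreeWalk T U) → ∀ {f} → Shape T f → Contiguous f (posA (expand w))
  expand-contiguousA (a {R} {U} {L} w) {f} s@(_ , sR , _) =
    block-contiguous {l = suc ∣ L ∣} (posA-block-↑ˡ (suc ∣ L ∣) (expand w)) (posA-block-↑ʳ (suc ∣ L ∣) (expand w))
      (shape-components L R {f} s) (expand-contiguousA w sR)
  expand-contiguousA (b {L = L} w) s =
    shift-contiguous {l = suc ∣ L ∣} (posA-blockB (suc ∣ L ∣) (expand w)) (expand-contiguousA w s)
  expand-contiguousA (g e w) s = shift-contiguous {l = 1} (λ _ → refl) (expand-contiguousA w s)

  expand-contiguousB : (w : TreeWalk T U) → ∀ {f} → Shape U f → Contiguous f (posB (expand w))
  expand-contiguousB (b {R = R} {L} w) {f} s@(_ , sR , _) =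
    block-contiguous {l = suc ∣ L ∣} (posB-block-↑ˡ (suc ∣ L ∣) (expand w)) (posB-block-↑ʳ (suc ∣ L ∣) (expand w))
      (shape-components L R {f} s) (expand-contiguousB w sR)
  expand-contiguousB (a {L = L} w) s =
    shift-contiguous {l = suc ∣ L ∣} (posB-blockA (suc ∣ L ∣) (expand w)) (expand-contiguousB w s)
  expand-contiguousB (g e w) s = shift-contiguous {l = 1} (λ _ → refl) (expand-contiguousB w s)

  data Suffix (X : Tree) : Tree → Set where
    here  : Suffix X X
    there : Suffix X (node L R) → Suffix X R

  suffix-node : Suffix (node L R) U → U ≡ node L R ⊎ Suffix R U
  suffix-node here      = inj₁ refl
  suffix-node (there s) with suffix-node s
  ... | inj₁ refl = inj₂ here
  ... | inj₂ t    = inj₂ (there t)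

  suffix-total : Suffix X T → Suffix X U → Suffix T U ⊎ Suffix U T
  suffix-total here      t = inj₁ t
  suffix-total (there s) t with suffix-total s t
  ... | inj₂ u = inj₂ (there u)
  ... | inj₁ u with suffix-node u
  ...   | inj₁ refl = inj₂ (there here)
  ...   | inj₂ v    = inj₁ v

  suffix-smaller : Suffix T U → U ≡ T ⊎ (spine U < spine T × ∣ U ∣ < ∣ T ∣)
  suffix-smaller here = inj₁ refl
  suffix-smaller (there {L} {R} s) with suffix-smaller s
  ... | inj₁ refl    = inj₂ (ℕₚ.n<1+n _ , s≤s (ℕₚ.m≤n+m ∣ R ∣ ∣ L ∣))
  ... | inj₂ (p , q) = inj₂ (ℕₚ.<-trans (ℕₚ.n<1+n _) p , ℕₚ.<-trans (s≤s (ℕₚ.m≤n+m ∣ R ∣ ∣ L ∣)) q)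

  -- Suffixes of X are linearly ordered, and both spine and size decrease strictly along them. This
  -- translates between level in components, as in `TreeWalk`, and level in letters, as in `Level`.
  suffix-≡ : Suffix X T → Suffix X U → spine T ≡ spine U ⊎ ∣ T ∣ ≡ ∣ U ∣ → T ≡ U
  suffix-≡ s t e with suffix-total s t
  suffix-≡ s t e | inj₁ u with suffix-smaller u
  ... | inj₁ p       = sym p
  suffix-≡ s t (inj₁ e) | inj₁ u | inj₂ (p , q) = ⊥-elim (ℕₚ.<⇒≢ p (sym e))
  suffix-≡ s t (inj₂ e) | inj₁ u | inj₂ (p , q) = ⊥-elim (ℕₚ.<⇒≢ q (sym e))
  suffix-≡ s t e | inj₂ u with suffix-smaller u
  ... | inj₁ p       = p
  suffix-≡ s t (inj₁ e) | inj₂ u | inj₂ (p , q) = ⊥-elim (ℕₚ.<⇒≢ p e)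
  suffix-≡ s t (inj₂ e) | inj₂ u | inj₂ (p , q) = ⊥-elim (ℕₚ.<⇒≢ q e)

  level-blockA : ∀ l (w : Shuffle k m N) → Level w → Level (blockA l w)
  level-blockA zero    w h         = h
  level-blockA (suc l) w h (suc p) = level-blockA l w h p

  level-blockB : ∀ l (w : Shuffle k m N) → Level w → Level (blockB l w)
  level-blockB zero    w h         = h
  level-blockB (suc l) w h (suc p) = level-blockB l w h p

  unlevel-blockA : ∀ l (w : Shuffle k m N) → Level (blockA l w) → Level w
  unlevel-blockA zero    w h = h
  unlevel-blockA (suc l) w h = unlevel-blockA l w (h ∘ suc)

  unlevel-blockB : ∀ l (w : Shuffle k m N) → Level (blockB l w) → Level w
  unlevel-blockB zero    w h = h
  unlevel-blockB (suc l) w h = unlevel-blockB l w (h ∘ suc)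

  expand-level : Suffix X T → Suffix X U → (w : TreeWalk T U) → Level (expand w)
  expand-level s t (a {L = L} w) = level-blockA (suc ∣ L ∣) (expand w) (expand-level (there s) t w)
  expand-level s t (b {L = L} w) = level-blockB (suc ∣ L ∣) (expand w) (expand-level s (there t) w)
  expand-level s t (g e w) zero    _ = cong ∣_∣ (suffix-≡ s t (inj₁ e))
  expand-level s t (g e w) (suc p) h = expand-level s t w p h

  data Letter : Set where
    A B G : Letter

  -- Forgets the counts, so that words of different types become comparable.
  letters : Shuffle k m N → List Letter
  letters []     = []
  letters (a∷ w) = A ∷ letters w
  letters (b∷ w) = B ∷ letters w
  letters (g∷ w) = G ∷ letters w

  letters-blockA : ∀ l (w : Shuffle k m N) → letters (blockA l w) ≡ replicate l A ++ letters w
  letters-blockA zero    w = refl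
  letters-blockA (suc l) w = cong (A ∷_) (letters-blockA l w)

  letters-blockB : ∀ l (w : Shuffle k m N) → letters (blockB l w) ≡ replicate l B ++ letters w
  letters-blockB zero    w = refl
  letters-blockB (suc l) w = cong (B ∷_) (letters-blockB l w)

  -- The block lengths come from trees which both walks share, so equal words can be cancelled block
  -- by block.
  expand-injective : (v w : TreeWalk T U) → letters (expand v) ≡ letters (expand w) → v ≡ w
  expand-injective end     end      e = refl
  expand-injective (a {L = L} v) (a w) e = cong a (expand-injective v w
    (Listₚ.++-cancelˡ (replicate ∣ L ∣ A) _ _ (trans (sym (letters-blockA ∣ L ∣ (expand v)))
      (trans (Listₚ.∷-injectiveʳ e) (letters-blockA ∣ L ∣ (expand w))))))
  expand-injective (b {L = L} v) (b w) e = cong b (expand-injective v w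
    (Listₚ.++-cancelˡ (replicate ∣ L ∣ B) _ _ (trans (sym (letters-blockB ∣ L ∣ (expand v)))
      (trans (Listₚ.∷-injectiveʳ e) (letters-blockB ∣ L ∣ (expand w))))))
  expand-injective (g p v) (g q w)  e =
    cong₂ g (ℕₚ.≡-irrelevant p q) (expand-injective v w (Listₚ.∷-injectiveʳ e))
  expand-injective end     (g _ w)  ()
  expand-injective (a v)   (b w)    ()
  expand-injective (a v)   (g _ w)  ()
  expand-injective (b v)   (a w)    ()
  expand-injective (b v)   (g _ w)  ()
  expand-injective (g _ v) end      ()
  expand-injective (g _ v) (a w)    ()
  expand-injective (g _ v) (b w)    ()

  private
    data StartsA (l : ℕ) {k m : ℕ} : ∀ {N} → Shuffle (l + k) m N → Set where
      starts : ∀ {N} (w : Shuffle k m N) → StartsA l (blockA l w)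

    data StartsB (l : ℕ) {k m : ℕ} : ∀ {N} → Shuffle k (l + m) N → Set where
      starts : ∀ {N} (w : Shuffle k m N) → StartsB l (blockB l w)

    startsA : ∀ l {k} (w : Shuffle (l + k) m N) →
              (∀ c q → q Fin.< posA w (c ↑ˡ k) → ∃ λ h → q ≡ posA w h) → StartsA l w
    startsA zero    w      h = starts w
    startsA (suc l) (a∷ w) h with startsA l w (λ c q p → strip (h (suc c) (suc q) (s<s p)))
      where
      strip : ∀ {q} → (∃ λ i → suc q ≡ posA (a∷ w) i) → ∃ λ i → q ≡ posA w i
      strip (suc i , e) = i , Finₚ.suc-injective e
    ... | starts v = starts v
    startsA (suc l) (b∷ w) h with h zero zero z<s
    ... | _ , ()
    startsA (suc l) (g∷ w) h with h zero zero z<s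
    ... | _ , ()

    startsB : ∀ l {k} (w : Shuffle m (l + k) N) →
              (∀ c q → q Fin.< posB w (c ↑ˡ k) → ∃ λ h → q ≡ posB w h) → StartsB l w
    startsB zero    w      h = starts w
    startsB (suc l) (b∷ w) h with startsB l w (λ c q p → strip (h (suc c) (suc q) (s<s p)))
      where
      strip : ∀ {q} → (∃ λ i → suc q ≡ posB (b∷ w) i) → ∃ λ i → q ≡ posB w i
      strip (suc i , e) = i , Finₚ.suc-injective e
    ... | starts v = starts v
    startsB (suc l) (a∷ w) h with h zero zero z<s
    ... | _ , ()
    startsB (suc l) (g∷ w) h with h zero zero z<s
    ... | _ , ()

    -- The first entry of L ⊕ 1 is smaller than the last one, unless L is empty.
    first-component : ∀ L R {f} {M} {pos : Fin (suc (∣ L ∣ + ∣ R ∣)) → Fin M} →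
      Shape (node L R) f → (∀ {i j} → i Fin.< j → pos i Fin.< pos j) → Contiguous f pos →
      ∀ c q → pos zero Fin.< q → q Fin.< pos (suc c ↑ˡ ∣ R ∣) → ∃ λ h → q ≡ pos h
    first-component L@(node _ _) R {pos = pos} (_ , _ , L< , _ , _) mono cont c q p<q q<p =
      cont {zero} {rootᵢ ∣ L ∣ ∣ R ∣} (left<root {∣ L ∣} {∣ R ∣} zero) (L< zero) q p<q (ℕₚ.<-≤-trans q<p below)
      where
      below : toℕ (pos (suc c ↑ˡ ∣ R ∣)) ≤ toℕ (pos (rootᵢ ∣ L ∣ ∣ R ∣))
      below with position ∣ L ∣ ∣ R ∣ (suc c ↑ˡ ∣ R ∣) in eq
      ... | p = go p refl
        where
        go : ∀ {x} → Position ∣ L ∣ ∣ R ∣ x → suc c ↑ˡ ∣ R ∣ ≡ x → toℕ (pos x) ≤ toℕ (pos (rootᵢ ∣ L ∣ ∣ R ∣))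
        go (isLeft i)  e = ℕₚ.<⇒≤ (mono (left<root {∣ L ∣} {∣ R ∣} i))
        go isRoot      e = ℕₚ.≤-refl
        go (isRight i) e = ⊥-elim (↑ˡ≢↑ʳ (suc c) i (sym e))
    first-component leaf R s mono cont () q p<q q<p

  data Expansion (T U : Tree) : ∀ {N} → Shuffle ∣ T ∣ ∣ U ∣ N → Set where
    expansion : (w : TreeWalk T U) → Expansion T U (expand w)

  private
    -- n bounds the length of the word, since what is left after a block is no structural subterm. T
    -- and U range over suffixes of a common X, as `suffix-≡` demands at a letter g.
    Parse : ℕ → Tree → Set
    Parse n X = ∀ {T U f h N} → N ≤ n → Suffix X T → Suffix X U → Shape T f → Shape U h →
      (w : Shuffle ∣ T ∣ ∣ U ∣ N) → Level w → Contiguous f (posA w) → Contiguous h (posB w) →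
      Expansion T U w

    -- Once the first letter of a component has been read, contiguity along the ascent found in
    -- `first-component` forces the rest of the block to follow at once.
    parseA : ∀ {n L R U f h N} → Parse n X → N ≤ n → Suffix X (node L R) → Suffix X U →
      Shape (node L R) f → Shape U h → (v : Shuffle (∣ L ∣ + ∣ R ∣) ∣ U ∣ N) → Level (a∷ v) →
      Contiguous f (posA (a∷ v)) → Contiguous h (posB (a∷ v)) → Expansion (node L R) U (a∷ v)
    parseA {L = L} {R} rec N≤n s t sT@(_ , sR , _) sU v level cA cB
      with startsA ∣ L ∣ v (λ c q p → strip (first-component L R sT (posA-mono (a∷ v)) cA c (suc q) z<s (s<s p)))
      where
      strip : ∀ {q} → (∃ λ i → suc q ≡ posA (a∷ v) i) → ∃ λ i → q ≡ posA v i
      strip (suc i , e) = i , Finₚ.suc-injective e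
    ... | starts u with rec (ℕₚ.≤-trans (ℕₚ.m≤n+m _ ∣ L ∣) N≤n) (there s) t sR sU u
            (unlevel-blockA (suc ∣ L ∣) u level)
            (unblock-contiguous {l = suc ∣ L ∣} (posA-block-↑ˡ (suc ∣ L ∣) u) (posA-block-↑ʳ (suc ∣ L ∣) u) cA)
            (unshift-contiguous {l = suc ∣ L ∣} (posB-blockA (suc ∣ L ∣) u) cB)
    ...   | expansion x = expansion (a x)

    parseB : ∀ {n L R T f h N} → Parse n X → N ≤ n → Suffix X T → Suffix X (node L R) →
      Shape T f → Shape (node L R) h → (v : Shuffle ∣ T ∣ (∣ L ∣ + ∣ R ∣) N) → Level (b∷ v) →
      Contiguous f (posA (b∷ v)) → Contiguous h (posB (b∷ v)) → Expansion T (node L R) (b∷ v)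
    parseB {L = L} {R} rec N≤n s t sT sU@(_ , sR , _) v level cA cB
      with startsB ∣ L ∣ v (λ c q p → strip (first-component L R sU (posB-mono (b∷ v)) cB c (suc q) z<s (s<s p)))
      where
      strip : ∀ {q} → (∃ λ i → suc q ≡ posB (b∷ v) i) → ∃ λ i → q ≡ posB v i
      strip (suc i , e) = i , Finₚ.suc-injective e
    ... | starts u with rec (ℕₚ.≤-trans (ℕₚ.m≤n+m _ ∣ L ∣) N≤n) s (there t) sT sR u
            (unlevel-blockB (suc ∣ L ∣) u level)
            (unshift-contiguous {l = suc ∣ L ∣} (posA-blockB (suc ∣ L ∣) u) cA)
            (unblock-contiguous {l = suc ∣ L ∣} (posB-block-↑ˡ (suc ∣ L ∣) u) (posB-block-↑ʳ (suc ∣ L ∣) u) cB)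
    ...   | expansion x = expansion (b x)

    parseG : ∀ {n T U f h N} → Parse n X → N ≤ n → Suffix X T → Suffix X U →
      Shape T f → Shape U h → (v : Shuffle ∣ T ∣ ∣ U ∣ N) → Level (g∷ v) →
      Contiguous f (posA (g∷ v)) → Contiguous h (posB (g∷ v)) → Expansion T U (g∷ v)
    parseG rec N≤n s t sT sU v level cA cB
      -- The level condition at this very letter g says that T and U have the same size.
      with suffix-≡ s t (inj₂ (level zero tt))
         | rec N≤n s t sT sU v (level ∘ suc) (unshift-contiguous {l = 1} (λ _ → refl) cA)
             (unshift-contiguous {l = 1} (λ _ → refl) cB)
    ... | e | expansion x = expansion (g (cong spine e) x)

  parseWalk : ∀ n {X} → Parse n X
  parseWalk n       {T = leaf}     {leaf}     N≤n s t sT sU [] level cA cB = expansion end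
  parseWalk (suc n) {T = leaf}     {leaf}     (s≤s N≤n) s t sT sU (g∷ v) = parseG (parseWalk n) N≤n s t sT sU v
  parseWalk (suc n) {T = leaf}     {node _ _} (s≤s N≤n) s t sT sU (b∷ v) = parseB (parseWalk n) N≤n s t sT sU v
  parseWalk (suc n) {T = leaf}     {node _ _} (s≤s N≤n) s t sT sU (g∷ v) = parseG (parseWalk n) N≤n s t sT sU v
  parseWalk (suc n) {T = node _ _} {leaf}     (s≤s N≤n) s t sT sU (a∷ v) = parseA (parseWalk n) N≤n s t sT sU v
  parseWalk (suc n) {T = node _ _} {leaf}     (s≤s N≤n) s t sT sU (g∷ v) = parseG (parseWalk n) N≤n s t sT sU v
  parseWalk (suc n) {T = node _ _} {node _ _} (s≤s N≤n) s t sT sU (a∷ v) = parseA (parseWalk n) N≤n s t sT sU v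
  parseWalk (suc n) {T = node _ _} {node _ _} (s≤s N≤n) s t sT sU (b∷ v) = parseB (parseWalk n) N≤n s t sT sU v
  parseWalk (suc n) {T = node _ _} {node _ _} (s≤s N≤n) s t sT sU (g∷ v) = parseG (parseWalk n) N≤n s t sT sU v


-- Recovering β and the word from a permutation

module Parsing where

  open import Data.Empty using (⊥-elim)
  open import Data.Fin.Base as Fin using (Fin; zero; suc; toℕ; fromℕ<; _↑ˡ_; _↑ʳ_)
  open import Data.Fin.Permutation as Perm using (Permutation′; Permutation; permutation; _⟨$⟩ʳ_; _⟨$⟩ˡ_; ↔⇒≡)
  import Data.Fin.Properties as Finₚ
  open import Data.List.Base using (_∷_)
  open import Data.Nat.Base as ℕ using (ℕ; zero; suc; _+_; _∸_; _≤_; _<_; z≤n; s≤s)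
  import Data.Nat.Properties as ℕₚ
  open import Data.Product.Base using (∃; ∃₂; _×_; _,_; proj₁; proj₂)
  open import Function.Base using (_∘_)
  open import Relation.Binary.Definitions using (tri<; tri≈; tri>)
  open import Relation.Binary.PropositionalEquality using (_≡_; _≢_; refl; sym; trans; cong; subst; subst₂)
  open import Relation.Nullary using (¬_; Dec; yes; no)
  open import Relation.Nullary.Decidable using (_→-dec_)
  open TreeShapes using (No132)
  open Words
  open Walks using (inˡ; inʳ; side; Letter; A; B; G; letters)

  private variable k m n N : ℕ

  -- `letter` without the index: its type is independent of the counts, so a word can be specified
  -- by its tags before the counts are known.
  tag : Shuffle k m N → Fin N → Letter
  tag (a∷ w) zero    = A
  tag (b∷ w) zero    = B
  tag (g∷ w) zero    = G
  tag (a∷ w) (suc p) = tag w p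
  tag (b∷ w) (suc p) = tag w p
  tag (g∷ w) (suc p) = tag w p

  tag-posA : (w : Shuffle k m N) → ∀ i → tag w (posA w i) ≡ A
  tag-posA (a∷ w) zero    = refl
  tag-posA (a∷ w) (suc i) = tag-posA w i
  tag-posA (b∷ w) i       = tag-posA w i
  tag-posA (g∷ w) i       = tag-posA w i

  tag-posB : (w : Shuffle k m N) → ∀ i → tag w (posB w i) ≡ B
  tag-posB (b∷ w) zero    = refl
  tag-posB (b∷ w) (suc i) = tag-posB w i
  tag-posB (a∷ w) i       = tag-posB w i
  tag-posB (g∷ w) i       = tag-posB w i

  tag-G : (w : Shuffle k m N) → ∀ p → IsG w p → tag w p ≡ G
  tag-G (g∷ w) zero    h = refl
  tag-G (a∷ w) (suc p) h = tag-G w p h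
  tag-G (b∷ w) (suc p) h = tag-G w p h
  tag-G (g∷ w) (suc p) h = tag-G w p h

  tag-A⁻¹ : (w : Shuffle k m N) → ∀ {p} → tag w p ≡ A → ∃ λ i → p ≡ posA w i
  tag-A⁻¹ w {p} e with kind w p
  ... | isA i   = i , refl
  ... | isB i   with () ← trans (sym e) (tag-posB w i)
  ... | isG _ h with () ← trans (sym e) (tag-G w p h)

  tag-B⁻¹ : (w : Shuffle k m N) → ∀ {p} → tag w p ≡ B → ∃ λ i → p ≡ posB w i
  tag-B⁻¹ w {p} e with kind w p
  ... | isB i   = i , refl
  ... | isA i   with () ← trans (sym e) (tag-posA w i)
  ... | isG _ h with () ← trans (sym e) (tag-G w p h)

  data Word (f : Fin N → Letter) : Set where
    word : ∀ {k m} (w : Shuffle k m N) → (∀ p → tag w p ≡ f p) → Word f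

  wordOf : (f : Fin N → Letter) → Word f
  wordOf {zero}  f = word [] λ ()
  wordOf {suc N} f with f zero in eq | wordOf (f ∘ suc)
  ... | A | word w h = word (a∷ w) λ { zero → sym eq ; (suc p) → h p }
  ... | B | word w h = word (b∷ w) λ { zero → sym eq ; (suc p) → h p }
  ... | G | word w h = word (g∷ w) λ { zero → sym eq ; (suc p) → h p }

  letters-cong : ∀ {k m k′ m′} (v : Shuffle k m N) (w : Shuffle k′ m′ N) →
                 (∀ p → tag v p ≡ tag w p) → letters v ≡ letters w
  letters-cong []     []     h = refl
  letters-cong (a∷ v) (a∷ w) h = cong (A ∷_) (letters-cong v w (h ∘ suc))
  letters-cong (b∷ v) (b∷ w) h = cong (B ∷_) (letters-cong v w (h ∘ suc))
  letters-cong (g∷ v) (g∷ w) h = cong (G ∷_) (letters-cong v w (h ∘ suc))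
  letters-cong (a∷ v) (b∷ w) h with () ← h zero
  letters-cong (a∷ v) (g∷ w) h with () ← h zero
  letters-cong (b∷ v) (a∷ w) h with () ← h zero
  letters-cong (b∷ v) (g∷ w) h with () ← h zero
  letters-cong (g∷ v) (a∷ w) h with () ← h zero
  letters-cong (g∷ v) (b∷ w) h with () ← h zero

  shuffle-ext : (v w : Shuffle k m N) → (∀ p → tag v p ≡ tag w p) → v ≡ w
  shuffle-ext []     []     h = refl
  shuffle-ext (a∷ v) (a∷ w) h = cong a∷_ (shuffle-ext v w (h ∘ suc))
  shuffle-ext (b∷ v) (b∷ w) h = cong b∷_ (shuffle-ext v w (h ∘ suc))
  shuffle-ext (g∷ v) (g∷ w) h = cong g∷_ (shuffle-ext v w (h ∘ suc))
  shuffle-ext (a∷ v) (b∷ w) h with () ← h zero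
  shuffle-ext (a∷ v) (g∷ w) h with () ← h zero
  shuffle-ext (b∷ v) (a∷ w) h with () ← h zero
  shuffle-ext (b∷ v) (g∷ w) h with () ← h zero
  shuffle-ext (g∷ v) (a∷ w) h with () ← h zero
  shuffle-ext (g∷ v) (b∷ w) h with () ← h zero

  -- An increasing map satisfies i ≤ σ i, and the same holds for the inverse of σ.
  monotone-id : (σ : Permutation′ k) → (∀ {i j} → i Fin.< j → (σ ⟨$⟩ʳ i) Fin.< (σ ⟨$⟩ʳ j)) →
                ∀ i → σ ⟨$⟩ʳ i ≡ i
  monotone-id {k} σ mono i = Finₚ.toℕ-injective (ℕₚ.≤-antisym
    (ℕₚ.≤-trans (below (σ ⟨$⟩ˡ_) mono⁻¹ (σ ⟨$⟩ʳ i)) (ℕₚ.≤-reflexive (cong toℕ (Perm.inverseˡ σ))))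
    (below (σ ⟨$⟩ʳ_) mono i))
    where
    mono⁻¹ : ∀ {i j} → i Fin.< j → (σ ⟨$⟩ˡ i) Fin.< (σ ⟨$⟩ˡ j)
    mono⁻¹ p = mono-reflects {f = σ ⟨$⟩ʳ_} mono (subst₂ Fin._<_ (sym (Perm.inverseʳ σ)) (sym (Perm.inverseʳ σ)) p)
    below : ∀ {k n} (f : Fin k → Fin n) → (∀ {i j} → i Fin.< j → f i Fin.< f j) → ∀ i → toℕ i ≤ toℕ (f i)
    below f mono zero    = z≤n
    below f mono (suc i) = ℕₚ.≤-trans (s≤s (below (f ∘ Fin.inject₁) (λ {i} {j} p → mono
        (subst₂ _<_ (sym (Finₚ.toℕ-inject₁ i)) (sym (Finₚ.toℕ-inject₁ j)) p)) i))
      (mono (subst (_< suc (toℕ i)) (sym (Finₚ.toℕ-inject₁ i)) (ℕₚ.n<1+n _)))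

  -- The witness is i = m - s. Applied to the letters remaining at a fixed point, this turns
  -- comparisons of positions into equality of counts.
  no-gap : ∀ {m r s} → r < s → s ≤ m → ¬ (∀ (i : Fin m) → toℕ i + r < m → toℕ i + s < m)
  no-gap {m} {r} {s} r<s s≤m h = ℕₚ.<-irrefl i+s (h i (subst (toℕ i + r <_) i+s (ℕₚ.+-monoʳ-< (toℕ i) r<s)))
    where
    m∸s<m : m ∸ s < m
    m∸s<m = ℕₚ.∸-monoʳ-< {m} {s} {0} (ℕₚ.≤-<-trans z≤n r<s) s≤m
    i : Fin m
    i = fromℕ< m∸s<m
    i+s : toℕ i + s ≡ m
    i+s = trans (cong (_+ s) (Finₚ.toℕ-fromℕ< m∸s<m)) (ℕₚ.m∸n+n≡m s≤m)

  Square : ℕ → (Fin n → Fin n) → Set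
  Square m π = ∀ x → toℕ x < m → m ≤ toℕ (π x)

  IncreasingFrom : ℕ → (Fin n → Fin n) → Set
  IncreasingFrom m π = ∀ {x y} → m ≤ toℕ x → x Fin.< y → m ≤ toℕ (π x) → m ≤ toℕ (π y) → π x Fin.< π y

  -- The side of the largest square, in the lower left corner of the diagram of π,
  -- that contains no point of the diagram.
  largestSquare : ∀ {π : Fin n → Fin n} → (∀ {x y} → π x ≡ π y → x ≡ y) → Increasing132 π →
    ∀ m N → m + N ≡ n → Square m π → ∃₂ λ m N → m + N ≡ n × Square m π × IncreasingFrom m π
  largestSquare {n} {π} inj no132 m zero e sq = m , 0 , e , sq ,
    λ {x} m≤x x<y _ _ → ⊥-elim (ℕₚ.<⇒≱ (subst (toℕ x <_) (trans (sym e) (ℕₚ.+-identityʳ m)) (Finₚ.toℕ<n x)) m≤x)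
  largestSquare {n} {π} inj no132 m (suc N) e sq
    with Finₚ.all? (λ x → (toℕ x ℕₚ.<? suc m) →-dec (suc m ℕₚ.≤? toℕ (π x)))
  ... | yes sq′ = largestSquare inj no132 (suc m) N (trans (sym (ℕₚ.+-suc m N)) e) sq′
  ... | no ¬sq
    with Finₚ.¬∀⟶∃¬ n _ (λ x → (toℕ x ℕₚ.<? suc m) →-dec (suc m ℕₚ.≤? toℕ (π x))) ¬sq
  ... | i , ¬i = m , suc N , e , sq , increasing
    where
    i≤m : toℕ i ≤ m
    i≤m = ℕₚ.≮⇒≥ λ m<i → ¬i λ i<1+m → ⊥-elim (ℕₚ.<⇒≱ m<i (ℕₚ.≤-pred i<1+m))
    πi≤m : toℕ (π i) ≤ m
    πi≤m = ℕₚ.≮⇒≥ λ m<πi → ¬i λ _ → m<πi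
    -- The square of side m + 1 contains a point, at i. It lies below and to the left of every
    -- descent in question, and would complete the descent to a 132.
    increasing : IncreasingFrom m π
    increasing {x} {y} m≤x x<y m≤πx m≤πy with Finₚ.<-cmp (π x) (π y)
    ... | tri< p _ _ = p
    ... | tri≈ _ p _ = ⊥-elim (Finₚ.<⇒≢ x<y (inj p))
    ... | tri> _ _ πy<πx with Finₚ.<-cmp i x
    ...   | tri> _ _ x<i    = ⊥-elim (ℕₚ.<⇒≱ x<i (ℕₚ.≤-trans i≤m m≤x))
    ...   | tri≈ _ refl _   = ⊥-elim (ℕₚ.<⇒≱ πy<πx (ℕₚ.≤-trans πi≤m m≤πy))
    ...   | tri< i<x _ _    = ⊥-elim (no132 i<x x<y
      (Finₚ.≤∧≢⇒< (ℕₚ.≤-trans πi≤m m≤πy) (λ q → Finₚ.<⇒≢ (ℕₚ.<-trans i<x x<y) (inj q))) πy<πx)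

  data Parsed : ∀ {n} → Permutation′ n → Set where
    parsed : ∀ {m N} {π : Permutation′ (m + N)} (β : Permutation′ m) (w : Shuffle m m N) →
             No132 (toℕ ∘ (β ⟨$⟩ʳ_)) → Level w →
             Contiguous (toℕ ∘ (β ⟨$⟩ʳ_)) (posA w) → Contiguous (toℕ ∘ (β ⟨$⟩ʳ_)) (posB w) →
             (∀ x → Decoding.to β w x ≡ π ⟨$⟩ʳ x) → Parsed π

  module _ {m N} (π : Permutation′ (m + N)) (no132 : Increasing132 (π ⟨$⟩ʳ_)) (cube : Cube (π ⟨$⟩ʳ_))
           (square : Square m (π ⟨$⟩ʳ_)) (increasing : IncreasingFrom m (π ⟨$⟩ʳ_)) where

    private
      πʳ = π ⟨$⟩ʳ_
      πˡ = π ⟨$⟩ˡ_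

      P : Fin m → Fin (m + N)
      P i = i ↑ˡ N

      W : Fin N → Fin (m + N)
      W p = m ↑ʳ p

      Low : Fin (m + N) → Set
      Low x = toℕ x < m

      π-injective : ∀ {x y} → πʳ x ≡ πʳ y → x ≡ y
      π-injective e = trans (sym (Perm.inverseˡ π)) (trans (cong πˡ e) (Perm.inverseˡ π))

      π²≡π⁻¹ : ∀ x → πʳ (πʳ x) ≡ πˡ x
      π²≡π⁻¹ x = π-injective (trans (cube x) (sym (Perm.inverseʳ π)))

      lowP : ∀ i → Low (P i)
      lowP i = subst (_< m) (sym (Finₚ.toℕ-↑ˡ i N)) (Finₚ.toℕ<n i)

      highW : ∀ p → m ≤ toℕ (W p)
      highW p = subst (m ≤_) (sym (Finₚ.toℕ-↑ʳ m p)) (ℕₚ.m≤m+n m (toℕ p))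

      P-of : ∀ {x} → Low x → ∃ λ i → P i ≡ x
      P-of {x} low with side m N x
      ... | inˡ i = i , refl
      ... | inʳ p = ⊥-elim (ℕₚ.<⇒≱ low (highW p))

      W-of : ∀ {x} → ¬ Low x → ∃ λ p → W p ≡ x
      W-of {x} ¬low with side m N x
      ... | inˡ i = ⊥-elim (¬low (lowP i))
      ... | inʳ p = p , refl

      P-injective : ∀ {i j} → P i ≡ P j → i ≡ j
      P-injective = Finₚ.↑ˡ-injective N _ _

      W-injective : ∀ {p q} → W p ≡ W q → p ≡ q
      W-injective = Finₚ.↑ʳ-injective m _ _

      P<P⁺ : ∀ {i j} → i Fin.< j → P i Fin.< P j
      P<P⁺ {i} {j} = subst₂ _<_ (sym (Finₚ.toℕ-↑ˡ i N)) (sym (Finₚ.toℕ-↑ˡ j N))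

      W<W⁻ : ∀ {p q} → W p Fin.< W q → p Fin.< q
      W<W⁻ {p} {q} h = ℕₚ.+-cancelˡ-< m _ _ (subst₂ _<_ (Finₚ.toℕ-↑ʳ m p) (Finₚ.toℕ-↑ʳ m q) h)

      W<W : ∀ {p q} → p Fin.< q → W p Fin.< W q
      W<W {p} {q} h = subst₂ _<_ (sym (Finₚ.toℕ-↑ʳ m p)) (sym (Finₚ.toℕ-↑ʳ m q)) (ℕₚ.+-monoʳ-< m h)

      high-π : ∀ {x} → Low x → ¬ Low (πʳ x)
      high-π low low′ = ℕₚ.<⇒≱ low′ (square _ low)

      high-π⁻¹ : ∀ {x} → Low x → ¬ Low (πˡ x)
      high-π⁻¹ {x} low low′ = high-π low′ (subst Low (sym (Perm.inverseʳ π)) low)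

      low? : ∀ x → Dec (Low x)
      low? x = toℕ x ℕₚ.<? m

      letterAt : Fin N → Letter
      letterAt p with low? (πˡ (W p)) | low? (πʳ (W p))
      ... | yes _ | _     = A
      ... | no _  | yes _ = B
      ... | no _  | no _  = G

      -- As π² is the inverse of π, both π x and its image π² x would be low, against the empty
      -- square.
      not-both : ∀ {p} → Low (πˡ (W p)) → ¬ Low (πʳ (W p))
      not-both {p} l l′ = high-π l′ (subst Low (sym (π²≡π⁻¹ (W p))) l)

      letterAt-A : ∀ {p} → Low (πˡ (W p)) → letterAt p ≡ A
      letterAt-A {p} l with low? (πˡ (W p)) | low? (πʳ (W p))
      ... | yes _ | _     = refl
      ... | no ¬l | _     = ⊥-elim (¬l l)

      letterAt-A⁻¹ : ∀ {p} → letterAt p ≡ A → Low (πˡ (W p))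
      letterAt-A⁻¹ {p} e with low? (πˡ (W p)) | low? (πʳ (W p))
      ... | yes l | _     = l
      letterAt-A⁻¹ {p} () | no _ | yes _
      letterAt-A⁻¹ {p} () | no _ | no _

      letterAt-B : ∀ {p} → Low (πʳ (W p)) → letterAt p ≡ B
      letterAt-B {p} l with low? (πˡ (W p)) | low? (πʳ (W p))
      ... | yes l′ | _     = ⊥-elim (not-both l′ l)
      ... | no _   | yes _ = refl
      ... | no _   | no ¬l = ⊥-elim (¬l l)

      letterAt-B⁻¹ : ∀ {p} → letterAt p ≡ B → Low (πʳ (W p))
      letterAt-B⁻¹ {p} e with low? (πˡ (W p)) | low? (πʳ (W p))
      letterAt-B⁻¹ {p} () | yes _ | _
      ... | no _ | yes l = l
      letterAt-B⁻¹ {p} () | no _ | no _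

      letterAt-G⁻¹ : ∀ {p} → letterAt p ≡ G → ¬ Low (πˡ (W p)) × ¬ Low (πʳ (W p))
      letterAt-G⁻¹ {p} e with low? (πˡ (W p)) | low? (πʳ (W p))
      letterAt-G⁻¹ {p} () | yes _ | _
      letterAt-G⁻¹ {p} () | no _  | yes _
      ... | no ¬l | no ¬l′ = ¬l , ¬l′

      module _ {k l} (w : Shuffle k l N) (tags : ∀ p → tag w p ≡ letterAt p) where

        toA : ∀ j → ∃ λ i → P i ≡ πˡ (W (posA w j))
        toA j = P-of (letterAt-A⁻¹ (trans (sym (tags _)) (tag-posA w j)))

        fromA : ∀ i → ∃ λ j → W (posA w j) ≡ πʳ (P i)
        fromA i with W-of (high-π (lowP i))
        ... | p , e with tag-A⁻¹ w (trans (tags p) (letterAt-A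
                           (subst Low (sym (trans (cong πˡ e) (Perm.inverseˡ π))) (lowP i))))
        ...   | j , refl = j , e

        toB : ∀ j → ∃ λ i → P i ≡ πʳ (W (posB w j))
        toB j = P-of (letterAt-B⁻¹ (trans (sym (tags _)) (tag-posB w j)))

        fromB : ∀ i → ∃ λ j → W (posB w j) ≡ πˡ (P i)
        fromB i with W-of (high-π⁻¹ (lowP i))
        ... | p , e with tag-B⁻¹ w (trans (tags p) (letterAt-B
                           (subst Low (sym (trans (cong πʳ e) (Perm.inverseʳ π))) (lowP i))))
        ...   | j , refl = j , e

        -- Serves twice: being a bijection it forces k = m, and then it is β. Likewise `permB`
        -- yields l = m and the numbering β′ by letters b.
        permA : Permutation k m
        permA = permutation (proj₁ ∘ toA) (proj₁ ∘ fromA)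
          (λ i → P-injective (trans (proj₂ (toA _)) (trans (cong πˡ (proj₂ (fromA i))) (Perm.inverseˡ π))))
          (λ j → mono-injective (posA-mono w) (W-injective
            (trans (proj₂ (fromA _)) (trans (cong πʳ (proj₂ (toA j))) (Perm.inverseʳ π)))))

        permB : Permutation l m
        permB = permutation (proj₁ ∘ toB) (proj₁ ∘ fromB)
          (λ i → P-injective (trans (proj₂ (toB _)) (trans (cong πʳ (proj₂ (fromB i))) (Perm.inverseʳ π))))
          (λ j → mono-injective (posB-mono w) (W-injective
            (trans (proj₂ (fromB _)) (trans (cong πˡ (proj₂ (toB j))) (Perm.inverseˡ π)))))

      module _ (w : Shuffle m m N) (tags : ∀ p → tag w p ≡ letterAt p) (β β′ : Permutation′ m)
               (β-A  : ∀ j → P (β ⟨$⟩ʳ j) ≡ πˡ (W (posA w j)))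
               (β-P  : ∀ i → W (posA w (β ⟨$⟩ˡ i)) ≡ πʳ (P i))
               (β′-B : ∀ j → P (β′ ⟨$⟩ʳ j) ≡ πʳ (W (posB w j)))
               (β′-P : ∀ i → W (posB w (β′ ⟨$⟩ˡ i)) ≡ πˡ (P i)) where

        -- π takes the j-th a to the b with number σ j. Since π increases above the square, σ is
        -- increasing and hence the identity, so the two numberings β and β′ coincide.
        σ : Permutation′ m
        σ = β Perm.∘ₚ Perm.flip β′

        π-P : ∀ i → πʳ (P i) ≡ W (posA w (β ⟨$⟩ˡ i))
        π-P i = sym (β-P i)

        π-A-σ : ∀ j → πʳ (W (posA w j)) ≡ W (posB w (σ ⟨$⟩ʳ j))
        π-A-σ j = trans (cong πʳ (sym (Perm.inverseʳ π)))
          (trans (π²≡π⁻¹ _) (trans (cong πˡ (sym (β-A j))) (sym (β′-P _))))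

        high-A-image : ∀ j → m ≤ toℕ (πʳ (W (posA w j)))
        high-A-image j = subst (λ x → m ≤ toℕ x) (sym (π-A-σ j)) (highW _)

        σ-mono : ∀ {i j} → i Fin.< j → (σ ⟨$⟩ʳ i) Fin.< (σ ⟨$⟩ʳ j)
        σ-mono {i} {j} p = mono-reflects (posB-mono w) (W<W⁻ (subst₂ Fin._<_ (π-A-σ i) (π-A-σ j)
          (increasing (highW _) (W<W (posA-mono w p)) (high-A-image i) (high-A-image j))))

        π-A : ∀ j → πʳ (W (posA w j)) ≡ W (posB w j)
        π-A j = trans (π-A-σ j) (cong (W ∘ posB w) (monotone-id σ σ-mono j))

        β≡β′ : ∀ j → β ⟨$⟩ʳ j ≡ β′ ⟨$⟩ʳ j
        β≡β′ j = trans (sym (Perm.inverseʳ β′)) (cong (β′ ⟨$⟩ʳ_) (monotone-id σ σ-mono j))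

        π-B : ∀ j → πʳ (W (posB w j)) ≡ P (β ⟨$⟩ʳ j)
        π-B j = trans (sym (β′-B j)) (cong P (sym (β≡β′ j)))

        -- The whole orbit lies above the square, where π increases; if π moved the point, the orbit
        -- would be strictly monotone and could not return after three steps.
        π-G : ∀ {p} → IsG w p → πʳ (W p) ≡ W p
        π-G {p} h with letterAt-G⁻¹ (trans (sym (tags p)) (tag-G w p h))
        ... | ¬low⁻¹ , ¬low = fixed
          where
          x = W p
          h₀ : m ≤ toℕ x
          h₀ = highW p
          h₁ : m ≤ toℕ (πʳ x)
          h₁ = ℕₚ.≮⇒≥ ¬low
          h₂ : m ≤ toℕ (πʳ (πʳ x))
          h₂ = subst (λ y → m ≤ toℕ y) (sym (π²≡π⁻¹ x)) (ℕₚ.≮⇒≥ ¬low⁻¹)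
          h₃ : m ≤ toℕ (πʳ (πʳ (πʳ x)))
          h₃ = subst (λ y → m ≤ toℕ y) (sym (cube x)) h₀
          fixed : πʳ x ≡ x
          fixed with Finₚ.<-cmp (πʳ x) x
          ... | tri≈ _ e _ = e
          ... | tri< p _ _ = ⊥-elim (Finₚ.<-irrefl refl (ℕₚ.<-trans p (subst (Fin._< πʳ x) (cube x)
            (ℕₚ.<-trans (increasing h₂ (increasing h₁ p h₂ h₁) h₃ h₂) (increasing h₁ p h₂ h₁)))))
          ... | tri> _ _ p = ⊥-elim (Finₚ.<-irrefl refl (ℕₚ.<-trans p (subst (πʳ x Fin.<_) (cube x)
            (ℕₚ.<-trans (increasing h₀ p h₁ h₂) (increasing h₁ (increasing h₀ p h₁ h₂) h₂ h₃)))))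

        agrees : ∀ x → Decoding.to β w x ≡ πʳ x
        agrees x = go (Decoding.element β w x)
          where
          go : ∀ {x} → Decoding.Element β w x → Decoding.to β w x ≡ πʳ x
          go (Decoding.inP i)   = trans (Decoding.to-P β w i) (sym (π-P i))
          go (Decoding.inA i)   = trans (Decoding.to-A β w i) (sym (π-A i))
          go (Decoding.inB i)   = trans (Decoding.to-B β w i) (sym (π-B i))
          go (Decoding.inG p h) = trans (Decoding.to-G β w h) (sym (π-G h))

        β-no132 : No132 (toℕ ∘ (β ⟨$⟩ʳ_))
        β-no132 {x} {y} {z} x<y y<z p q = no132 (W<W (posB-mono w x<y)) (W<W (posB-mono w y<z))
          (subst₂ Fin._<_ (sym (π-B x)) (sym (π-B z)) (P<P⁺ p))
          (subst₂ Fin._<_ (sym (π-B z)) (sym (π-B y)) (P<P⁺ q))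

        P-β : ∀ i → πʳ (P (β ⟨$⟩ʳ i)) ≡ W (posA w i)
        P-β i = trans (π-P _) (cong (W ∘ posA w) (Perm.inverseˡ β))

        -- If q were not an a, its preimage would come after β i and β j, and these three positions
        -- would have the values i-th a, j-th a, q: a 132.
        contiguousA : Contiguous (toℕ ∘ (β ⟨$⟩ʳ_)) (posA w)
        contiguousA {i} {j} i<j βi<βj q i<q q<j with low? (πˡ (W q))
        ... | yes l = tag-A⁻¹ w (trans (tags q) (letterAt-A l))
        ... | no ¬l = ⊥-elim (no132 (P<P⁺ βi<βj) (ℕₚ.<-≤-trans (lowP _) (ℕₚ.≮⇒≥ ¬l))
          (subst₂ Fin._<_ (sym (P-β i)) (sym (Perm.inverseʳ π)) (W<W i<q))
          (subst₂ Fin._<_ (sym (Perm.inverseʳ π)) (sym (P-β j)) (W<W q<j)))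

        -- If q were not a b, its value would exceed the low values β i and β j, and the three
        -- positions would form a 132.
        contiguousB : Contiguous (toℕ ∘ (β ⟨$⟩ʳ_)) (posB w)
        contiguousB {i} {j} i<j βi<βj q i<q q<j with low? (πʳ (W q))
        ... | yes l = tag-B⁻¹ w (trans (tags q) (letterAt-B l))
        ... | no ¬l = ⊥-elim (no132 (W<W i<q) (W<W q<j)
          (subst₂ Fin._<_ (sym (π-B i)) (sym (π-B j)) (P<P⁺ βi<βj))
          (subst (Fin._< πʳ (W q)) (sym (π-B j)) (ℕₚ.<-≤-trans (lowP _) (ℕₚ.≮⇒≥ ¬l))))

        A<G⇒B<G : ∀ {i p} → IsG w p → posA w i Fin.< p → posB w i Fin.< p
        A<G⇒B<G {i} {p} h q = W<W⁻ (subst₂ Fin._<_ (π-A i) (π-G h)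
          (increasing (highW _) (W<W q) (high-A-image i) (subst (λ x → m ≤ toℕ x) (sym (π-G h)) (highW p))))

        G<A⇒G<B : ∀ {i p} → IsG w p → p Fin.< posA w i → p Fin.< posB w i
        G<A⇒G<B {i} {p} h q = W<W⁻ (subst₂ Fin._<_ (π-G h) (π-A i)
          (increasing (highW _) (W<W q) (subst (λ x → m ≤ toℕ x) (sym (π-G h)) (highW p)) (high-A-image i)))

        B<G⇒A<G : ∀ {i p} → IsG w p → posB w i Fin.< p → posA w i Fin.< p
        B<G⇒A<G {i} {p} h q with Finₚ.<-cmp (posA w i) p
        ... | tri< r _ _    = r
        ... | tri≈ _ refl _ = ⊥-elim (posA≢G w i h)
        ... | tri> _ _ r    = ⊥-elim (ℕₚ.<-asym q (G<A⇒G<B h r))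

        -- π fixes p and increases above the square, so the i-th a precedes p exactly when its
        -- image, the i-th b, does.
        level : Level w
        level p h with ℕₚ.<-cmp (restA w p) (restB w p)
        ... | tri≈ _ e _   = e
        ... | tri< A<B _ _ = ⊥-elim (no-gap A<B (restB≤ w p)
          λ i q → restB-before w (A<G⇒B<G h (before-restA w q)))
        ... | tri> _ _ B<A = ⊥-elim (no-gap B<A (restA≤ w p)
          λ i q → restA-before w (B<G⇒A<G h (before-restB w q)))

    private
      assemble : ∀ (w : Shuffle m m N) (tags : ∀ p → tag w p ≡ letterAt p) β β′ →
                 (∀ j → P (β ⟨$⟩ʳ j) ≡ πˡ (W (posA w j))) → (∀ i → W (posA w (β ⟨$⟩ˡ i)) ≡ πʳ (P i)) →
                 (∀ j → P (β′ ⟨$⟩ʳ j) ≡ πʳ (W (posB w j))) → (∀ i → W (posB w (β′ ⟨$⟩ˡ i)) ≡ πˡ (P i)) → Parsed π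
      assemble w tags β β′ p q r s = parsed β w (β-no132 w tags β β′ p q r s) (level w tags β β′ p q r s)
        (contiguousA w tags β β′ p q r s) (contiguousB w tags β β′ p q r s) (agrees w tags β β′ p q r s)

      finish : ∀ {k l} (w : Shuffle k l N) → (∀ p → tag w p ≡ letterAt p) → k ≡ m → l ≡ m → Parsed π
      finish w tags refl refl = assemble w tags (permA w tags) (permB w tags) (λ j → proj₂ (toA w tags j))
        (λ i → proj₂ (fromA w tags i)) (λ j → proj₂ (toB w tags j)) (λ i → proj₂ (fromB w tags i))

      parseWord : Word letterAt → Parsed π
      parseWord (word w tags) = finish w tags (↔⇒≡ (permA w tags)) (↔⇒≡ (permB w tags))

    parseAt : Parsed π
    parseAt = parseWord (wordOf letterAt)

  parse : (π : Permutation′ n) → Increasing132 (π ⟨$⟩ʳ_) → Cube (π ⟨$⟩ʳ_) → Parsed π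
  parse {n} π no132 cube
    with largestSquare (λ e → trans (sym (Perm.inverseˡ π)) (trans (cong (π ⟨$⟩ˡ_) e) (Perm.inverseˡ π)))
           no132 0 n refl (λ _ ())
  ... | m , N , refl , square , increasing = parseAt π no132 cube square increasing

  -- Two decodings live on sets whose sizes are equal only by a proof; comparing by numerical value
  -- avoids transport.
  Same : (Fin k → Fin k) → (Fin n → Fin n) → Set
  Same f h = ∀ x y → toℕ x ≡ toℕ y → toℕ (f x) ≡ toℕ (h y)

  module _ {m N m′ N′} (β : Permutation′ m) (w : Shuffle m m N) (β′ : Permutation′ m′) (w′ : Shuffle m′ m′ N′) where
    private
      module D  = Decoding β w
      module D′ = Decoding β′ w′

    -- An index outside the empty square of the first diagram leaves the square
    -- immediately, whereas one inside the square of the second stays out for two steps.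
    square-maximal : m + N ≡ m′ + N′ → Same D.to D′.to → ¬ m < m′
    square-maximal e same m<m′ = go (D.element x) x≡m
        (subst (m′ ≤_) (sym (same x y x≡y)) (subst (λ z → m′ ≤ toℕ z) (sym (D′.to-P i)) (high _)))
        (subst (m′ ≤_) (sym (same _ _ (same x y x≡y))) (subst (λ z → m′ ≤ toℕ z)
          (sym (trans (cong D′.to (D′.to-P i)) (D′.to-A _))) (high _)))
      where
      i : Fin m′
      i = fromℕ< m<m′
      y : Fin (m′ + N′)
      y = D′.P i
      x : Fin (m + N)
      x = Fin.cast (sym e) y
      x≡y : toℕ x ≡ toℕ y
      x≡y = Finₚ.toℕ-cast (sym e) y
      x≡m : toℕ x ≡ m
      x≡m = trans x≡y (trans (Finₚ.toℕ-↑ˡ i N′) (Finₚ.toℕ-fromℕ< m<m′))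
      high : ∀ p → m′ ≤ toℕ (D′.W p)
      high p = subst (m′ ≤_) (sym (Finₚ.toℕ-↑ʳ m′ p)) (ℕₚ.m≤m+n m′ (toℕ p))
      low : ∀ i → toℕ (D.P i) < m
      low i = subst (_< m) (sym (Finₚ.toℕ-↑ˡ i N)) (Finₚ.toℕ<n i)
      -- The index m is a letter of the first word. An a falls below m after two steps and a b after
      -- one, and a g remains at m, always below m′.
      go : ∀ {x} → D.Element x → toℕ x ≡ m → m′ ≤ toℕ (D.to x) → ¬ m′ ≤ toℕ (D.to (D.to x))
      go (D.inP i) e _ _ = ℕₚ.<⇒≢ (low i) e
      go (D.inA i) e _ h = ℕₚ.<⇒≱ (ℕₚ.<-trans (low _) m<m′)
        (subst (λ z → m′ ≤ toℕ z) (trans (cong D.to (D.to-A i)) (D.to-B i)) h)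
      go (D.inB i) e h _ = ℕₚ.<⇒≱ (ℕₚ.<-trans (low _) m<m′) (subst (λ z → m′ ≤ toℕ z) (D.to-B i) h)
      go (D.inG p g) e h _ = ℕₚ.<⇒≱ m<m′ (ℕₚ.≤-trans (subst (λ z → m′ ≤ toℕ z) (D.to-G g) h) (ℕₚ.≤-reflexive e))

  module _ {m N} (β : Permutation′ m) (w : Shuffle m m N) (β′ : Permutation′ m) (w′ : Shuffle m m N)
           (same : ∀ x → Decoding.to β w x ≡ Decoding.to β′ w′ x) where
    private
      module D  = Decoding β w
      module D′ = Decoding β′ w′

      P≢W : ∀ {i p} → D.P i ≢ D.W p
      P≢W {i} {p} e = Finₚ.<⇒≢ (D.P<W i p) e

      same² : ∀ x → D.to (D.to x) ≡ D′.to (D′.to x)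
      same² x = trans (same _) (cong D′.to (same x))

      A² : ∀ i → D.to (D.to (D.W (posA w i))) ≡ D.P (β ⟨$⟩ʳ i)
      A² i = trans (cong D.to (D.to-A i)) (D.to-B i)

      A²′ : ∀ i → D′.to (D′.to (D.W (posA w′ i))) ≡ D.P (β′ ⟨$⟩ʳ i)
      A²′ i = trans (cong D′.to (D′.to-A i)) (D′.to-B i)

      B²′ : ∀ i → D′.to (D′.to (D.W (posB w′ i))) ≡ D.W (posA w′ (β′ ⟨$⟩ˡ (β′ ⟨$⟩ʳ i)))
      B²′ i = trans (cong D′.to (D′.to-B i)) (D′.to-P _)

      B² : ∀ i → D.to (D.to (D.W (posB w i))) ≡ D.W (posA w (β ⟨$⟩ˡ (β ⟨$⟩ʳ i)))
      B² i = trans (cong D.to (D.to-B i)) (D.to-P _)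

      G² : ∀ {p} → IsG w p → D.to (D.to (D.W p)) ≡ D.W p
      G² g = trans (cong D.to (D.to-G g)) (D.to-G g)

      G²′ : ∀ {p} → IsG w′ p → D′.to (D′.to (D.W p)) ≡ D.W p
      G²′ g = trans (cong D′.to (D′.to-G g)) (D′.to-G g)

      -- The map itself reveals the kind: an a reaches the first m positions in two steps, a b in
      -- one, and a g never.
      same-tag : ∀ {p q} → Kind w p → Kind w′ q → p ≡ q → tag w p ≡ tag w′ q
      same-tag (isA i)   (isA j)   e = trans (tag-posA w i) (sym (tag-posA w′ j))
      same-tag (isB i)   (isB j)   e = trans (tag-posB w i) (sym (tag-posB w′ j))
      same-tag (isG p g) (isG q h) e = trans (tag-G w p g) (sym (tag-G w′ q h))
      same-tag (isA i) (isB j) e = ⊥-elim (P≢W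
        (trans (sym (A² i)) (trans (same² _) (trans (cong (D′.to ∘ D′.to ∘ D.W) e) (B²′ j)))))
      same-tag (isA i) (isG q h) e = ⊥-elim (P≢W
        (trans (sym (A² i)) (trans (same² _) (trans (cong (D′.to ∘ D′.to ∘ D.W) e) (G²′ h)))))
      same-tag (isB i) (isA j) e = ⊥-elim (P≢W
        (trans (sym (A²′ j)) (trans (cong (D′.to ∘ D′.to ∘ D.W) (sym e)) (trans (sym (same² _)) (B² i)))))
      same-tag (isG p g) (isA j) e = ⊥-elim (P≢W
        (trans (sym (A²′ j)) (trans (cong (D′.to ∘ D′.to ∘ D.W) (sym e)) (trans (sym (same² _)) (G² g)))))
      same-tag (isB i) (isG q h) e = ⊥-elim (P≢W
        (trans (sym (D.to-B i)) (trans (same _) (trans (cong (D′.to ∘ D.W) e) (D′.to-G h)))))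
      same-tag (isG p g) (isB j) e = ⊥-elim (P≢W
        (trans (sym (D′.to-B j)) (trans (cong (D′.to ∘ D.W) (sym e)) (trans (sym (same _)) (D.to-G g)))))

    decode-word : w ≡ w′
    decode-word = shuffle-ext w w′ λ p → same-tag (kind w p) (kind w′ p) refl

  decode-permutation : ∀ (β β′ : Permutation′ m) (w : Shuffle m m N) →
    (∀ x → Decoding.to β w x ≡ Decoding.to β′ w x) → ∀ i → β ⟨$⟩ʳ i ≡ β′ ⟨$⟩ʳ i
  decode-permutation {N = N} β β′ w same i = Finₚ.↑ˡ-injective N _ _
    (trans (sym (Decoding.to-B β w i)) (trans (same _) (Decoding.to-B β′ w i)))

  decode-injective : ∀ {m N m′ N′} (β : Permutation′ m) (w : Shuffle m m N) (β′ : Permutation′ m′) (w′ : Shuffle m′ m′ N′) →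
    m + N ≡ m′ + N′ → Same (Decoding.to β w) (Decoding.to β′ w′) →
    m ≡ m′ × letters w ≡ letters w′ × (∀ i j → toℕ i ≡ toℕ j → toℕ (β ⟨$⟩ʳ i) ≡ toℕ (β′ ⟨$⟩ʳ j))
  decode-injective {m} {N} {m′} {N′} β w β′ w′ e same = m≡m′ , equal m≡m′ β w β′ w′ e same
    where
    m≡m′ : m ≡ m′
    m≡m′ with ℕₚ.<-cmp m m′
    ... | tri< p _ _ = ⊥-elim (square-maximal β w β′ w′ e same p)
    ... | tri≈ _ p _ = p
    ... | tri> _ _ p = ⊥-elim (square-maximal β′ w′ β w (sym e) (λ x y q → sym (same y x (sym q))) p)

    equal : ∀ {m m′ N N′} → m ≡ m′ → (β : Permutation′ m) (w : Shuffle m m N) (β′ : Permutation′ m′) (w′ : Shuffle m′ m′ N′) →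
      m + N ≡ m′ + N′ → Same (Decoding.to β w) (Decoding.to β′ w′) →
      letters w ≡ letters w′ × (∀ i j → toℕ i ≡ toℕ j → toℕ (β ⟨$⟩ʳ i) ≡ toℕ (β′ ⟨$⟩ʳ j))
    equal {m} refl β w β′ w′ e same with ℕₚ.+-cancelˡ-≡ m _ _ e
    ... | refl with decode-word β w β′ w′ (λ x → Finₚ.toℕ-injective (same x x refl))
    ...   | refl = refl , λ i j p → cong toℕ (trans
      (decode-permutation β β′ w (λ x → Finₚ.toℕ-injective (same x x refl)) i)
      (cong (β′ ⟨$⟩ʳ_) (Finₚ.toℕ-injective p)))


-- The bijection between permutations and codes

module Enumeration where

  open import Data.Empty using (⊥-elim)
  open import Data.Fin.Base as Fin using (Fin; zero; suc; toℕ)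
  open import Data.Fin.Patterns using (0F; 1F; 2F)
  open import Data.Fin.Permutation as Perm using (Permutation′; _⟨$⟩ʳ_; _⟨$⟩ˡ_; ↔⇒≡)
  import Data.Fin.Properties as Finₚ
  open import Data.List.Base using (List; []; _∷_; length; filter; lookup)
  import Data.List.Membership.Setoid as Membership
  open import Data.List.Membership.Setoid.Properties using (∈-filter⁺)
  open import Data.List.Relation.Unary.All as All using (All)
  open import Data.List.Relation.Unary.All.Properties using (all-filter)
  import Data.List.Relation.Unary.AllPairs as AllPairs
  open import Data.List.Relation.Unary.Any as Any using (here; there)
  open import Data.List.Relation.Unary.Any.Properties using (lookup-index)
  import Data.List.Relation.Unary.Unique.Setoid as Unique
  open import Data.List.Relation.Unary.Unique.Setoid.Properties using (filter⁺)
  open import Data.Nat.Base as ℕ using (ℕ; zero; suc; _+_; _<_; z≤n; s≤s; s<s; z<s)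
  import Data.Nat.Properties as ℕₚ
  open import Data.Product.Base using (Σ; ∃; ∃₂; _×_; _,_; proj₁; proj₂)
  open import Function.Base using (_∘_)
  open import Function.Bundles using (_↔_; mk↔ₛ′; mk⇔; module Equivalence)
  open import Function.Properties.Inverse using (↔-sym; ↔-trans)
  open import Relation.Binary.Bundles using (Setoid)
  open import Relation.Binary.PropositionalEquality using (_≡_; _≢_; refl; sym; trans; cong; cong₂; subst₂)
  open import Relation.Nullary using (yes; no)
  open import Relation.Nullary.Decidable using (_×-dec_)
  open import Relation.Unary using (Pred; Decidable)
  open import Defs using (Avoids; pattern132; CycleLengthsIn; avoids?; cycleLengthsIn?; permutationSetoid; ∈-permutations; permutations-unique; numberAvoiding)
  open GradedFamilies using (Fiber-cong)
  open Codes using (Tree; leaf; node; ∣_∣; weight; flats; Code; size; codeCount; codes-counted)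
  open TreeShapes
  open Words
  open Walks hiding (a; b; g)
  open Parsing

  private variable n : ℕ

  module _ {π : Permutation′ n} where
    private πʳ = π ⟨$⟩ʳ_

    avoids⇒no132 : Avoids pattern132 π → Increasing132 πʳ
    avoids⇒no132 avoids {x} {y} {z} x<y y<z πx<πz πz<πy = avoids (f , inc , ord)
      where
      f : Fin 3 → Fin n
      f 0F = x
      f 1F = y
      f 2F = z
      x<z : x Fin.< z
      x<z = ℕₚ.<-trans x<y y<z
      πx<πy : πʳ x Fin.< πʳ y
      πx<πy = ℕₚ.<-trans πx<πz πz<πy
      inc : ∀ a b → a Fin.< b → f a Fin.< f b
      inc 0F 1F _ = x<y
      inc 0F 2F _ = x<z
      inc 1F 2F _ = y<z
      inc 0F 0F ()
      inc 1F 0F ()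
      inc 1F 1F (s≤s ())
      inc 2F 0F ()
      inc 2F 1F (s≤s ())
      inc 2F 2F (s≤s (s≤s ()))
      ord : ∀ a b → _
      ord 0F 0F = mk⇔ (λ ()) (λ p → ⊥-elim (ℕₚ.<-irrefl refl p))
      ord 0F 1F = mk⇔ (λ _ → πx<πy) (λ _ → z<s)
      ord 0F 2F = mk⇔ (λ _ → πx<πz) (λ _ → z<s)
      ord 1F 0F = mk⇔ (λ ()) (λ p → ⊥-elim (ℕₚ.<-asym p πx<πy))
      ord 1F 1F = mk⇔ (λ { (s≤s (s≤s ())) }) (λ p → ⊥-elim (ℕₚ.<-irrefl refl p))
      ord 1F 2F = mk⇔ (λ { (s≤s ()) }) (λ p → ⊥-elim (ℕₚ.<-asym p πz<πy))
      ord 2F 0F = mk⇔ (λ ()) (λ p → ⊥-elim (ℕₚ.<-asym p πx<πz))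
      ord 2F 1F = mk⇔ (λ _ → πz<πy) (λ _ → s<s z<s)
      ord 2F 2F = mk⇔ (λ { (s≤s ()) }) (λ p → ⊥-elim (ℕₚ.<-irrefl refl p))

    no132⇒avoids : Increasing132 πʳ → Avoids pattern132 π
    no132⇒avoids no132 (f , inc , ord) = no132 (inc 0F 1F z<s) (inc 1F 2F (s<s z<s))
      (Equivalence.to (ord 0F 2F) z<s) (Equivalence.to (ord 2F 1F) (s<s z<s))

    cycles⇒cube : CycleLengthsIn (1 ∷ 3 ∷ []) π → Cube πʳ
    cycles⇒cube cycles i with cycles i
    ... | here (_ , πi≡i , _)          = trans (cong (πʳ ∘ πʳ) πi≡i) (trans (cong πʳ πi≡i) πi≡i)
    ... | there (here (_ , π³i≡i , _)) = π³i≡i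

    cube⇒cycles : Cube πʳ → CycleLengthsIn (1 ∷ 3 ∷ []) π
    cube⇒cycles cube i with πʳ i Finₚ.≟ i
    ... | yes πi≡i = here (z<s , πi≡i , λ { (s≤s z≤n) () })
    ... | no πi≢i  = there (here (z<s , cube i , no-shorter))
      where
      no-shorter : ∀ {m} → m < 3 → 0 < m → _ ≢ i
      no-shorter {suc zero}          _ _ e = πi≢i e
      -- From π² i = i follows π i = π³ i = i.
      no-shorter {suc (suc zero)}    _ _ e = πi≢i (trans (sym (cong πʳ e)) (cube i))
      no-shorter {suc (suc (suc m))} (s≤s (s≤s (s≤s ()))) _ _

  Good : Permutation′ n → Set
  Good π = Increasing132 (π ⟨$⟩ʳ_) × Cube (π ⟨$⟩ʳ_)

  Good-resp : ∀ {π ρ : Permutation′ n} → π Perm.≈ ρ → Good π → Good ρ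
  Good-resp {π = π} {ρ} e (no132 , cube) =
      (λ {x} {y} {z} x<y y<z p q → no132 x<y y<z
        (subst₂ Fin._<_ (sym (e x)) (sym (e z)) p) (subst₂ Fin._<_ (sym (e z)) (sym (e y)) q))
    , λ i → trans (sym (e _)) (trans (cong (π ⟨$⟩ʳ_) (sym (e _)))
        (trans (cong (λ j → π ⟨$⟩ʳ (π ⟨$⟩ʳ j)) (sym (e i))) (cube i)))

  module _ {c ℓ} (S : Setoid c ℓ) where
    open Setoid S renaming (refl to ≈-refl; sym to ≈-sym; trans to ≈-trans)
    open Unique S using (Unique)

    private
      lookup-All : ∀ {p} {P : Pred Carrier p} {xs} → All P xs → ∀ i → P (lookup xs i)
      lookup-All (px All.∷ _)  zero    = px
      lookup-All (_ All.∷ pxs) (suc i) = lookup-All pxs i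

    lookup-injective : ∀ {xs} → Unique xs → ∀ i j → lookup xs i ≈ lookup xs j → i ≡ j
    lookup-injective (_ AllPairs.∷ u) zero    zero    e = refl
    lookup-injective (h AllPairs.∷ u) zero    (suc j) e = ⊥-elim (lookup-All h j e)
    lookup-injective (h AllPairs.∷ u) (suc i) zero    e = ⊥-elim (lookup-All h i (≈-sym e))
    lookup-injective (_ AllPairs.∷ u) (suc i) (suc j) e = cong suc (lookup-injective u i j e)

    module _ {p} {P : Pred Carrier p} (P? : Decidable P) (resp : ∀ {x y} → x ≈ y → P x → P y)
             {xs} (unique : Unique xs) (complete : ∀ x → Membership._∈_ S x xs)
             {X : Set} (f : X → Carrier) (f-P : ∀ a → P (f a))
             (f-injective : ∀ a b → f a ≈ f b → a ≡ b) (f-surjective : ∀ x → P x → ∃ λ a → f a ≈ x) where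

      -- List entries and values of f are compared by ≈, indices and elements of X by ≡. Uniqueness
      -- of the list and injectivity of f turn the former into the latter in the two round trips.
      filter↔ : Fin (length (filter P? xs)) ↔ X
      filter↔ = mk↔ₛ′ to from
        (λ a → f-injective _ _ (≈-trans (to-≈ (from a)) (≈-sym (from-≈ a))))
        (λ i → lookup-injective unique′ _ _ (≈-trans (≈-sym (from-≈ (to i))) (to-≈ i)))
        where
        ys = filter P? xs
        unique′ : Unique ys
        unique′ = filter⁺ S P? unique
        chosen : ∀ i → ∃ λ a → f a ≈ lookup ys i
        chosen i = f-surjective (lookup ys i) (lookup-All (all-filter P? xs) i)
        to : Fin (length ys) → X
        to i = proj₁ (chosen i)
        to-≈ : ∀ i → f (to i) ≈ lookup ys i
        to-≈ i = proj₂ (chosen i)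
        member : ∀ a → Membership._∈_ S (f a) ys
        member a = ∈-filter⁺ S P? resp (complete (f a)) (f-P a)
        from : X → Fin (length ys)
        from a = Any.index (member a)
        from-≈ : ∀ a → f a ≈ lookup ys (from a)
        from-≈ a = lookup-index (member a)

  relabel : ∀ {k n} → k ≡ n → Permutation′ k → Permutation′ n
  relabel refl π = π

  relabel-same : ∀ {k n} (e : k ≡ n) (π : Permutation′ k) → Same (π ⟨$⟩ʳ_) (relabel e π ⟨$⟩ʳ_)
  relabel-same refl π x y p = cong (toℕ ∘ (π ⟨$⟩ʳ_)) (Finₚ.toℕ-injective p)

  relabel-good : ∀ {k n} (e : k ≡ n) (π : Permutation′ k) → Good π → Good (relabel e π)
  relabel-good refl π h = h

  module _ {T} (w : TreeWalk T T) where

    walkPermutation : Permutation′ (∣ T ∣ + width w)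
    walkPermutation = Decoding.decoded (treePermutation T) (expand w)

    walkPermutation-good : Good walkPermutation
    walkPermutation-good =
        Decoding.decoded-no132 (treePermutation T) (expand w) (shape-no132 T shape)
          (expand-level here here w) (expand-contiguousA w shape) (expand-contiguousB w shape)
      , Decoding.cube (treePermutation T) (expand w)
      where
      shape : Shape T (values T)
      shape = treePermutation-shape T

  walkPermutation-injective : ∀ {T U} (v : TreeWalk T T) (w : TreeWalk U U) → ∣ T ∣ + width v ≡ ∣ U ∣ + width w →
    Same (walkPermutation v ⟨$⟩ʳ_) (walkPermutation w ⟨$⟩ʳ_) →
    _≡_ {A = Σ Tree λ T → TreeWalk T T} (T , v) (U , w)
  walkPermutation-injective {T} {U} v w e same
    with decode-injective (treePermutation T) (expand v) (treePermutation U) (expand w) e same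
  ... | m≡ , l≡ , β≡
    with shape-unique T U (treePermutation-shape T) (treePermutation-shape U) m≡ β≡
  ... | refl with expand-injective v w l≡
  ... | refl = refl

  walkPermutation-surjective : (π : Permutation′ n) → Good π →
    ∃₂ λ T (w : TreeWalk T T) → ∣ T ∣ + width w ≡ n × Same (walkPermutation w ⟨$⟩ʳ_) (π ⟨$⟩ʳ_)
  walkPermutation-surjective π (no132 , cube) = go (parse π no132 cube)
    where
    distinct : ∀ {m} (β : Permutation′ m) → Distinct (toℕ ∘ (β ⟨$⟩ʳ_))
    distinct β x<y e = Finₚ.<⇒≢ x<y
      (trans (sym (Perm.inverseˡ β)) (trans (cong (β ⟨$⟩ˡ_) (Finₚ.toℕ-injective e)) (Perm.inverseˡ β)))

    -- The shape determines the relative order, so the inverse of one permutation followed by the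
    -- other is increasing and hence the identity.
    same-shape : ∀ T (β : Permutation′ ∣ T ∣) → Shape T (toℕ ∘ (β ⟨$⟩ʳ_)) → ∀ i → treePermutation T ⟨$⟩ʳ i ≡ β ⟨$⟩ʳ i
    same-shape T β s i = trans (sym (monotone-id σ mono (treePermutation T ⟨$⟩ʳ i)))
                           (cong (β ⟨$⟩ʳ_) (Perm.inverseˡ (treePermutation T)))
      where
      σ : Permutation′ ∣ T ∣
      σ = Perm.flip (treePermutation T) Perm.∘ₚ β
      mono : ∀ {i j} → i Fin.< j → (σ ⟨$⟩ʳ i) Fin.< (σ ⟨$⟩ʳ j)
      mono {i} {j} i<j = shape-order T (treePermutation-shape T) s
        (subst₂ Fin._<_ (sym (Perm.inverseʳ (treePermutation T))) (sym (Perm.inverseʳ (treePermutation T))) i<j)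

    same-decoding : ∀ {m N} (β β′ : Permutation′ m) (w : Shuffle m m N) → (∀ i → β ⟨$⟩ʳ i ≡ β′ ⟨$⟩ʳ i) →
                    ∀ x → Decoding.to β w x ≡ Decoding.to β′ w x
    same-decoding β β′ w e x = step (Decoding.element β w x)
      where
      eˡ : ∀ i → β ⟨$⟩ˡ i ≡ β′ ⟨$⟩ˡ i
      eˡ i = trans (sym (Perm.inverseˡ β′)) (cong (β′ ⟨$⟩ˡ_) (trans (sym (e _)) (Perm.inverseʳ β)))
      step : ∀ {x} → Decoding.Element β w x → Decoding.to β w x ≡ Decoding.to β′ w x
      step (Decoding.inP i)   = trans (Decoding.to-P β w i)
        (trans (cong (Decoding.W β w ∘ posA w) (eˡ i)) (sym (Decoding.to-P β′ w i)))
      step (Decoding.inA i)   = trans (Decoding.to-A β w i) (sym (Decoding.to-A β′ w i))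
      step (Decoding.inB i)   = trans (Decoding.to-B β w i)
        (trans (cong (Decoding.P β w) (e i)) (sym (Decoding.to-B β′ w i)))
      step (Decoding.inG p h) = trans (Decoding.to-G β w h) (sym (Decoding.to-G β′ w h))

    fromShape : ∀ {m N} {π : Permutation′ (m + N)} (β : Permutation′ m) (w : Shuffle m m N) → Level w →
      Contiguous (toℕ ∘ (β ⟨$⟩ʳ_)) (posA w) → Contiguous (toℕ ∘ (β ⟨$⟩ʳ_)) (posB w) →
      (∀ x → Decoding.to β w x ≡ π ⟨$⟩ʳ x) → ∀ {f} → (∀ i → f i ≡ toℕ (β ⟨$⟩ʳ i)) → HasShape m f →
      ∃₂ λ T (w : TreeWalk T T) → ∣ T ∣ + width w ≡ m + N × Same (walkPermutation w ⟨$⟩ʳ_) (π ⟨$⟩ʳ_)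
    fromShape {N = N} {π} β w level cA cB agrees {f} f≡ (has T s) = fromExpansion {π = π} (parseWalk N ℕₚ.≤-refl here here s′ s′ w level cA cB) agrees
      where
      s′ : Shape T (toℕ ∘ (β ⟨$⟩ʳ_))
      s′ = shape-resp T {f} (λ {x} {y} → subst₂ _<_ (f≡ x) (f≡ y)) s
      fromExpansion : ∀ {N} {π : Permutation′ (∣ T ∣ + N)} {w : Shuffle ∣ T ∣ ∣ T ∣ N} → Expansion T T w →
        (∀ x → Decoding.to β w x ≡ π ⟨$⟩ʳ x) →
        ∃₂ λ U (v : TreeWalk U U) → ∣ U ∣ + width v ≡ ∣ T ∣ + N × Same (walkPermutation v ⟨$⟩ʳ_) (π ⟨$⟩ʳ_)
      fromExpansion {π = π} (expansion v) agrees = T , v , refl , λ x y p → cong toℕ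
        (trans (same-decoding (treePermutation T) β (expand v) (same-shape T β s′) x)
          (trans (agrees x) (cong (π ⟨$⟩ʳ_) (Finₚ.toℕ-injective p))))

    go : ∀ {n} {π : Permutation′ n} → Parsed π →
         ∃₂ λ T (w : TreeWalk T T) → ∣ T ∣ + width w ≡ n × Same (walkPermutation w ⟨$⟩ʳ_) (π ⟨$⟩ʳ_)
    go {π = π} (parsed {m} β w β-no132 level cA cB agrees) =
      fromShape {π = π} β w level cA cB agrees (λ _ → refl) (no132-shape m (toℕ ∘ (β ⟨$⟩ʳ_)) (distinct β) β-no132)

  weight-eq : ∀ T → weight T ≡ ∣ T ∣ + (∣ T ∣ + ∣ T ∣)
  weight-eq leaf       = refl
  weight-eq (node L R) = trans (cong (3 +_) (cong₂ _+_ (weight-eq L) (weight-eq R))) (solve-∀′ ∣ L ∣ ∣ R ∣)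
    where
    open import Data.Nat.Solver using (module +-*-Solver)
    open +-*-Solver
    solve-∀′ : ∀ l r → 3 + ((l + (l + l)) + (r + (r + r))) ≡ suc (l + r) + (suc (l + r) + suc (l + r))
    solve-∀′ = solve 2 (λ l r → con 3 :+ ((l :+ (l :+ l)) :+ (r :+ (r :+ r)))
      := (con 1 :+ (l :+ r)) :+ ((con 1 :+ (l :+ r)) :+ (con 1 :+ (l :+ r)))) refl

  total-width : ∀ {T} (w : TreeWalk T T) → ∣ T ∣ + width w ≡ weight T + flats (toWalk w)
  total-width {T} w = begin
    ∣ T ∣ + width w                                ≡⟨ cong (∣ T ∣ +_) (width-eq w) ⟩
    ∣ T ∣ + (∣ T ∣ + ∣ T ∣ + flats (toWalk w))     ≡⟨ ℕₚ.+-assoc ∣ T ∣ (∣ T ∣ + ∣ T ∣) (flats (toWalk w)) ⟨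
    ∣ T ∣ + (∣ T ∣ + ∣ T ∣) + flats (toWalk w)     ≡⟨ cong (_+ flats (toWalk w)) (weight-eq T) ⟨
    weight T + flats (toWalk w)                    ∎
    where open Relation.Binary.PropositionalEquality.≡-Reasoning

  -- At height 0 both letters run through the spine of the same tree.
  code↔walk : Code 0 ↔ (Σ Tree λ T → TreeWalk T T)
  code↔walk = mk↔ₛ′
    (λ { (T , _ , refl , w) → T , fromWalk T T w })
    (λ (T , w) → T , _ , refl , toWalk w)
    (λ (T , w) → cong (T ,_) (fromWalk-toWalk w))
    (λ { (T , _ , refl , w) → cong (λ w → T , _ , refl , w) (toWalk-fromWalk T T w) })

  module _ (n : ℕ) where

    private
      Walks : Set
      Walks = ∃ λ ((T , w) : Σ Tree λ T → TreeWalk T T) → weight T + flats (toWalk w) ≡ n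

      total : (x : Walks) → ∣ proj₁ (proj₁ x) ∣ + width (proj₂ (proj₁ x)) ≡ n
      total ((T , w) , e) = trans (total-width w) e

      toPermutation : Walks → Permutation′ n
      toPermutation x@((T , w) , _) = relabel (total x) (walkPermutation w)

      toPermutation-same : ∀ x → Same (walkPermutation (proj₂ (proj₁ x)) ⟨$⟩ʳ_) (toPermutation x ⟨$⟩ʳ_)
      toPermutation-same x@((T , w) , _) = relabel-same (total x) (walkPermutation w)

      good : ∀ x → Good (toPermutation x)
      good x@((T , w) , _) = relabel-good (total x) (walkPermutation w) (walkPermutation-good w)

      injective : ∀ x y → toPermutation x Perm.≈ toPermutation y → x ≡ y
      injective x@((T , v) , p) y@((U , w) , q) e = lift
        (walkPermutation-injective v w (trans (total x) (sym (total y))) λ i j i≡j → trans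
          (toPermutation-same x i (k i) (sym (Finₚ.toℕ-cast (total x) i)))
          (trans (cong toℕ (e (k i)))
            (sym (toPermutation-same y j (k i) (trans (sym i≡j) (sym (Finₚ.toℕ-cast (total x) i)))))))
        where
        -- Both decodings are compared through `Fin n`, where the hypothesis e is stated.
        k : Fin (∣ T ∣ + width v) → Fin n
        k = Fin.cast (total x)
        lift : proj₁ x ≡ proj₁ y → x ≡ y
        lift refl = cong (_ ,_) (ℕₚ.≡-irrelevant p q)

      surjective : ∀ π → Good π → ∃ λ x → toPermutation x Perm.≈ π
      surjective π h with walkPermutation-surjective π h
      ... | T , w , e , same = x , λ i → Finₚ.toℕ-injective (trans
          (sym (toPermutation-same x (k i) i (Finₚ.toℕ-cast (sym e) i)))
          (same (k i) i (Finₚ.toℕ-cast (sym e) i)))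
        where
        x : Walks
        x = (T , w) , trans (sym (total-width w)) e
        k : Fin n → Fin (∣ T ∣ + width w)
        k = Fin.cast (sym e)

      Counted : Permutation′ n → Set
      Counted π = Avoids pattern132 π × CycleLengthsIn (1 ∷ 3 ∷ []) π

      counted⇒good : ∀ {π} → Counted π → Good π
      counted⇒good {π} (a , c) = avoids⇒no132 {π = π} a , cycles⇒cube {π = π} c

      good⇒counted : ∀ {π} → Good π → Counted π
      good⇒counted {π} (h , c) = no132⇒avoids {π = π} h , cube⇒cycles {π = π} c

      sizes : ∀ c → weight (proj₁ (Function.Bundles.Inverse.to code↔walk c)) +
                    flats (toWalk (proj₂ (Function.Bundles.Inverse.to code↔walk c))) ≡ size c
      sizes (T , _ , refl , w) = cong (λ w → weight T + flats w) (toWalk-fromWalk T T w)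

    numberAvoiding≡codeCount : numberAvoiding pattern132 (1 ∷ 3 ∷ []) n ≡ codeCount 0 n
    numberAvoiding≡codeCount = ↔⇒≡ (↔-trans
      (filter↔ (permutationSetoid n) (λ π → avoids? pattern132 π ×-dec cycleLengthsIn? (1 ∷ 3 ∷ []) π)
        (λ {π} {ρ} e h → good⇒counted {ρ} (Good-resp {π = π} {ρ} e (counted⇒good {π} h)))
        (permutations-unique n) (∈-permutations {n})
        toPermutation (λ x → good⇒counted {toPermutation x} (good x)) injective
        (λ π h → surjective π (counted⇒good {π} h)))
      (↔-trans (↔-sym (Fiber-cong code↔walk sizes n)) (codes-counted 0 n)))


open import Defs
open import Data.List.Base using ([]; _∷_)
open import Data.Nat.Base using (nonZero)
open import Data.Product.Base using (_×_)
open import Relation.Binary.PropositionalEquality using (refl)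
open import Relation.Binary.PropositionalEquality using (cong; sym; trans)
open GeneratingFunctions using (fromℕ; fromℕ-/1; generating-forms; codeSeries-equations)
open Enumeration using (numberAvoiding≡codeCount)

theorem4p9 : (A132 (1 ∷ 3 ∷ []) ≈ (# 1 / (# 1 - z)) * F ⟨ # 2 / (# 1 - z) , c[z³] - # 1 ⟩[ refl ])
    × (A132 (1 ∷ 3 ∷ []) ≈ c[z³] / (√ (c[z³] * (# 4 - # 3 * c[z³])) refl - z * c[z³]))
theorem4p9 = generating-forms codeSeries-equations λ n →
  trans (sym (fromℕ-/1 _)) (cong fromℕ (numberAvoiding≡codeCount n))
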